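{- The minimal co-factor set of $T_6 \cap P_{1,7}$ is $$\Lambda(6,1,7) = \{x^2 - x + 1,\ x^2 + 1,\ x^2 + 2x + 1\}.$$
   Context: A Salem number is a real algebraic integer $\beta>1$ whose other Galois conjugates all satisfy $|\alpha|\le 1$, with at least one satisfying $|\alpha|=1$. For real $\beta>1$, the greedy beta expansion $d_\beta(1)=(c_n)_{n\ge1}$ is defined by $r_0=1$, and for $n\ge 1$: $c_n=\lfloor \beta r_{n-1}\rfloor$, $r_n=\beta r_{n-1}-\lfloor \beta r_{n-1}\rfloor$. If it is eventually periodic, $\beta$ is called a Parry number, and the smallest $m\ge0$ and $p\ge1$ with $c_{n+m}=c_{n+m+p}$ for all $n\ge1$ are the preperiod length and the period length of the expansion. (By convention $p=0$ if $r_N=0$ for some $N$; this never happens for Salem numbers.) For a Salem number $\beta$ that is a Parry number with preperiod length $m$ and period length $p\geq 1$, put $P_k(x)=x^k-c_1x^{k-1}-\dots-c_k$. The companion polynomial is $R(x)=P_{m+p}(x)-P_m(x)$; it has $\beta$ as a root, so $R(x)=P(x)Q(x)$ with $P$ the minimal polynomial of $\beta$ and $Q\in\mathbb{Z}[x]$; $Q$ is the co-factor of $\beta$. $T_n$ denotes the set of all Salem numbers of degree $n$. $P_{m,p}$ denotes the set of Salem Parry numbers whose beta expansion $d_\beta(1)$ has preperiod length $m$ and period length $p$. $C_{Q(x)}$ denotes the set of all Salem (Parry) numbers whose co-factor is $Q(x)$. The minimal co-factor set $\Lambda(n,m,p)\subseteq\mathbb{Z}[x]$ of $T_n\cap P_{m,p}$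 is the minimal set (with respect to inclusion) $\Lambda$ satisfying $T_n\cap P_{m,p}=P_{m,p}\cap\bigl(\bigcup_{q(x)\in\Lambda}C_{q(x)}\bigr)$ when the members are understood as co-factors of elements of $T_n\cap P_{m,p}$; i.e. it is the set of all co-factors of elements of $T_n\cap P_{m,p}$. -}

module Defs where

open import Algebra.Bundles.Raw using (RawRing)
open import Data.Integer.Base as ℤ using (ℤ)
open import Data.List.Base using (List; []; _∷_; map; foldr)
open import Data.Nat.Base as ℕ using (ℕ; zero; suc)
import Data.Nat.Properties as ℕ
open import Data.Product.Base using (∃-syntax; _×_; _,_)
open import Data.Rational.Base as ℚ using (ℚ; 0ℚ; 1ℚ; ½; ∣_∣)
import Data.Rational.Properties as ℚ
open import Data.Rational.Solver using (module +-*-Solver)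
open import Level using (0ℓ)
open import Relation.Binary.PropositionalEquality
  using (_≡_; refl; sym; cong; subst)
open import Relation.Nullary.Negation using (¬_)
open import Relation.Unary using (Pred; _∈_; _∩_)

------------------------------------------------------------------------
-- Real numbers: Cauchy sequences of rationals with pointwise operations,
-- taken up to _≈ᵣ_ ("the difference tends to 0").

IsCauchy : (ℕ → ℚ) → Set
IsCauchy x = ∀ ε → 0ℚ ℚ.< ε →
  ∃[ N ] (∀ m n → N ℕ.≤ m → N ℕ.≤ n → ∣ x m ℚ.- x n ∣ ℚ.< ε)

record ℝ : Set where
  constructor mkℝ
  field
    seq    : ℕ → ℚ
    cauchy : IsCauchy seq

open ℝ public

constant-cauchy : ∀ q → IsCauchy (λ _ → q)
constant-cauchy q ε 0<ε = 0 , λ _ _ _ _ →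
  subst (ℚ._< ε) (sym (cong ∣_∣ (ℚ.+-inverseʳ q))) 0<ε

neg-cauchy : ∀ x → IsCauchy x → IsCauchy (λ n → ℚ.- x n)
neg-cauchy x cx ε 0<ε with cx ε 0<ε
... | N , h = N , λ m n N≤m N≤n → begin-strict
  ∣ (ℚ.- x m) ℚ.- (ℚ.- x n) ∣  ≡⟨ cong ∣_∣ (ℚ.neg-distrib-+ (x m) (ℚ.- x n)) ⟨
  ∣ ℚ.- (x m ℚ.- x n) ∣        ≡⟨ ℚ.∣-p∣≡∣p∣ (x m ℚ.- x n) ⟩
  ∣ x m ℚ.- x n ∣              <⟨ h m n N≤m N≤n ⟩
  ε                            ∎
  where open ℚ.≤-Reasoning

+-cauchy : ∀ x y → IsCauchy x → IsCauchy y → IsCauchy (λ n → x n ℚ.+ y n)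
+-cauchy x y cx cy ε 0<ε = go (cx δ 0<δ) (cy δ 0<δ)
  where
  open ℚ.≤-Reasoning

  δ : ℚ
  δ = ½ ℚ.* ε

  0<δ : 0ℚ ℚ.< δ
  0<δ = ℚ.*-monoʳ-<-pos ½ 0<ε

  δ+δ≡ε : δ ℚ.+ δ ≡ ε
  δ+δ≡ε = begin-equality
    ½ ℚ.* ε ℚ.+ ½ ℚ.* ε  ≡⟨ ℚ.*-distribʳ-+ ε ½ ½ ⟨
    1ℚ ℚ.* ε             ≡⟨ ℚ.*-identityˡ ε ⟩
    ε                    ∎

  rearrange : ∀ a b c d → (a ℚ.+ b) ℚ.- (c ℚ.+ d) ≡ (a ℚ.- c) ℚ.+ (b ℚ.- d)
  rearrange = solve 4 (λ a b c d →
    (a :+ b) :- (c :+ d) := (a :- c) :+ (b :- d)) refl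
    where open +-*-Solver

  go : ∃[ N ] (∀ m n → N ℕ.≤ m → N ℕ.≤ n → ∣ x m ℚ.- x n ∣ ℚ.< δ) →
       ∃[ N ] (∀ m n → N ℕ.≤ m → N ℕ.≤ n → ∣ y m ℚ.- y n ∣ ℚ.< δ) →
       ∃[ N ] (∀ m n → N ℕ.≤ m → N ℕ.≤ n →
               ∣ (x m ℚ.+ y m) ℚ.- (x n ℚ.+ y n) ∣ ℚ.< ε)
  go (M , hx) (N , hy) = M ℕ.⊔ N , λ m n ≤m ≤n → begin-strict
    ∣ (x m ℚ.+ y m) ℚ.- (x n ℚ.+ y n) ∣
      ≡⟨ cong ∣_∣ (rearrange (x m) (y m) (x n) (y n)) ⟩
    ∣ (x m ℚ.- x n) ℚ.+ (y m ℚ.- y n) ∣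
      ≤⟨ ℚ.∣p+q∣≤∣p∣+∣q∣ (x m ℚ.- x n) (y m ℚ.- y n) ⟩
    ∣ x m ℚ.- x n ∣ ℚ.+ ∣ y m ℚ.- y n ∣
      <⟨ ℚ.+-mono-< (hx m n (ℕ.m⊔n≤o⇒m≤o M N ≤m) (ℕ.m⊔n≤o⇒m≤o M N ≤n))
                    (hy m n (ℕ.m⊔n≤o⇒n≤o M N ≤m) (ℕ.m⊔n≤o⇒n≤o M N ≤n)) ⟩
    δ ℚ.+ δ
      ≡⟨ δ+δ≡ε ⟩
    ε ∎

cauchy-bounded : ∀ x → IsCauchy x →
  ∃[ B ] ∃[ N ] (0ℚ ℚ.< B × (∀ n → N ℕ.≤ n → ∣ x n ∣ ℚ.≤ B))
cauchy-bounded x cx with cx 1ℚ (ℚ.positive⁻¹ 1ℚ)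
... | N , h = ∣ x N ∣ ℚ.+ 1ℚ , N
  , ℚ.+-mono-≤-< (ℚ.0≤∣p∣ (x N)) (ℚ.positive⁻¹ 1ℚ)
  , λ n N≤n → begin
    ∣ x n ∣                          ≡⟨ cong ∣_∣ (split (x n) (x N)) ⟩
    ∣ x N ℚ.+ (x n ℚ.- x N) ∣        ≤⟨ ℚ.∣p+q∣≤∣p∣+∣q∣ (x N) (x n ℚ.- x N) ⟩
    ∣ x N ∣ ℚ.+ ∣ x n ℚ.- x N ∣      <⟨ ℚ.+-monoʳ-< ∣ x N ∣ (h n N N≤n ℕ.≤-refl) ⟩
    ∣ x N ∣ ℚ.+ 1ℚ                   ∎
  where
  open ℚ.≤-Reasoning

  split : ∀ a b → a ≡ b ℚ.+ (a ℚ.- b)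
  split = solve 2 (λ a b → a := b :+ (a :- b)) refl
    where open +-*-Solver

*-modulus : ∀ {A B ε} → 0ℚ ℚ.< A → 0ℚ ℚ.< B → 0ℚ ℚ.< ε →
  ∃[ δ ] (0ℚ ℚ.< δ × A ℚ.* δ ℚ.+ B ℚ.* δ ≡ ε)
*-modulus {A} {B} {ε} 0<A 0<B 0<ε = go (A ℚ.+ B) refl (ℚ.+-mono-< 0<A 0<B)
  where
  open ℚ.≤-Reasoning

  go : ∀ S → S ≡ A ℚ.+ B → 0ℚ ℚ.< S →
       ∃[ δ ] (0ℚ ℚ.< δ × A ℚ.* δ ℚ.+ B ℚ.* δ ≡ ε)
  go S S≡A+B 0<S = S⁻¹ ℚ.* ε , ℚ.positive⁻¹ (S⁻¹ ℚ.* ε) {{δ-pos}} , (begin-equality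
    A ℚ.* (S⁻¹ ℚ.* ε) ℚ.+ B ℚ.* (S⁻¹ ℚ.* ε)  ≡⟨ ℚ.*-distribʳ-+ (S⁻¹ ℚ.* ε) A B ⟨
    (A ℚ.+ B) ℚ.* (S⁻¹ ℚ.* ε)                ≡⟨ cong (ℚ._* (S⁻¹ ℚ.* ε)) S≡A+B ⟨
    S ℚ.* (S⁻¹ ℚ.* ε)                        ≡⟨ ℚ.*-assoc S S⁻¹ ε ⟨
    S ℚ.* S⁻¹ ℚ.* ε                          ≡⟨ cong (ℚ._* ε) (ℚ.*-inverseʳ S {{S≢0}}) ⟩
    1ℚ ℚ.* ε                                 ≡⟨ ℚ.*-identityˡ ε ⟩
    ε                                        ∎)
    where
    S≢0 : ℚ.NonZero S
    S≢0 = ℚ.pos⇒nonZero S {{ℚ.positive 0<S}}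

    S⁻¹ : ℚ
    S⁻¹ = ℚ.1/_ S {{S≢0}}

    δ-pos : ℚ.Positive (S⁻¹ ℚ.* ε)
    δ-pos = ℚ.pos*pos⇒pos S⁻¹ {{ℚ.1/pos⇒pos S {{ℚ.positive 0<S}}}}
                          ε   {{ℚ.positive 0<ε}}

∣*∣-bound : ∀ p q {P Q} → 0ℚ ℚ.< P →
  ∣ p ∣ ℚ.≤ P → ∣ q ∣ ℚ.< Q → ∣ p ℚ.* q ∣ ℚ.< P ℚ.* Q
∣*∣-bound p q {P} {Q} 0<P p≤P q<Q = begin-strict
  ∣ p ℚ.* q ∣      ≡⟨ ℚ.∣p*q∣≡∣p∣*∣q∣ p q ⟩
  ∣ p ∣ ℚ.* ∣ q ∣  ≤⟨ ℚ.*-monoʳ-≤-nonNeg ∣ q ∣ {{ℚ.∣-∣-nonNeg q}} p≤P ⟩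
  P ℚ.* ∣ q ∣      <⟨ ℚ.*-monoʳ-<-pos P {{ℚ.positive 0<P}} q<Q ⟩
  P ℚ.* Q          ∎
  where open ℚ.≤-Reasoning

∣+∣-bound : ∀ p q {P Q} → ∣ p ∣ ℚ.< P → ∣ q ∣ ℚ.< Q → ∣ p ℚ.+ q ∣ ℚ.< P ℚ.+ Q
∣+∣-bound p q p<P q<Q =
  ℚ.≤-<-trans (ℚ.∣p+q∣≤∣p∣+∣q∣ p q) (ℚ.+-mono-< p<P q<Q)

*-difference : ∀ a b c d →
  a ℚ.* b ℚ.- c ℚ.* d ≡ a ℚ.* (b ℚ.- d) ℚ.+ d ℚ.* (a ℚ.- c)
*-difference = solve 4 (λ a b c d →
  a :* b :- c :* d := a :* (b :- d) :+ d :* (a :- c)) refl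
  where open +-*-Solver

*-distance : ∀ a b c d {A B δ} → 0ℚ ℚ.< A → 0ℚ ℚ.< B →
  ∣ a ∣ ℚ.≤ A → ∣ d ∣ ℚ.≤ B → ∣ a ℚ.- c ∣ ℚ.< δ → ∣ b ℚ.- d ∣ ℚ.< δ →
  ∣ a ℚ.* b ℚ.- c ℚ.* d ∣ ℚ.< A ℚ.* δ ℚ.+ B ℚ.* δ
*-distance a b c d {A} {B} {δ} 0<A 0<B a≤A d≤B a-c<δ b-d<δ =
  subst (λ z → ∣ z ∣ ℚ.< A ℚ.* δ ℚ.+ B ℚ.* δ) (sym (*-difference a b c d))
    (∣+∣-bound (a ℚ.* (b ℚ.- d)) (d ℚ.* (a ℚ.- c)) {A ℚ.* δ} {B ℚ.* δ}
      (∣*∣-bound a (b ℚ.- d) {A} {δ} 0<A a≤A b-d<δ)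
      (∣*∣-bound d (a ℚ.- c) {B} {δ} 0<B d≤B a-c<δ))

-- Helpers instead of `with`, which normalises the products in the goal and
-- makes checking blow up.
*-cauchy : ∀ x y → IsCauchy x → IsCauchy y → IsCauchy (λ n → x n ℚ.* y n)
*-cauchy x y cx cy ε 0<ε = bound (cauchy-bounded x cx) (cauchy-bounded y cy)
  where
  Goal : Set
  Goal = ∃[ N ] (∀ m n → N ℕ.≤ m → N ℕ.≤ n →
                 ∣ x m ℚ.* y m ℚ.- x n ℚ.* y n ∣ ℚ.< ε)

  close : ∀ {A K B L δ} →
    0ℚ ℚ.< A → (∀ n → K ℕ.≤ n → ∣ x n ∣ ℚ.≤ A) →
    0ℚ ℚ.< B → (∀ n → L ℕ.≤ n → ∣ y n ∣ ℚ.≤ B) →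
    A ℚ.* δ ℚ.+ B ℚ.* δ ≡ ε →
    ∃[ M ] (∀ m n → M ℕ.≤ m → M ℕ.≤ n → ∣ x m ℚ.- x n ∣ ℚ.< δ) →
    ∃[ N ] (∀ m n → N ℕ.≤ m → N ℕ.≤ n → ∣ y m ℚ.- y n ∣ ℚ.< δ) →
    Goal
  close {A} {K} {B} {L} {δ} 0<A x≤A 0<B y≤B Aδ+Bδ≡ε (M , hx) (N , hy) =
    (K ℕ.⊔ L) ℕ.⊔ (M ℕ.⊔ N) , λ m n ≤m ≤n →
    let KL≤m = ℕ.m⊔n≤o⇒m≤o (K ℕ.⊔ L) (M ℕ.⊔ N) ≤m
        KL≤n = ℕ.m⊔n≤o⇒m≤o (K ℕ.⊔ L) (M ℕ.⊔ N) ≤n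
        MN≤m = ℕ.m⊔n≤o⇒n≤o (K ℕ.⊔ L) (M ℕ.⊔ N) ≤m
        MN≤n = ℕ.m⊔n≤o⇒n≤o (K ℕ.⊔ L) (M ℕ.⊔ N) ≤n
    in subst (∣ x m ℚ.* y m ℚ.- x n ℚ.* y n ∣ ℚ.<_) Aδ+Bδ≡ε
         (*-distance (x m) (y m) (x n) (y n) {A} {B} {δ} 0<A 0<B
           (x≤A m (ℕ.m⊔n≤o⇒m≤o K L KL≤m))
           (y≤B n (ℕ.m⊔n≤o⇒n≤o K L KL≤n))
           (hx m n (ℕ.m⊔n≤o⇒m≤o M N MN≤m) (ℕ.m⊔n≤o⇒m≤o M N MN≤n))
           (hy m n (ℕ.m⊔n≤o⇒n≤o M N MN≤m) (ℕ.m⊔n≤o⇒n≤o M N MN≤n)))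

  bound : ∃[ A ] ∃[ K ] (0ℚ ℚ.< A × (∀ n → K ℕ.≤ n → ∣ x n ∣ ℚ.≤ A)) →
          ∃[ B ] ∃[ L ] (0ℚ ℚ.< B × (∀ n → L ℕ.≤ n → ∣ y n ∣ ℚ.≤ B)) →
          Goal
  bound (A , K , 0<A , x≤A) (B , L , 0<B , y≤B) =
    let (δ , 0<δ , Aδ+Bδ≡ε) = *-modulus {A} {B} {ε} 0<A 0<B 0<ε
    in close {A} {K} {B} {L} {δ} 0<A x≤A 0<B y≤B Aδ+Bδ≡ε (cx δ 0<δ) (cy δ 0<δ)

infix  8 -ᵣ_
infixl 7 _*ᵣ_
infixl 6 _+ᵣ_ _-ᵣ_
infix  4 _≈ᵣ_ _<ᵣ_ _≤ᵣ_

fromℚ : ℚ → ℝ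
fromℚ q = mkℝ (λ _ → q) (constant-cauchy q)

fromℤ : ℤ → ℝ
fromℤ k = fromℚ (k ℚ./ 1)

0ᵣ 1ᵣ : ℝ
0ᵣ = fromℚ 0ℚ
1ᵣ = fromℚ 1ℚ

_+ᵣ_ : ℝ → ℝ → ℝ
x +ᵣ y = mkℝ (λ n → seq x n ℚ.+ seq y n) (+-cauchy (seq x) (seq y) (cauchy x) (cauchy y))

_*ᵣ_ : ℝ → ℝ → ℝ
x *ᵣ y = mkℝ (λ n → seq x n ℚ.* seq y n) (*-cauchy (seq x) (seq y) (cauchy x) (cauchy y))

-ᵣ_ : ℝ → ℝ
-ᵣ x = mkℝ (λ n → ℚ.- seq x n) (neg-cauchy (seq x) (cauchy x))

_-ᵣ_ : ℝ → ℝ → ℝ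
x -ᵣ y = x +ᵣ (-ᵣ y)

_≈ᵣ_ : ℝ → ℝ → Set
x ≈ᵣ y = ∀ ε → 0ℚ ℚ.< ε →
  ∃[ N ] (∀ n → N ℕ.≤ n → ∣ seq x n ℚ.- seq y n ∣ ℚ.< ε)

_<ᵣ_ : ℝ → ℝ → Set
x <ᵣ y = ∃[ ε ] (0ℚ ℚ.< ε ×
  ∃[ N ] (∀ n → N ℕ.≤ n → seq x n ℚ.+ ε ℚ.≤ seq y n))

_≤ᵣ_ : ℝ → ℝ → Set
x ≤ᵣ y = ¬ (y <ᵣ x)

ℝ-rawRing : RawRing 0ℓ 0ℓ
ℝ-rawRing = record
  { Carrier = ℝ ; _≈_ = _≈ᵣ_ ; _+_ = _+ᵣ_ ; _*_ = _*ᵣ_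
  ; -_ = -ᵣ_ ; 0# = 0ᵣ ; 1# = 1ᵣ }

IsFloor : ℝ → ℤ → Set
IsFloor x k = fromℤ k ≤ᵣ x × x <ᵣ fromℤ (ℤ.suc k)

------------------------------------------------------------------------
-- Complex numbers

record ℂ : Set where
  constructor _+i_
  field
    re im : ℝ

open ℂ public

infix 4 _≈ᶜ_

_≈ᶜ_ : ℂ → ℂ → Set
z ≈ᶜ w = re z ≈ᵣ re w × im z ≈ᵣ im w

ofℝ : ℝ → ℂ
ofℝ x = x +i 0ᵣ

ℂ-rawRing : RawRing 0ℓ 0ℓ
ℂ-rawRing = record
  { Carrier = ℂ
  ; _≈_     = _≈ᶜ_
  ; _+_     = λ z w → (re z +ᵣ re w) +i (im z +ᵣ im w)
  ; _*_     = λ z w → (re z *ᵣ re w -ᵣ im z *ᵣ im w)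
                      +i (re z *ᵣ im w +ᵣ im z *ᵣ re w)
  ; -_      = λ z → (-ᵣ re z) +i (-ᵣ im z)
  ; 0#      = ofℝ 0ᵣ
  ; 1#      = ofℝ 1ᵣ
  }

-- |z|², so that |z| ≤ 1 and |z| = 1 read ∣ z ∣² ≤ᵣ 1 and ∣ z ∣² ≈ᵣ 1.
∣_∣² : ℂ → ℝ
∣ z ∣² = re z *ᵣ re z +ᵣ im z *ᵣ im z

------------------------------------------------------------------------
-- Polynomials: coefficient lists, constant term first.  Trailing zeros
-- are allowed, so polynomials are compared by _≈ₚ_.

module Polynomial {c ℓ} (R : RawRing c ℓ) where
  open RawRing R

  infix  8 -ₚ_
  infixl 7 _*ₚ_
  infixl 6 _+ₚ_ _-ₚ_
  infix  4 _≈ₚ_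

  Poly : Set c
  Poly = List Carrier

  coeff : Poly → ℕ → Carrier
  coeff []      _       = 0#
  coeff (a ∷ f) zero    = a
  coeff (a ∷ f) (suc n) = coeff f n

  _≈ₚ_ : Poly → Poly → Set ℓ
  f ≈ₚ g = ∀ n → coeff f n ≈ coeff g n

  _+ₚ_ : Poly → Poly → Poly
  []      +ₚ g       = g
  (a ∷ f) +ₚ []      = a ∷ f
  (a ∷ f) +ₚ (b ∷ g) = a + b ∷ f +ₚ g

  -ₚ_ : Poly → Poly
  -ₚ_ = map (-_)

  _-ₚ_ : Poly → Poly → Poly
  f -ₚ g = f +ₚ (-ₚ g)

  _*ₚ_ : Poly → Poly → Poly
  []      *ₚ g = []
  (a ∷ f) *ₚ g = map (a *_) g +ₚ (0# ∷ f *ₚ g)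

  HasDegree : Poly → ℕ → Set ℓ
  HasDegree f d = ¬ (coeff f d ≈ 0#) × (∀ k → d ℕ.< k → coeff f k ≈ 0#)

  Monic : Poly → Set ℓ
  Monic f = ∃[ d ] (coeff f d ≈ 1# × (∀ k → d ℕ.< k → coeff f k ≈ 0#))

  eval : Poly → Carrier → Carrier
  eval f x = foldr (λ a v → a + x * v) 0# f

open Polynomial ℤ.+-*-rawRing public
  using (_≈ₚ_; _+ₚ_; -ₚ_; _-ₚ_; _*ₚ_; Monic)
  renaming (Poly to ℤ[x]; coeff to coeffℤ; HasDegree to HasDegreeℤ)

open Polynomial ℚ.+-*-rawRing public
  using ()
  renaming (Poly to ℚ[x]; coeff to coeffℚ; HasDegree to HasDegreeℚ)

evalℤ : ℤ[x] → ℝ → ℝ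
evalℤ f = Polynomial.eval ℝ-rawRing (map fromℤ f)

evalℚ : ℚ[x] → ℝ → ℝ
evalℚ f = Polynomial.eval ℝ-rawRing (map fromℚ f)

evalℂ : ℤ[x] → ℂ → ℂ
evalℂ f = Polynomial.eval ℂ-rawRing (map (λ k → ofℝ (fromℤ k)) f)

------------------------------------------------------------------------
-- Salem numbers

IsAlgebraicInteger : Pred ℝ 0ℓ
IsAlgebraicInteger β = ∃[ F ] (Monic F × evalℤ F β ≈ᵣ 0ᵣ)

-- P is the minimal polynomial over ℚ of the algebraic integer β; it has
-- integer coefficients, so it is represented in ℤ[x].
IsMinPoly : ℝ → ℤ[x] → Set
IsMinPoly β P =
  Monic P × evalℤ P β ≈ᵣ 0ᵣ ×
  (∀ (F : ℚ[x]) d e → HasDegreeℤ P d → HasDegreeℚ F e →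
     evalℚ F β ≈ᵣ 0ᵣ → d ℕ.≤ e)

IsOtherConjugate : ℝ → ℂ → Set
IsOtherConjugate β α =
  ¬ (α ≈ᶜ ofℝ β) × ∃[ P ] (IsMinPoly β P × evalℂ P α ≈ᶜ ofℝ 0ᵣ)

IsSalem : Pred ℝ 0ℓ
IsSalem β =
  IsAlgebraicInteger β × 1ᵣ <ᵣ β ×
  (∀ α → IsOtherConjugate β α → ∣ α ∣² ≤ᵣ 1ᵣ) ×
  ∃[ α ] (IsOtherConjugate β α × ∣ α ∣² ≈ᵣ 1ᵣ)

T : ℕ → Pred ℝ 0ℓ
T n β = IsSalem β × ∃[ P ] (IsMinPoly β P × HasDegreeℤ P n)

------------------------------------------------------------------------
-- Greedy expansions.  Digit sequences c : ℕ → ℤ are indexed from 1; the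
-- value c 0 is never used.

remainder : ℝ → (ℕ → ℤ) → ℕ → ℝ
remainder β c zero    = 1ᵣ
remainder β c (suc n) = β *ᵣ remainder β c n -ᵣ fromℤ (c (suc n))

IsGreedyExpansion : ℝ → (ℕ → ℤ) → Set
IsGreedyExpansion β c = ∀ n → IsFloor (β *ᵣ remainder β c n) (c (suc n))

IsPeriodic : (ℕ → ℤ) → ℕ → ℕ → Set
IsPeriodic c m p =
  1 ℕ.≤ p × (∀ n → 1 ℕ.≤ n → c (n ℕ.+ m) ≡ c (n ℕ.+ m ℕ.+ p))

-- c is the expansion of 1 in base β, with preperiod length m and period
-- length p ≥ 1.  A terminating expansion has period length 0 by
-- convention, hence the condition that no remainder vanishes.
IsParryExpansion : ℝ → (ℕ → ℤ) → ℕ → ℕ → Set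
IsParryExpansion β c m p =
  IsGreedyExpansion β c ×
  (∀ n → ¬ (remainder β c n ≈ᵣ 0ᵣ)) ×
  IsPeriodic c m p ×
  (∀ m′ p′ → IsPeriodic c m′ p′ → m ℕ.≤ m′ × p ℕ.≤ p′)

P[_,_] : ℕ → ℕ → Pred ℝ 0ℓ
P[ m , p ] β = IsSalem β × ∃[ c ] IsParryExpansion β c m p

------------------------------------------------------------------------
-- Co-factors

-- P_k(x) = x^k - c₁x^(k-1) - … - c_k, via P_(k+1)(x) = x P_k(x) - c_(k+1).
expansionPoly : (ℕ → ℤ) → ℕ → ℤ[x]
expansionPoly c zero    = ℤ.1ℤ ∷ []
expansionPoly c (suc k) = ℤ.- c (suc k) ∷ expansionPoly c k

companion : (ℕ → ℤ) → ℕ → ℕ → ℤ[x]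
companion c m p = expansionPoly c (m ℕ.+ p) -ₚ expansionPoly c m

C[_] : ℤ[x] → Pred ℝ 0ℓ
C[ Q ] β = IsSalem β ×
  ∃[ c ] ∃[ m ] ∃[ p ] (IsParryExpansion β c m p ×
    ∃[ P ] (IsMinPoly β P × companion c m p ≈ₚ P *ₚ Q))

Λ : ℕ → ℕ → ℕ → Pred ℤ[x] 0ℓ
Λ n m p Q = ∃[ β ] (β ∈ T n ∩ P[ m , p ] ∩ C[ Q ])

{-# OPTIONS --safe #-}
module Submission where

-- Let β be a Salem number of degree 6 with preperiod 1 and period 7, P its
-- minimal polynomial and R = P Q.  A conjugate of modulus 1 is a common root
-- of P and its reciprocal polynomial, so that P is reciprocal,
-- P = x⁶ + a x⁵ + b x⁴ + c x³ + b x² + a x + 1.  Comparing coefficients in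
-- R = P Q gives Q = x² + q₁ x + q₀ with q₀ = c₁ - c₈ ≥ 1 (otherwise the
-- expansion is purely periodic), and expresses a, b, c through the digits
-- 0 ≤ cᵢ ≤ c₁.  If q₀ ≥ 2, or q₀ = 1 and q₁ ≤ -2, then a, b, c ≥ 0, which is
-- impossible as P has a positive root; if q₀ = 1, then q₁ = 1 and q₁ ≥ 3
-- contradict the bounds on the digits.  What is left is q₁ ∈ {-1, 0, 2}.
--
-- Conversely, each of these is realised by a sextic P whose trace polynomial
-- G, P(x) = x³ G(x + 1/x), is irreducible modulo 2 and has one root γ₀ > 2 and
-- two roots in (-2, 2).  If β + 1/β = γ₀ and U(γ₀) + V(γ₀) β = 0, then the norm
-- U² + γ U V + V² vanishes at γ₀, hence at a root |γ| < 2 of G, where it is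
-- definite; so U = V = 0 and P is the minimal polynomial of β.  The expansion
-- is verified with rational enclosures of β and R(β) = P(β) Q(β) = 0.

open import Data.Integer.Base using (1ℤ; 0ℤ; -1ℤ; +_)
open import Data.List.Base using ([]; _∷_)
open import Relation.Unary using (_≐_; _∪_)
open import Defs

open import Algebra.Bundles using (CommutativeRing)
open import Algebra.Bundles.Raw using (RawRing)
open import Algebra.Morphism.Structures using (module RingMorphisms)
import Algebra.Solver.Ring as RingSolver
open import Algebra.Solver.Ring.AlmostCommutativeRing
  using (AlmostCommutativeRing; fromCommutativeRing; _-Raw-AlmostCommutative⟶_; -raw-almostCommutative⟶; Induced-equivalence)
import Algebra.Solver.Ring.NaturalCoefficients.Default as NaturalSolver
open import Algebra.Structures using (IsCommutativeRing)
import Data.Bool.Base as Bool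
open import Data.Empty using (⊥; ⊥-elim)
open import Data.Fin.Base using (Fin)
open import Data.Integer.Base as ℤ using (ℤ; +[1+_]; -[1+_])
open import Data.Integer.DivMod using (a≡a%ℕn+[a/ℕn]*n; n%ℕd<d; _%ℕ_; _/ℕ_)
import Data.Integer.Properties as ℤ
open import Data.List.Base using (List; _∷ʳ_; _ʳ++_; foldr; last; length; map; reverse; take)
open import Data.List.Properties using (length-++; length-map; length-take; map-∘)
open import Data.List.Relation.Unary.All using (All; []; _∷_)
open import Data.List.Relation.Unary.All.Properties using (++⁺)
open import Data.Maybe.Base using (Maybe; just; nothing; is-just)
open import Data.Maybe.Properties using (just-injective)
open import Data.Nat.Base as ℕ using (ℕ; zero; suc; s≤s; z≤n)
import Data.Nat.Coprimality as Coprimality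
open import Data.Nat.Divisibility using (_∣_; divides)
import Data.Nat.Properties as ℕ
import Data.Nat.Solver as ℕSolver
open import Data.Product.Base using (∃-syntax; _×_; _,_; proj₁; proj₂)
open import Data.Rational.Base as ℚ using (ℚ; mkℚ; 0ℚ; 1ℚ; ½; ∣_∣; toℚᵘ)
import Data.Rational.Properties as ℚ
open import Data.Rational.Unnormalised.Base as ℚᵘ using (mkℚᵘ; *≡*)
import Data.Rational.Unnormalised.Properties as ℚᵘ
open import Data.Sum.Base as Sum using (_⊎_; inj₁; inj₂)
open import Data.Vec.Base as Vec using (Vec; allFin; lookup)
open import Data.Vec.N-ary using (N-ary; Eq; curryⁿ; curryⁿ-cong; _$ⁿ_)
open import Level using (0ℓ)
open import Relation.Binary.Consequences using (dec⇒weaklyDec)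
open import Relation.Binary.Definitions using (tri<; tri≈; tri>; WeaklyDecidable)
open import Relation.Binary.PropositionalEquality as ≡
  using (_≡_; _≢_; cong; cong₂; subst; subst₂; module ≡-Reasoning)
open import Relation.Nullary.Decidable using (Dec; yes; no; True; toWitness; ¬?; _×-dec_)
open import Relation.Nullary.Negation using (¬_; contradiction)
open import Relation.Unary using (_⊆_)

-- Ring solver

-- Equality and order of constructive reals are undecidable, so a case distinction on a sign or on a
-- vanishing factor is made only on the way to a contradiction or to an equality, which is stable
-- under double negation. Irreducibility enters as `Independent`, the linear independence of the low
-- powers of a root over ℚ; in this form it can be carried from β to a complex conjugate. In the
-- exclusion of cofactors, the multipliers of the coefficient equations are chosen so that a, b, c
-- cancel or are expressed by digits; what remains is decided by 0 ≤ cᵢ ≤ c₁. In the existence half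
-- the unit circle is reached without square roots in ℝ. A second bisection gives τ > 0 for which 4
-- - τ² is the square of a root γ of G(y) = y³ + a y² + q y + r, and γ is rational in γ², because γ
-- (γ² + q) = -(a γ² + r). Thus |γ| < 2 holds by construction, and (γ + iτ)/2 is a conjugate of
-- modulus 1. The third root is defined by Vieta's formula; that it also lies in (-2, 2) is read off
-- from the sign of G(2) G(-2).

infixl 7 _:*_
infixl 6 _:+_ _:-_
infix  8 :-_
infix  4 _:=_

data Expr (K : Set) (n : ℕ) : Set where
  con       : K → Expr K n
  var       : Fin n → Expr K n
  _:+_ _:*_ : Expr K n → Expr K n → Expr K n
  :-_       : Expr K n → Expr K n

_:-_ : ∀ {K n} → Expr K n → Expr K n → Expr K n
e :- f = e :+ (:- f)

_:=_ : ∀ {K n} → Expr K n → Expr K n → Expr K n × Expr K n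
_:=_ = _,_

-- The library's ring solver, with expressions that do not mention the ring
-- and with normal forms compared by a boolean: the terms elaborated by the
-- library's own `solve` are much larger.
module Reflective (K : RawRing 0ℓ 0ℓ) (R : AlmostCommutativeRing 0ℓ 0ℓ)
  (morphism : K -Raw-AlmostCommutative⟶ R) (_≟_ : WeaklyDecidable (Induced-equivalence morphism)) where

  private module K = RawRing K
  open AlmostCommutativeRing R
  open _-Raw-AlmostCommutative⟶_ morphism using () renaming (⟦_⟧ to ⟦_⟧ᶜ)

  private module S = RingSolver K R morphism _≟_

  ⟦_⟧ : ∀ {n} → Expr K.Carrier n → Vec Carrier n → Carrier
  ⟦ con k  ⟧ ρ = ⟦ k ⟧ᶜ
  ⟦ var i  ⟧ ρ = lookup ρ i
  ⟦ e :+ f ⟧ ρ = ⟦ e ⟧ ρ + ⟦ f ⟧ ρ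
  ⟦ e :* f ⟧ ρ = ⟦ e ⟧ ρ * ⟦ f ⟧ ρ
  ⟦ :- e   ⟧ ρ = - ⟦ e ⟧ ρ

  private
    translate : ∀ {n} → Expr K.Carrier n → S.Polynomial n
    translate (con k)  = S.con k
    translate (var i)  = S.var i
    translate (e :+ f) = translate e S.:+ translate f
    translate (e :* f) = translate e S.:* translate f
    translate (:- e)   = S.:- translate e

    translate-correct : ∀ {n} (e : Expr K.Carrier n) ρ → S.⟦ translate e ⟧ ρ ≡ ⟦ e ⟧ ρ
    translate-correct (con k)  ρ = ≡.refl
    translate-correct (var i)  ρ = ≡.refl
    translate-correct (e :+ f) ρ = cong₂ _+_ (translate-correct e ρ) (translate-correct f ρ)
    translate-correct (e :* f) ρ = cong₂ _*_ (translate-correct e ρ) (translate-correct f ρ)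
    translate-correct (:- e)   ρ = cong -_ (translate-correct e ρ)

    normal : ∀ {n} → Expr K.Carrier n → S.Normal n
    normal e = S.normalise (translate e)

    sound : ∀ {n} (e f : Expr K.Carrier n) → Bool.T (is-just (normal e S.≟N normal f)) → ∀ ρ → ⟦ e ⟧ ρ ≈ ⟦ f ⟧ ρ
    sound e f same ρ with normal e S.≟N normal f
    ... | just e≈f = trans (reflexive (≡.sym (translate-correct e ρ)))
      (trans (S.prove ρ (translate e) (translate f) (S.⟦ e≈f ⟧N-cong ρ)) (reflexive (translate-correct f ρ)))

    close : ∀ n → N-ary n (Expr K.Carrier n) (Expr K.Carrier n × Expr K.Carrier n) → Expr K.Carrier n × Expr K.Carrier n
    close n f = f $ⁿ Vec.map var (allFin n)

  -- For a concrete equation the boolean test evaluates to true, so the implicit argument has the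
  -- unit type and is filled in silently.
  solve : ∀ n (f : N-ary n (Expr K.Carrier n) (Expr K.Carrier n × Expr K.Carrier n)) →
    {Bool.T (is-just (normal (proj₁ (close n f)) S.≟N normal (proj₂ (close n f))))} →
    Eq n _≈_ (curryⁿ ⟦ proj₁ (close n f) ⟧) (curryⁿ ⟦ proj₂ (close n f) ⟧)
  solve n f {same} = curryⁿ-cong _≈_ ⟦ proj₁ (close n f) ⟧ ⟦ proj₂ (close n f) ⟧
    (sound (proj₁ (close n f)) (proj₂ (close n f)) same)

module ℤ-Solver = Reflective ℤ.+-*-rawRing (fromCommutativeRing ℤ.+-*-commutativeRing)
  (-raw-almostCommutative⟶ (fromCommutativeRing ℤ.+-*-commutativeRing)) (dec⇒weaklyDec ℤ._≟_)
module ℚ-Solver₀ = Reflective ℚ.+-*-rawRing (fromCommutativeRing ℚ.+-*-commutativeRing)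
  (-raw-almostCommutative⟶ (fromCommutativeRing ℚ.+-*-commutativeRing)) (dec⇒weaklyDec ℚ._≟_)

-- The ordered ring of real numbers

Eventually : (ℕ → Set) → Set
Eventually A = ∃[ N ] (∀ n → N ℕ.≤ n → A n)

ev-map₂ : ∀ {A B C : ℕ → Set} → (∀ n → A n → B n → C n) →
  Eventually A → Eventually B → Eventually C
ev-map₂ f (M , hA) (N , hB) = M ℕ.⊔ N , λ n ≤n →
  f n (hA n (ℕ.m⊔n≤o⇒m≤o M N ≤n)) (hB n (ℕ.m⊔n≤o⇒n≤o M N ≤n))

ev-map : ∀ {A B : ℕ → Set} → (∀ n → A n → B n) → Eventually A → Eventually B
ev-map f (M , hA) = M , λ n ≤n → f n (hA n ≤n)

half-pos : ∀ {ε} → 0ℚ ℚ.< ε → 0ℚ ℚ.< ½ ℚ.* ε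
half-pos = ℚ.*-monoʳ-<-pos ½

half+half : ∀ ε → ½ ℚ.* ε ℚ.+ ½ ℚ.* ε ≡ ε
half+half = solve 1 (λ ε → con ½ :* ε :+ con ½ :* ε := ε)
  where open ℚ-Solver₀

dist-sym : ∀ p q → ∣ p ℚ.- q ∣ ≡ ∣ q ℚ.- p ∣
dist-sym p q = ≡.trans (≡.sym (ℚ.∣-p∣≡∣p∣ (p ℚ.- q))) (cong ∣_∣ (flip-sub p q))
  where
  open ℚ-Solver₀
  flip-sub : ∀ p q → ℚ.- (p ℚ.- q) ≡ q ℚ.- p
  flip-sub = solve 2 (λ p q → :- (p :- q) := q :- p)

p≤∣p∣ : ∀ p → p ℚ.≤ ∣ p ∣
p≤∣p∣ p with ℚ.≤-total 0ℚ p
... | inj₁ 0≤p = ℚ.≤-reflexive (≡.sym (ℚ.0≤p⇒∣p∣≡p 0≤p))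
... | inj₂ p≤0 = ℚ.≤-trans p≤0 (ℚ.0≤∣p∣ p)

dist<⇒< : ∀ p q {δ} → ∣ p ℚ.- q ∣ ℚ.< δ → p ℚ.< q ℚ.+ δ
dist<⇒< p q {δ} h = begin-strict
  p                ≡⟨ split p q ⟩
  q ℚ.+ (p ℚ.- q)  <⟨ ℚ.+-monoʳ-< q (ℚ.≤-<-trans (p≤∣p∣ (p ℚ.- q)) h) ⟩
  q ℚ.+ δ          ∎
  where
  open ℚ.≤-Reasoning
  open ℚ-Solver₀
  split : ∀ p q → p ≡ q ℚ.+ (p ℚ.- q)
  split = solve 2 (λ p q → p := q :+ (p :- q))

<⇒-< : ∀ p q {δ} → p ℚ.< q ℚ.+ δ → p ℚ.- q ℚ.< δ
<⇒-< p q {δ} h = begin-strict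
  p ℚ.- q          <⟨ ℚ.+-monoˡ-< (ℚ.- q) h ⟩
  q ℚ.+ δ ℚ.- q    ≡⟨ cancel q δ ⟩
  δ                ∎
  where
  open ℚ.≤-Reasoning
  open ℚ-Solver₀
  cancel : ∀ q d → q ℚ.+ d ℚ.- q ≡ d
  cancel = solve 2 (λ q d → q :+ d :- q := d)

<⇒dist< : ∀ p q {δ} → p ℚ.< q ℚ.+ δ → q ℚ.< p ℚ.+ δ → ∣ p ℚ.- q ∣ ℚ.< δ
<⇒dist< p q {δ} p<q+δ q<p+δ with ℚ.∣p∣≡p∨∣p∣≡-p (p ℚ.- q)
... | inj₁ eq = subst (ℚ._< δ) (≡.sym eq) (<⇒-< p q p<q+δ)
... | inj₂ eq = subst (ℚ._< δ)
  (≡.sym (≡.trans eq (solve 2 (λ p q → :- (p :- q) := q :- p) p q)))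
  (<⇒-< q p q<p+δ)
  where open ℚ-Solver₀

pointwise : ∀ x y → (∀ n → seq x n ≡ seq y n) → x ≈ᵣ y
pointwise x y eq ε 0<ε = 0 , λ n _ → subst (ℚ._< ε)
  (≡.sym (≡.trans (cong (λ z → ∣ z ℚ.- seq y n ∣) (eq n)) (cong ∣_∣ (ℚ.+-inverseʳ (seq y n))))) 0<ε

≈ᵣ-refl : ∀ x → x ≈ᵣ x
≈ᵣ-refl x = pointwise x x (λ _ → ≡.refl)

≈ᵣ-sym : ∀ x y → x ≈ᵣ y → y ≈ᵣ x
≈ᵣ-sym x y x≈y ε 0<ε =
  ev-map (λ n → subst (ℚ._< ε) (dist-sym (seq x n) (seq y n))) (x≈y ε 0<ε)

≈ᵣ-trans : ∀ x y z → x ≈ᵣ y → y ≈ᵣ z → x ≈ᵣ z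
≈ᵣ-trans x y z x≈y y≈z ε 0<ε = ev-map₂
  (λ n h k → subst₂ (λ u v → ∣ u ∣ ℚ.< v) (join (seq x n) (seq y n) (seq z n)) (half+half ε)
    (∣+∣-bound (seq x n ℚ.- seq y n) (seq y n ℚ.- seq z n) h k))
  (x≈y (½ ℚ.* ε) (half-pos 0<ε)) (y≈z (½ ℚ.* ε) (half-pos 0<ε))
  where
  open ℚ-Solver₀
  join : ∀ a b c → (a ℚ.- b) ℚ.+ (b ℚ.- c) ≡ a ℚ.- c
  join = solve 3 (λ a b c → (a :- b) :+ (b :- c) := a :- c)

+ᵣ-cong : ∀ x x′ y y′ → x ≈ᵣ x′ → y ≈ᵣ y′ → x +ᵣ y ≈ᵣ x′ +ᵣ y′
+ᵣ-cong x x′ y y′ x≈ y≈ ε 0<ε = ev-map₂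
  (λ n h k → subst₂ (λ u v → ∣ u ∣ ℚ.< v)
    (rearrange (seq x n) (seq x′ n) (seq y n) (seq y′ n)) (half+half ε)
    (∣+∣-bound (seq x n ℚ.- seq x′ n) (seq y n ℚ.- seq y′ n) h k))
  (x≈ (½ ℚ.* ε) (half-pos 0<ε)) (y≈ (½ ℚ.* ε) (half-pos 0<ε))
  where
  open ℚ-Solver₀
  rearrange : ∀ a c b d → (a ℚ.- c) ℚ.+ (b ℚ.- d) ≡ (a ℚ.+ b) ℚ.- (c ℚ.+ d)
  rearrange = solve 4 (λ a c b d → (a :- c) :+ (b :- d) := (a :+ b) :- (c :+ d))

-ᵣ-cong : ∀ x y → x ≈ᵣ y → -ᵣ x ≈ᵣ -ᵣ y
-ᵣ-cong x y x≈y ε 0<ε = ev-map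
  (λ n → subst (ℚ._< ε) (≡.trans (dist-sym (seq x n) (seq y n))
    (cong ∣_∣ (swap (seq x n) (seq y n)))))
  (x≈y ε 0<ε)
  where
  open ℚ-Solver₀
  swap : ∀ p q → q ℚ.- p ≡ (ℚ.- p) ℚ.- (ℚ.- q)
  swap = solve 2 (λ p q → q :- p := (:- p) :- (:- q))

-- x y - x′ y′ = x (y - y′) + y′ (x - x′), hence the bounds taken for `x` and `y′`.
*ᵣ-cong : ∀ x x′ y y′ → x ≈ᵣ x′ → y ≈ᵣ y′ → x *ᵣ y ≈ᵣ x′ *ᵣ y′
*ᵣ-cong x x′ y y′ x≈ y≈ ε 0<ε =
  bound (cauchy-bounded (seq x) (cauchy x)) (cauchy-bounded (seq y′) (cauchy y′))
  where
  Goal : Set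
  Goal = Eventually (λ n → ∣ seq x n ℚ.* seq y n ℚ.- seq x′ n ℚ.* seq y′ n ∣ ℚ.< ε)

  bound : ∃[ A ] ∃[ K ] (0ℚ ℚ.< A × (∀ n → K ℕ.≤ n → ∣ seq x n ∣ ℚ.≤ A)) →
          ∃[ B ] ∃[ L ] (0ℚ ℚ.< B × (∀ n → L ℕ.≤ n → ∣ seq y′ n ∣ ℚ.≤ B)) → Goal
  bound (A , K , 0<A , x≤A) (B , L , 0<B , y≤B) =
    let (δ , 0<δ , eq) = *-modulus {A} {B} {ε} 0<A 0<B 0<ε in
    ev-map₂ (λ { n (a , b) (c , d) →
        subst (∣ seq x n ℚ.* seq y n ℚ.- seq x′ n ℚ.* seq y′ n ∣ ℚ.<_) eq
          (*-distance (seq x n) (seq y n) (seq x′ n) (seq y′ n) {A} {B} {δ} 0<A 0<B a b c d) })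
      (ev-map₂ (λ _ → _,_) (K , x≤A) (L , y≤B))
      (ev-map₂ (λ _ → _,_) (x≈ δ 0<δ) (y≈ δ 0<δ))

ℝ-isCommutativeRing : IsCommutativeRing _≈ᵣ_ _+ᵣ_ _*ᵣ_ -ᵣ_ 0ᵣ 1ᵣ
ℝ-isCommutativeRing = record
    { isRing = record
      { +-isAbelianGroup = record
        { isGroup = record
          { isMonoid = record
            { isSemigroup = record
              { isMagma = record
                { isEquivalence = record
                  { refl  = λ {x} → ≈ᵣ-refl x
                  ; sym   = λ {x y} → ≈ᵣ-sym x y
                  ; trans = λ {x y z} → ≈ᵣ-trans x y z
                  }
                ; ∙-cong = λ {x y u v} → +ᵣ-cong x y u v
                }
              ; assoc = λ x y z → pointwise ((x +ᵣ y) +ᵣ z) (x +ᵣ (y +ᵣ z))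
                  (λ n → ℚ.+-assoc (seq x n) (seq y n) (seq z n))
              }
            ; identity = (λ x → pointwise (0ᵣ +ᵣ x) x (λ n → ℚ.+-identityˡ (seq x n)))
                       , (λ x → pointwise (x +ᵣ 0ᵣ) x (λ n → ℚ.+-identityʳ (seq x n)))
            }
          ; inverse = (λ x → pointwise ((-ᵣ x) +ᵣ x) 0ᵣ (λ n → ℚ.+-inverseˡ (seq x n)))
                    , (λ x → pointwise (x +ᵣ (-ᵣ x)) 0ᵣ (λ n → ℚ.+-inverseʳ (seq x n)))
          ; ⁻¹-cong = λ {x y} → -ᵣ-cong x y
          }
        ; comm = λ x y → pointwise (x +ᵣ y) (y +ᵣ x) (λ n → ℚ.+-comm (seq x n) (seq y n))
        }
      ; *-cong = λ {x y u v} → *ᵣ-cong x y u v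
      ; *-assoc = λ x y z → pointwise ((x *ᵣ y) *ᵣ z) (x *ᵣ (y *ᵣ z))
          (λ n → ℚ.*-assoc (seq x n) (seq y n) (seq z n))
      ; *-identity = (λ x → pointwise (1ᵣ *ᵣ x) x (λ n → ℚ.*-identityˡ (seq x n)))
                   , (λ x → pointwise (x *ᵣ 1ᵣ) x (λ n → ℚ.*-identityʳ (seq x n)))
      ; distrib = (λ x y z → pointwise (x *ᵣ (y +ᵣ z)) (x *ᵣ y +ᵣ x *ᵣ z)
                    (λ n → ℚ.*-distribˡ-+ (seq x n) (seq y n) (seq z n)))
                , (λ x y z → pointwise ((y +ᵣ z) *ᵣ x) (y *ᵣ x +ᵣ z *ᵣ x)
                    (λ n → ℚ.*-distribʳ-+ (seq x n) (seq y n) (seq z n)))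
      }
    ; *-comm = λ x y → pointwise (x *ᵣ y) (y *ᵣ x) (λ n → ℚ.*-comm (seq x n) (seq y n))
    }

Posᵣ : ℝ → Set
Posᵣ x = 0ᵣ <ᵣ x

posᵣ-resp : ∀ x y → x ≈ᵣ y → Posᵣ x → Posᵣ y
posᵣ-resp x y x≈y (ε , 0<ε , h) = ½ ℚ.* ε , half-pos 0<ε ,
  ev-map₂ (λ n ε≤x near → bound (seq x n) (seq y n) ε≤x (dist<⇒< (seq x n) (seq y n) near))
    h (x≈y (½ ℚ.* ε) (half-pos 0<ε))
  where
  open ℚ.≤-Reasoning
  open ℚ-Solver₀
  bound : ∀ p q → 0ℚ ℚ.+ ε ℚ.≤ p → p ℚ.< q ℚ.+ ½ ℚ.* ε → 0ℚ ℚ.+ ½ ℚ.* ε ℚ.≤ q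
  bound p q ε≤p p<q+ = begin
    0ℚ ℚ.+ ½ ℚ.* ε                ≡⟨ solve 1 (λ e → con 0ℚ :+ con ½ :* e := (con 0ℚ :+ e) :- con ½ :* e) ε ⟩
    (0ℚ ℚ.+ ε) ℚ.- ½ ℚ.* ε        ≤⟨ ℚ.+-monoˡ-≤ (ℚ.- (½ ℚ.* ε)) (ℚ.≤-trans ε≤p (ℚ.<⇒≤ p<q+)) ⟩
    (q ℚ.+ ½ ℚ.* ε) ℚ.- ½ ℚ.* ε   ≡⟨ solve 2 (λ q e → (q :+ e) :- e := q) q (½ ℚ.* ε) ⟩
    q                             ∎

posᵣ-+ : ∀ x y → Posᵣ x → Posᵣ y → Posᵣ (x +ᵣ y)
posᵣ-+ x y (ε , 0<ε , h) (δ , 0<δ , k) = ε ℚ.+ δ , ℚ.+-mono-< 0<ε 0<δ ,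
  ev-map₂ (λ n a b → subst (ℚ._≤ seq x n ℚ.+ seq y n)
    (solve 2 (λ e d → (con 0ℚ :+ e) :+ (con 0ℚ :+ d) := con 0ℚ :+ (e :+ d)) ε δ)
    (ℚ.+-mono-≤ a b)) h k
  where open ℚ-Solver₀

posᵣ-* : ∀ x y → Posᵣ x → Posᵣ y → Posᵣ (x *ᵣ y)
posᵣ-* x y (ε , 0<ε , h) (δ , 0<δ , k) =
  ε ℚ.* δ , ℚ.positive⁻¹ (ε ℚ.* δ) {{ℚ.pos*pos⇒pos ε {{ℚ.positive 0<ε}} δ {{ℚ.positive 0<δ}}}} ,
  ev-map₂ (λ n a b → bound (seq x n) (seq y n)
      (subst (ℚ._≤ seq x n) (ℚ.+-identityˡ ε) a) (subst (ℚ._≤ seq y n) (ℚ.+-identityˡ δ) b)) h k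
  where
  open ℚ.≤-Reasoning
  bound : ∀ p q → ε ℚ.≤ p → δ ℚ.≤ q → 0ℚ ℚ.+ ε ℚ.* δ ℚ.≤ p ℚ.* q
  bound p q ε≤p δ≤q = begin
    0ℚ ℚ.+ ε ℚ.* δ  ≡⟨ ℚ.+-identityˡ (ε ℚ.* δ) ⟩
    ε ℚ.* δ         ≤⟨ ℚ.*-monoʳ-≤-nonNeg δ {{ℚ.nonNegative (ℚ.<⇒≤ 0<δ)}} ε≤p ⟩
    p ℚ.* δ         ≤⟨ ℚ.*-monoˡ-≤-nonNeg p {{ℚ.nonNegative (ℚ.≤-trans (ℚ.<⇒≤ 0<ε) ε≤p)}} δ≤q ⟩
    p ℚ.* q         ∎

¬posᵣ-0 : ¬ Posᵣ 0ᵣ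
¬posᵣ-0 (ε , 0<ε , N , h) = ℚ.<-irrefl ≡.refl (ℚ.<-≤-trans 0<ε
  (subst (ℚ._≤ 0ℚ) (ℚ.+-identityˡ ε) (h N ℕ.≤-refl)))

posᵣ-fromℚ : ∀ q → 0ℚ ℚ.< q → Posᵣ (fromℚ q)
posᵣ-fromℚ q 0<q = q , 0<q , 0 , λ _ _ → ℚ.≤-reflexive (ℚ.+-identityˡ q)

<ᵣ⇒pos : ∀ x y → x <ᵣ y → Posᵣ (y -ᵣ x)
<ᵣ⇒pos x y (ε , 0<ε , h) = ε , 0<ε , ev-map (λ n → bound (seq x n) (seq y n)) h
  where
  open ℚ.≤-Reasoning
  open ℚ-Solver₀
  bound : ∀ p q → p ℚ.+ ε ℚ.≤ q → 0ℚ ℚ.+ ε ℚ.≤ q ℚ.- p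
  bound p q p+ε≤q = begin
    0ℚ ℚ.+ ε           ≡⟨ solve 2 (λ e p → con 0ℚ :+ e := (p :+ e) :- p) ε p ⟩
    (p ℚ.+ ε) ℚ.- p    ≤⟨ ℚ.+-monoˡ-≤ (ℚ.- p) p+ε≤q ⟩
    q ℚ.- p            ∎

pos⇒<ᵣ : ∀ x y → Posᵣ (y -ᵣ x) → x <ᵣ y
pos⇒<ᵣ x y (ε , 0<ε , h) = ε , 0<ε , ev-map (λ n → bound (seq x n) (seq y n)) h
  where
  open ℚ.≤-Reasoning
  open ℚ-Solver₀
  bound : ∀ p q → 0ℚ ℚ.+ ε ℚ.≤ q ℚ.- p → p ℚ.+ ε ℚ.≤ q
  bound p q ε≤ = begin
    p ℚ.+ ε            ≡⟨ solve 2 (λ e p → p :+ e := (con 0ℚ :+ e) :+ p) ε p ⟩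
    (0ℚ ℚ.+ ε) ℚ.+ p   ≤⟨ ℚ.+-monoˡ-≤ p ε≤ ⟩
    (q ℚ.- p) ℚ.+ p    ≡⟨ solve 2 (λ q p → (q :- p) :+ p := q) q p ⟩
    q                  ∎

-- A Cauchy sequence that is not eventually within ε of 0 is eventually
-- bounded away from 0 with a constant sign.
tightᵣ : ∀ x → ¬ Posᵣ x → ¬ Posᵣ (-ᵣ x) → x ≈ᵣ 0ᵣ
tightᵣ x ¬pos ¬neg ε 0<ε = go (cauchy x δ 0<δ)
  where
  open ℚ.≤-Reasoning
  open ℚ-Solver₀
  -- Half and a quarter of ε: if one late term is at least θ, all later ones are at least θ - δ = δ;
  -- if it is below θ, they stay below θ + δ < ε.
  θ = ½ ℚ.* ε
  δ = ½ ℚ.* θ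

  0<δ : 0ℚ ℚ.< δ
  0<δ = half-pos (half-pos 0<ε)

  upper : ∀ p q → ¬ (θ ℚ.≤ q) → p ℚ.< q ℚ.+ δ → p ℚ.< ε
  upper p q θ≰q p<q+δ = begin-strict
    p                  <⟨ p<q+δ ⟩
    q ℚ.+ δ            <⟨ ℚ.+-monoˡ-< δ (ℚ.≰⇒> θ≰q) ⟩
    θ ℚ.+ δ            ≡⟨ solve 2 (λ t d → t :+ d := t :+ (con 0ℚ :+ d)) θ δ ⟩
    θ ℚ.+ (0ℚ ℚ.+ δ)   <⟨ ℚ.+-monoʳ-< θ (ℚ.+-monoˡ-< δ 0<δ) ⟩
    θ ℚ.+ (δ ℚ.+ δ)    ≡⟨ cong (θ ℚ.+_) (half+half θ) ⟩
    θ ℚ.+ θ            ≡⟨ half+half ε ⟩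
    ε                  ∎

  lower : ∀ p q → θ ℚ.≤ q → q ℚ.< p ℚ.+ δ → 0ℚ ℚ.+ δ ℚ.≤ p
  lower p q ≤q q< = begin
    0ℚ ℚ.+ δ          ≡⟨ solve 1 (λ t → con 0ℚ :+ con ½ :* t := t :- con ½ :* t) θ ⟩
    θ ℚ.- δ           ≤⟨ ℚ.+-monoˡ-≤ (ℚ.- δ) (ℚ.≤-trans ≤q (ℚ.<⇒≤ q<)) ⟩
    (p ℚ.+ δ) ℚ.- δ   ≡⟨ solve 2 (λ p d → (p :+ d) :- d := p) p δ ⟩
    p                 ∎

  negate : ∀ p q → ∣ p ℚ.- q ∣ ℚ.< δ → ∣ (ℚ.- p) ℚ.- (ℚ.- q) ∣ ℚ.< δ
  negate p q = subst (ℚ._< δ) (≡.trans (dist-sym p q)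
    (cong ∣_∣ (solve 2 (λ p q → q :- p := (:- p) :- (:- q)) p q)))

  within : ∀ p → p ℚ.< ε → ℚ.- p ℚ.< ε → ∣ p ℚ.- 0ℚ ∣ ℚ.< ε
  within p p<ε -p<ε = <⇒dist< p 0ℚ
    (subst (p ℚ.<_) (≡.sym (ℚ.+-identityˡ ε)) p<ε)
    (subst (ℚ._< p ℚ.+ ε) (ℚ.+-inverseʳ p) (ℚ.+-monoʳ-< p -p<ε))

  go : ∃[ N ] (∀ m n → N ℕ.≤ m → N ℕ.≤ n → ∣ seq x m ℚ.- seq x n ∣ ℚ.< δ) →
       Eventually (λ n → ∣ seq x n ℚ.- 0ℚ ∣ ℚ.< ε)
  go (N , close) with θ ℚ.≤? seq x N | θ ℚ.≤? (ℚ.- seq x N)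
  ... | yes big | _ = contradiction
    (δ , 0<δ , N , λ n N≤n → lower (seq x n) (seq x N) big
        (dist<⇒< (seq x N) (seq x n) (close N n ℕ.≤-refl N≤n))) ¬pos
  ... | no _ | yes big = contradiction
    (δ , 0<δ , N , λ n N≤n → lower (ℚ.- seq x n) (ℚ.- seq x N) big
        (dist<⇒< (ℚ.- seq x N) (ℚ.- seq x n)
          (negate (seq x N) (seq x n) (close N n ℕ.≤-refl N≤n)))) ¬neg
  ... | no a | no b = N , λ n N≤n → within (seq x n)
    (upper (seq x n) (seq x N) a
      (dist<⇒< (seq x n) (seq x N) (close n N N≤n ℕ.≤-refl)))
    (upper (ℚ.- seq x n) (ℚ.- seq x N) b
      (dist<⇒< (ℚ.- seq x n) (ℚ.- seq x N)
        (negate (seq x n) (seq x N) (close n N N≤n ℕ.≤-refl))))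

-- Roots by bisection

toℚ : ℤ → ℚ
toℚ k = k ℚ./ 1

toℚᵘ-toℚ : ∀ k → toℚᵘ (toℚ k) ℚᵘ.≃ mkℚᵘ k 0
toℚᵘ-toℚ k = ℚ.toℚᵘ-fromℚᵘ (mkℚᵘ k 0)

toℚ-+ : ∀ i j → toℚ (i ℤ.+ j) ≡ toℚ i ℚ.+ toℚ j
toℚ-+ i j = ℚ.toℚᵘ-injective (begin
  toℚᵘ (toℚ (i ℤ.+ j))               ≈⟨ toℚᵘ-toℚ (i ℤ.+ j) ⟩
  mkℚᵘ (i ℤ.+ j) 0                   ≈⟨ *≡* (cong (ℤ._* ℤ.1ℤ) (cong₂ ℤ._+_ (ℤ.*-identityʳ i) (ℤ.*-identityʳ j))) ⟨
  mkℚᵘ i 0 ℚᵘ.+ mkℚᵘ j 0             ≈⟨ ℚᵘ.+-cong (toℚᵘ-toℚ i) (toℚᵘ-toℚ j) ⟨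
  toℚᵘ (toℚ i) ℚᵘ.+ toℚᵘ (toℚ j)     ≈⟨ ℚ.toℚᵘ-homo-+ (toℚ i) (toℚ j) ⟨
  toℚᵘ (toℚ i ℚ.+ toℚ j)             ∎)
  where open ℚᵘ.≃-Reasoning

toℚ-* : ∀ i j → toℚ (i ℤ.* j) ≡ toℚ i ℚ.* toℚ j
toℚ-* i j = ℚ.toℚᵘ-injective (begin
  toℚᵘ (toℚ (i ℤ.* j))               ≈⟨ toℚᵘ-toℚ (i ℤ.* j) ⟩
  mkℚᵘ (i ℤ.* j) 0                   ≈⟨ *≡* ≡.refl ⟩
  mkℚᵘ i 0 ℚᵘ.* mkℚᵘ j 0             ≈⟨ ℚᵘ.*-cong (toℚᵘ-toℚ i) (toℚᵘ-toℚ j) ⟨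
  toℚᵘ (toℚ i) ℚᵘ.* toℚᵘ (toℚ j)     ≈⟨ ℚ.toℚᵘ-homo-* (toℚ i) (toℚ j) ⟨
  toℚᵘ (toℚ i ℚ.* toℚ j)             ∎)
  where open ℚᵘ.≃-Reasoning

toℚ-neg : ∀ i → toℚ (ℤ.- i) ≡ ℚ.- toℚ i
toℚ-neg i = ℚ.toℚᵘ-injective (begin
  toℚᵘ (toℚ (ℤ.- i))       ≈⟨ toℚᵘ-toℚ (ℤ.- i) ⟩
  ℚᵘ.- mkℚᵘ i 0            ≈⟨ ℚᵘ.-‿cong (toℚᵘ-toℚ i) ⟨
  ℚᵘ.- toℚᵘ (toℚ i)        ≈⟨ ℚ.toℚᵘ-homo‿- (toℚ i) ⟨
  toℚᵘ (ℚ.- toℚ i)         ∎)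
  where open ℚᵘ.≃-Reasoning

toℚ-injective : ∀ {i j} → toℚ i ≡ toℚ j → i ≡ j
toℚ-injective {i} {j} eq with ℚᵘ.≃-trans (ℚᵘ.≃-sym (toℚᵘ-toℚ i))
  (ℚᵘ.≃-trans (ℚ.toℚᵘ-cong eq) (toℚᵘ-toℚ j))
... | *≡* h = ≡.trans (≡.sym (ℤ.*-identityʳ i)) (≡.trans h (ℤ.*-identityʳ j))

toℚ-mono-< : ∀ {i j} → i ℤ.< j → toℚ i ℚ.< toℚ j
toℚ-mono-< {i} {j} i<j = ℚ.toℚᵘ-cancel-<
  (ℚᵘ.<-respˡ-≃ (ℚᵘ.≃-sym (toℚᵘ-toℚ i)) (ℚᵘ.<-respʳ-≃ (ℚᵘ.≃-sym (toℚᵘ-toℚ j))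
    (ℚᵘ.*<* (ℤ.*-monoʳ-<-pos ℤ.1ℤ i<j))))

archimedean : ∀ q → ∃[ n ] q ℚ.< toℚ (+ n)
archimedean q@(mkℚ a d _) = suc ℤ.∣ a ∣ , ℚ.toℚᵘ-cancel-<
  (ℚᵘ.<-respʳ-≃ (ℚᵘ.≃-sym (toℚᵘ-toℚ (+ suc ℤ.∣ a ∣))) (ℚᵘ.*<* (bound a)))
  where
  bound : ∀ a → a ℤ.* ℤ.1ℤ ℤ.< (+ suc ℤ.∣ a ∣) ℤ.* (+ suc d)
  bound a = subst (ℤ._< (+ suc ℤ.∣ a ∣) ℤ.* (+ suc d)) (≡.sym (ℤ.*-identityʳ a))
    (ℤ.≤-<-trans (below a) (ℤ.+<+ (ℕ.m≤m*n (suc ℤ.∣ a ∣) (suc d))))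
    where
    below : ∀ a → a ℤ.≤ + ℤ.∣ a ∣
    below (+ n) = ℤ.≤-refl
    below -[1+ n ] = ℤ.-≤+

-- The midpoint test takes place in ℚ, where the order is decidable. A midpoint with value 0 becomes
-- a left end, which keeps both sign conditions non-strict.
module Bisect (f : ℚ → ℚ) (lo w : ℚ) (0≤w : 0ℚ ℚ.≤ w)
                 (f-lo : f lo ℚ.≤ 0ℚ) (f-hi : 0ℚ ℚ.≤ f (lo ℚ.+ w)) where

  width : ℕ → ℚ
  width zero    = w
  width (suc n) = ½ ℚ.* width n

  move : ∀ l h → Dec (f (l ℚ.+ h) ℚ.≤ 0ℚ) → ℚ
  move l h (yes _) = l ℚ.+ h
  move l h (no _)  = l

  left : ℕ → ℚ
  left zero    = lo
  left (suc n) = move (left n) (width (suc n)) (f (left n ℚ.+ width (suc n)) ℚ.≤? 0ℚ)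

  right : ℕ → ℚ
  right n = left n ℚ.+ width n

  0≤width : ∀ n → 0ℚ ℚ.≤ width n
  0≤width zero    = 0≤w
  0≤width (suc n) = ℚ.*-monoˡ-≤-nonNeg ½ (0≤width n)

  private
    halves : ∀ l n → (l ℚ.+ width (suc n)) ℚ.+ width (suc n) ≡ l ℚ.+ width n
    halves l n = ≡.trans (ℚ.+-assoc l (width (suc n)) (width (suc n)))
      (cong (l ℚ.+_) (half+half (width n)))

    raise : ∀ p n → p ℚ.≤ p ℚ.+ width n
    raise p n = subst (ℚ._≤ p ℚ.+ width n) (ℚ.+-identityʳ p) (ℚ.+-monoʳ-≤ p (0≤width n))

    record Step (l : ℚ) (n : ℕ) (l′ : ℚ) : Set where
      field
        f-left  : f l′ ℚ.≤ 0ℚ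
        f-right : 0ℚ ℚ.≤ f (l′ ℚ.+ width (suc n))
        l≤l′    : l ℚ.≤ l′
        r′≤r    : l′ ℚ.+ width (suc n) ℚ.≤ l ℚ.+ width n

    step : ∀ l n → f l ℚ.≤ 0ℚ → 0ℚ ℚ.≤ f (l ℚ.+ width n) →
      (d : Dec (f (l ℚ.+ width (suc n)) ℚ.≤ 0ℚ)) → Step l n (move l (width (suc n)) d)
    step l n fl fr (yes p) = record
      { f-left = p ; f-right = subst (λ z → 0ℚ ℚ.≤ f z) (≡.sym (halves l n)) fr
      ; l≤l′ = raise l (suc n) ; r′≤r = ℚ.≤-reflexive (halves l n) }
    step l n fl fr (no p) = record
      { f-left = fl ; f-right = ℚ.<⇒≤ (ℚ.≰⇒> p)
      ; l≤l′ = ℚ.≤-refl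
      ; r′≤r = subst (l ℚ.+ width (suc n) ℚ.≤_) (halves l n) (raise (l ℚ.+ width (suc n)) (suc n)) }

  sign : ∀ n → f (left n) ℚ.≤ 0ℚ × 0ℚ ℚ.≤ f (right n)
  sign zero    = f-lo , f-hi
  sign (suc n) = let s = step (left n) n (proj₁ (sign n)) (proj₂ (sign n)) (f (left n ℚ.+ width (suc n)) ℚ.≤? 0ℚ)
    in Step.f-left s , Step.f-right s

  shrink : ∀ n → left n ℚ.≤ left (suc n) × right (suc n) ℚ.≤ right n
  shrink n = let s = step (left n) n (proj₁ (sign n)) (proj₂ (sign n)) (f (left n ℚ.+ width (suc n)) ℚ.≤? 0ℚ)
    in Step.l≤l′ s , Step.r′≤r s

  nested : ∀ n k → left n ℚ.≤ left (k ℕ.+ n) × right (k ℕ.+ n) ℚ.≤ right n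
  nested n zero    = ℚ.≤-refl , ℚ.≤-refl
  nested n (suc k) = ℚ.≤-trans (proj₁ (nested n k)) (proj₁ (shrink (k ℕ.+ n)))
                   , ℚ.≤-trans (proj₂ (shrink (k ℕ.+ n))) (proj₂ (nested n k))

  Within : ℕ → ℚ → Set
  Within n p = left n ℚ.≤ p × p ℚ.≤ right n

  within : ∀ {n m} → n ℕ.≤ m → Within n (left m) × Within n (right m)
  within {n} {m} n≤m with nested n (m ℕ.∸ n)
  ... | ≤left , right≤ rewrite ℕ.m∸n+n≡m n≤m =
    (≤left , ℚ.≤-trans (raise (left m) m) right≤) ,
    (ℚ.≤-trans ≤left (raise (left m) m) , right≤)

  left-bounds : ∀ n → lo ℚ.≤ left n × left n ℚ.≤ lo ℚ.+ w
  left-bounds n = proj₁ (within {0} {n} ℕ.z≤n)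

  private
    -- This is n + 1 ≤ 2^n in a form suited to induction; together with the archimedean property the
    -- linear bound already makes the widths tend to 0.
    width-bound : ∀ n → width n ℚ.* toℚ (+ suc n) ℚ.≤ w
    width-bound zero    = ℚ.≤-reflexive (ℚ.*-identityʳ w)
    width-bound (suc n) = begin
      ½ ℚ.* width n ℚ.* toℚ (+ suc (suc n))
        ≡⟨ cong (½ ℚ.* width n ℚ.*_) (toℚ-+ (+ 1) (+ suc n)) ⟩
      ½ ℚ.* width n ℚ.* (1ℚ ℚ.+ toℚ (+ suc n))
        ≤⟨ ℚ.*-monoˡ-≤-nonNeg (½ ℚ.* width n) {{ℚ.nonNegative (0≤width (suc n))}}
             (ℚ.+-monoˡ-≤ (toℚ (+ suc n)) 1≤) ⟩
      ½ ℚ.* width n ℚ.* (toℚ (+ suc n) ℚ.+ toℚ (+ suc n))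
        ≡⟨ solve 2 (λ x k → con ½ :* x :* (k :+ k) := x :* k) (width n) (toℚ (+ suc n)) ⟩
      width n ℚ.* toℚ (+ suc n)
        ≤⟨ width-bound n ⟩
      w ∎
      where
      open ℚ.≤-Reasoning
      open ℚ-Solver₀
      1≤ : 1ℚ ℚ.≤ toℚ (+ suc n)
      1≤ = ℚ.≮⇒≥ (λ h → ℤ.≤⇒≯ (ℤ.+≤+ (ℕ.s≤s (ℕ.z≤n {n}))) (cancel h))
        where
        cancel : toℚ (+ suc n) ℚ.< 1ℚ → + suc n ℤ.< + 1
        cancel h with ℤ.<-cmp (+ suc n) (+ 1)
        ... | tri< a _ _ = a
        ... | tri≈ _ b _ = contradiction h (ℚ.<-irrefl (cong toℚ b))
        ... | tri> _ _ c = contradiction h (ℚ.<-asym (toℚ-mono-< c))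

  width→0 : ∀ ε → 0ℚ ℚ.< ε → ∃[ N ] width N ℚ.< ε
  width→0 ε 0<ε = go (archimedean (w ℚ.* ε⁻¹))
    where
    open ℚ.≤-Reasoning
    ε≢0 = ℚ.pos⇒nonZero ε {{ℚ.positive 0<ε}}
    ε⁻¹ = ℚ.1/_ ε {{ε≢0}}
    go : ∃[ n ] w ℚ.* ε⁻¹ ℚ.< toℚ (+ n) → ∃[ N ] width N ℚ.< ε
    go (n , h) = n , ℚ.≰⇒> λ ε≤width → ℚ.<-irrefl ≡.refl (begin-strict
      w                             ≡⟨ ℚ.*-identityʳ w ⟨
      w ℚ.* 1ℚ                      ≡⟨ cong (w ℚ.*_) (ℚ.*-inverseˡ ε {{ε≢0}}) ⟨
      w ℚ.* (ε⁻¹ ℚ.* ε)             ≡⟨ ℚ.*-assoc w ε⁻¹ ε ⟨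
      w ℚ.* ε⁻¹ ℚ.* ε               <⟨ ℚ.*-monoˡ-<-pos ε {{ℚ.positive 0<ε}} (ℚ.<-trans h (toℚ-mono-< (ℤ.+<+ (ℕ.n<1+n n)))) ⟩
      toℚ (+ suc n) ℚ.* ε           ≡⟨ ℚ.*-comm (toℚ (+ suc n)) ε ⟩
      ε ℚ.* toℚ (+ suc n)           ≤⟨ ℚ.*-monoʳ-≤-nonNeg (toℚ (+ suc n)) {{ℚ.nonNegative (ℚ.<⇒≤ (toℚ-mono-< {+ 0} {+ suc n} (ℤ.+<+ ℕ.z<s)))}} ε≤width ⟩
      width n ℚ.* toℚ (+ suc n)     ≤⟨ width-bound n ⟩
      w                             ∎)

  private
    near : ∀ {ε} N p q → width N ℚ.< ε → Within N p → Within N q → ∣ p ℚ.- q ∣ ℚ.< ε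
    near {ε} N p q w<ε (l≤p , p≤r) (l≤q , q≤r) = <⇒dist< p q (below p≤r l≤q) (below q≤r l≤p)
      where
      below : ∀ {p q} → p ℚ.≤ right N → left N ℚ.≤ q → p ℚ.< q ℚ.+ ε
      below p≤r l≤q = ℚ.≤-<-trans p≤r (ℚ.+-mono-≤-< l≤q w<ε)

  root : ℝ
  root = mkℝ left λ ε 0<ε → let (N , w<ε) = width→0 ε 0<ε in
    N , λ m n N≤m N≤n → near N (left m) (left n) w<ε (proj₁ (within N≤m)) (proj₁ (within N≤n))

  root′ : ℝ
  root′ = mkℝ right λ ε 0<ε → let (N , w<ε) = width→0 ε 0<ε in
    N , λ m n N≤m N≤n → near N (right m) (right n) w<ε (proj₂ (within N≤m)) (proj₂ (within N≤n))

  root≈root′ : root ≈ᵣ root′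
  root≈root′ ε 0<ε = let (N , w<ε) = width→0 ε 0<ε in
    N , λ n N≤n → near N (left n) (right n) w<ε (proj₁ (within N≤n)) (proj₂ (within N≤n))

  -- No modulus of continuity is needed: F takes values of opposite signs
  -- along the two ends of the intervals, and these ends are equal reals.
  isRoot : (F : ℝ → ℝ) → (∀ x y → x ≈ᵣ y → F x ≈ᵣ F y) →
    (∀ x n → seq (F x) n ≡ f (seq x n)) → F root ≈ᵣ 0ᵣ
  isRoot F F-cong seq-F ε 0<ε = ev-map
    (λ n → zero-between (seq (F root) n) (seq (F root′) n)
      (subst (ℚ._≤ 0ℚ) (≡.sym (seq-F root n)) (proj₁ (sign n)))
      (subst (0ℚ ℚ.≤_) (≡.sym (seq-F root′ n)) (proj₂ (sign n))))
    (F-cong root root′ root≈root′ ε 0<ε)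
    where
    zero-between : ∀ p q → p ℚ.≤ 0ℚ → 0ℚ ℚ.≤ q → ∣ p ℚ.- q ∣ ℚ.< ε → ∣ p ℚ.- 0ℚ ∣ ℚ.< ε
    zero-between p q p≤0 0≤q h = <⇒dist< p 0ℚ
      (ℚ.≤-<-trans p≤0 (subst (0ℚ ℚ.<_) (≡.sym (ℚ.+-identityˡ ε)) 0<ε))
      (ℚ.≤-<-trans 0≤q (dist<⇒< q p (subst (ℚ._< ε) (dist-sym p q) h)))

-- Evaluation and division of polynomials

IsCommRing : RawRing 0ℓ 0ℓ → Set
IsCommRing S = IsCommutativeRing _≈_ _+_ _*_ -_ 0# 1#
  where open RawRing S

commRing : (S : RawRing 0ℓ 0ℓ) → IsCommRing S → CommutativeRing 0ℓ 0ℓ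
commRing S isCR = record { isCommutativeRing = isCR }

-- Coefficients and values live in different rings, so that one set of lemmas serves ℤ[x] and ℚ[x]
-- evaluated in ℝ as well as in ℂ.
module EvalHom (K S : RawRing 0ℓ 0ℓ) (isCR : IsCommRing S)
  (ι : RawRing.Carrier K → RawRing.Carrier S)
  (ι-hom : RingMorphisms.IsRingHomomorphism K S ι) where

  private module K = RawRing K
  open CommutativeRing (commRing S isCR) hiding (zero; rawRing)
  open RingMorphisms.IsRingHomomorphism ι-hom
    using (+-homo; *-homo; -‿homo; 0#-homo; 1#-homo; ⟦⟧-cong)
  open Polynomial K using (Poly; coeff)
    renaming (_≈ₚ_ to _≋_; _+ₚ_ to _⊞_; -ₚ_ to ⊖_; _-ₚ_ to _⊟_; _*ₚ_ to _⊠_)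
  open import Relation.Binary.Reasoning.Setoid setoid
  open import Algebra.Properties.Ring ring using (-0#≈0#; -‿+-comm; -‿distribʳ-*)
  private module N = NaturalSolver commutativeSemiring

  ev : Poly → Carrier → Carrier
  ev f = Polynomial.eval S (map ι f)

  ev-zero : ∀ f x → (∀ n → coeff f n K.≈ K.0#) → ev f x ≈ 0#
  ev-zero []      x f≈0 = refl
  ev-zero (a ∷ f) x f≈0 = begin
    ι a + x * ev f x  ≈⟨ +-cong (trans (⟦⟧-cong (f≈0 0)) 0#-homo)
                           (*-congˡ (ev-zero f x (λ n → f≈0 (suc n)))) ⟩
    0# + x * 0#       ≈⟨ N.solve 1 (λ x → N.con 0 N.:+ x N.:* N.con 0 N.:= N.con 0) refl x ⟩
    0#                ∎

  ev-cong : (∀ {a b} → a K.≈ b → b K.≈ a) → ∀ f g x → f ≋ g → ev f x ≈ ev g x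
  ev-cong K-sym []      g       x f≈g = sym (ev-zero g x (λ n → K-sym (f≈g n)))
  ev-cong K-sym (a ∷ f) []      x f≈g = ev-zero (a ∷ f) x f≈g
  ev-cong K-sym (a ∷ f) (b ∷ g) x f≈g =
    +-cong (⟦⟧-cong (f≈g 0)) (*-congˡ (ev-cong K-sym f g x (λ n → f≈g (suc n))))

  ev-congˣ : ∀ f {x y} → x ≈ y → ev f x ≈ ev f y
  ev-congˣ []      x≈y = refl
  ev-congˣ (a ∷ f) x≈y = +-congˡ (*-cong x≈y (ev-congˣ f x≈y))

  ev-+ : ∀ f g x → ev (f ⊞ g) x ≈ ev f x + ev g x
  ev-+ []      g       x = sym (+-identityˡ (ev g x))
  ev-+ (a ∷ f) []      x = sym (+-identityʳ (ev (a ∷ f) x))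
  ev-+ (a ∷ f) (b ∷ g) x = begin
    ι (a K.+ b) + x * ev (f ⊞ g) x
      ≈⟨ +-cong (+-homo a b) (*-congˡ (ev-+ f g x)) ⟩
    (ι a + ι b) + x * (ev f x + ev g x)
      ≈⟨ N.solve 5 (λ a b x f g → (a N.:+ b) N.:+ x N.:* (f N.:+ g) N.:= (a N.:+ x N.:* f) N.:+ (b N.:+ x N.:* g))
           refl (ι a) (ι b) x (ev f x) (ev g x) ⟩
    (ι a + x * ev f x) + (ι b + x * ev g x) ∎

  ev-neg : ∀ f x → ev (⊖ f) x ≈ - ev f x
  ev-neg []      x = sym -0#≈0#
  ev-neg (a ∷ f) x = begin
    ι (K.- a) + x * ev (⊖ f) x  ≈⟨ +-cong (-‿homo a) (trans (*-congˡ (ev-neg f x)) (sym (-‿distribʳ-* x (ev f x)))) ⟩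
    - ι a + - (x * ev f x)       ≈⟨ -‿+-comm (ι a) (x * ev f x) ⟩
    - (ι a + x * ev f x)         ∎

  ev-- : ∀ f g x → ev (f ⊟ g) x ≈ ev f x - ev g x
  ev-- f g x = trans (ev-+ f (⊖ g) x) (+-congˡ (ev-neg g x))

  ev-scale : ∀ a f x → ev (map (a K.*_) f) x ≈ ι a * ev f x
  ev-scale a []      x = sym (zeroʳ (ι a))
  ev-scale a (b ∷ f) x = begin
    ι (a K.* b) + x * ev (map (a K.*_) f) x  ≈⟨ +-cong (*-homo a b) (*-congˡ (ev-scale a f x)) ⟩
    ι a * ι b + x * (ι a * ev f x)           ≈⟨ N.solve 4 (λ a b x f → a N.:* b N.:+ x N.:* (a N.:* f) N.:= a N.:* (b N.:+ x N.:* f))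
                                                  refl (ι a) (ι b) x (ev f x) ⟩
    ι a * (ι b + x * ev f x)                 ∎

  ev-* : ∀ f g x → ev (f ⊠ g) x ≈ ev f x * ev g x
  ev-* []      g x = sym (zeroˡ (ev g x))
  ev-* (a ∷ f) g x = begin
    ev (map (a K.*_) g ⊞ (K.0# ∷ f ⊠ g)) x
      ≈⟨ ev-+ (map (a K.*_) g) (K.0# ∷ f ⊠ g) x ⟩
    ev (map (a K.*_) g) x + (ι K.0# + x * ev (f ⊠ g) x)
      ≈⟨ +-cong (ev-scale a g x) (+-cong 0#-homo (*-congˡ (ev-* f g x))) ⟩
    ι a * ev g x + (0# + x * (ev f x * ev g x))
      ≈⟨ N.solve 4 (λ a x f g → a N.:* g N.:+ (N.con 0 N.:+ x N.:* (f N.:* g)) N.:= (a N.:+ x N.:* f) N.:* g)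
           refl (ι a) x (ev f x) (ev g x) ⟩
    (ι a + x * ev f x) * ev g x ∎

  pow : Carrier → ℕ → Carrier
  pow x zero    = 1#
  pow x (suc n) = x * pow x n

  ev-∷ʳ : ∀ f c x → ev (f ∷ʳ c) x ≈ ev f x + pow x (length f) * ι c
  ev-∷ʳ []      c x = N.solve 2 (λ c x → c N.:+ x N.:* N.con 0 N.:= N.con 0 N.:+ N.con 1 N.:* c) refl (ι c) x
  ev-∷ʳ (a ∷ f) c x = begin
    ι a + x * ev (f ∷ʳ c) x                       ≈⟨ +-congˡ (*-congˡ (ev-∷ʳ f c x)) ⟩
    ι a + x * (ev f x + pow x (length f) * ι c)   ≈⟨ N.solve 5 (λ a x f p c → a N.:+ x N.:* (f N.:+ p N.:* c) N.:= (a N.:+ x N.:* f) N.:+ (x N.:* p) N.:* c)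
                                                       refl (ι a) x (ev f x) (pow x (length f)) (ι c) ⟩
    (ι a + x * ev f x) + (x * pow x (length f)) * ι c ∎

-- ℝ and ℂ enter the algebra through this interface: identities are proved for an abstract carrier,
-- and roots in two different algebras can be compared.
record ℚ-Algebra : Set₁ where
  field
    raw   : RawRing 0ℓ 0ℓ
    isCR  : IsCommRing raw
  open CommutativeRing (commRing raw isCR) public hiding (ring; rawRing; zero)
  field
    ι     : ℚ → Carrier
    ι-hom : RingMorphisms.IsRingHomomorphism ℚ.+-*-rawRing raw ι
  open RingMorphisms.IsRingHomomorphism ι-hom public
    using (+-homo; *-homo; -‿homo; 0#-homo; 1#-homo)
  open EvalHom ℚ.+-*-rawRing raw isCR ι ι-hom public

module ℚ-Solver (A : ℚ-Algebra) where
  open ℚ-Algebra A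

  -- Sends the coefficient 0 to 0# itself, so that 0# can be written as
  -- con 0ℚ in solver expressions.
  coefficient : ℚ → Carrier
  coefficient (mkℚ (+ zero) _ _) = 0#
  coefficient q                  = ι q

  coefficient≈ι : ∀ q → coefficient q ≈ ι q
  coefficient≈ι q@(mkℚ (+ zero) _ _) = trans (sym 0#-homo) (reflexive (cong ι (≡.sym (ℚ.↥p≡0⇒p≡0 q ≡.refl))))
  coefficient≈ι (mkℚ +[1+ _ ] _ _)   = refl
  coefficient≈ι (mkℚ -[1+ _ ] _ _)   = refl

  coefficient-≟ : ∀ p q → Maybe (coefficient p ≈ coefficient q)
  coefficient-≟ p q with p ℚ.≟ q
  ... | yes p≡q = just (reflexive (cong coefficient p≡q))
  ... | no  _   = nothing

  coefficient-morphism : ℚ.+-*-rawRing -Raw-AlmostCommutative⟶ fromCommutativeRing (commRing raw isCR)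
  coefficient-morphism = record
    { ⟦_⟧ = coefficient
    ; +-homo = λ p q → trans (coefficient≈ι (p ℚ.+ q)) (trans (+-homo p q)
        (sym (+-cong (coefficient≈ι p) (coefficient≈ι q))))
    ; *-homo = λ p q → trans (coefficient≈ι (p ℚ.* q)) (trans (*-homo p q)
        (sym (*-cong (coefficient≈ι p) (coefficient≈ι q))))
    ; -‿homo = λ p → trans (coefficient≈ι (ℚ.- p)) (trans (-‿homo p)
        (sym (-‿cong (coefficient≈ι p))))
    ; 0-homo = refl
    ; 1-homo = 1#-homo
    }

  open Reflective ℚ.+-*-rawRing (fromCommutativeRing (commRing raw isCR))
    coefficient-morphism coefficient-≟ public using (solve)

open Polynomial ℚ.+-*-rawRing public using ()
  renaming (_≈ₚ_ to _≈ᵠ_; _+ₚ_ to _+ᵠ_; -ₚ_ to -ᵠ_; _-ₚ_ to _-ᵠ_; _*ₚ_ to _*ᵠ_)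

Zero : List ℚ → Set
Zero = All (_≡ 0ℚ)

Zero⇒coeffs : ∀ {f} → Zero f → ∀ n → coeffℚ f n ≡ 0ℚ
Zero⇒coeffs []         _       = ≡.refl
Zero⇒coeffs (a≡0 ∷ _)  zero    = a≡0
Zero⇒coeffs (_ ∷ f≡0)  (suc n) = Zero⇒coeffs f≡0 n

module _ (A : ℚ-Algebra) where
  open ℚ-Algebra A
  open ℚ-Solver A
  open import Relation.Binary.Reasoning.Setoid setoid

  Root : List ℚ → Carrier → Set
  Root f x = ev f x ≈ 0#

  IsDivision : (f g q r : List ℚ) → Carrier → Set
  IsDivision f g q r x = ev f x ≈ ev g x * ev q x + ev r x

  ev-Zero : ∀ {f} x → Zero f → Root f x
  ev-Zero {f} x f≡0 = ev-zero f x (Zero⇒coeffs f≡0)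

  ev-one : ∀ x → ev (1ℚ ∷ []) x ≈ ι 1ℚ
  ev-one x = solve 2 (λ o x → o :+ x :* con 0ℚ := o) (ι 1ℚ) x

  ev-ι : ∀ f t → ev f (ι t) ≈ ι (Polynomial.eval ℚ.+-*-rawRing f t)
  ev-ι []      t = sym 0#-homo
  ev-ι (a ∷ f) t = trans (+-congˡ (trans (*-congˡ (ev-ι f t)) (sym (*-homo t _)))) (sym (+-homo a _))

  division-zero : ∀ f g → f ≈ g * 0# + f
  division-zero = solve 2 (λ f g → f := g :* con 0ℚ :+ f)

  -- One step of long division by the monic `g ∷ʳ 1ℚ`, with constant terms first. The old remainder,
  -- shifted by `a`, is one coefficient too long; its top coefficient `c` becomes the new lowest
  -- coefficient of the quotient, and c times the divisor is subtracted.
  division-suc : ∀ x a c f g q r w → length w ≡ length g → a ∷ r ≡ w ∷ʳ c →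
    ev f x ≈ ev (g ∷ʳ 1ℚ) x * ev q x + ev r x →
    ev (a ∷ f) x ≈ ev (g ∷ʳ 1ℚ) x * ev (c ∷ q) x + ev (w -ᵠ map (c ℚ.*_) g) x
  division-suc x a c f g q r w |w| a∷r≡w∷c division = begin
    ι a + x * ev f x
      ≈⟨ +-congˡ (*-congˡ division) ⟩
    ι a + x * (ev (g ∷ʳ 1ℚ) x * ev q x + ev r x)
      ≈⟨ solve 5 (λ a x g q r → a :+ x :* (g :* q :+ r) := x :* (g :* q) :+ (a :+ x :* r))
           (ι a) x (ev (g ∷ʳ 1ℚ) x) (ev q x) (ev r x) ⟩
    x * (ev (g ∷ʳ 1ℚ) x * ev q x) + ev (a ∷ r) x
      ≈⟨ +-cong (*-congˡ (*-congʳ (ev-∷ʳ g 1ℚ x))) (trans (reflexive (cong (λ f → ev f x) a∷r≡w∷c)) (ev-∷ʳ w c x)) ⟩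
    x * ((ev g x + pow x (length g) * ι 1ℚ) * ev q x) + (ev w x + pow x (length w) * ι c)
      ≈⟨ +-congˡ (+-congˡ (*-congʳ (reflexive (cong (pow x) |w|)))) ⟩
    x * ((ev g x + pow x (length g) * ι 1ℚ) * ev q x) + (ev w x + pow x (length g) * ι c)
      ≈⟨ solve 6 (λ x g p q w c → x :* ((g :+ p :* con 1ℚ) :* q) :+ (w :+ p :* c)
           := (g :+ p :* con 1ℚ) :* (c :+ x :* q) :+ (w :- c :* g))
           x (ev g x) (pow x (length g)) (ev q x) (ev w x) (ι c) ⟩
    (ev g x + pow x (length g) * ι 1ℚ) * (ι c + x * ev q x) + (ev w x - ι c * ev g x)
      ≈⟨ +-cong (*-congʳ (ev-∷ʳ g 1ℚ x)) (trans (ev-- w (map (c ℚ.*_) g) x) (+-congˡ (-‿cong (ev-scale c g x)))) ⟨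
    ev (g ∷ʳ 1ℚ) x * ev (c ∷ q) x + ev (w -ᵠ map (c ℚ.*_) g) x ∎

  ev-monic : ∀ x w c c⁻¹ → c⁻¹ ℚ.* c ≡ 1ℚ →
    ev (map (c⁻¹ ℚ.*_) w ∷ʳ 1ℚ) x ≈ ι c⁻¹ * ev (w ∷ʳ c) x
  ev-monic x w c c⁻¹ inv = begin
    ev (g ∷ʳ 1ℚ) x                               ≈⟨ ev-∷ʳ g 1ℚ x ⟩
    ev g x + pow x (length g) * ι 1ℚ             ≈⟨ +-cong (ev-scale c⁻¹ w x)
                                                      (*-cong (reflexive (cong (pow x) (length-map (c⁻¹ ℚ.*_) w)))
                                                        (trans (reflexive (cong ι (≡.sym inv))) (*-homo c⁻¹ c))) ⟩
    ι c⁻¹ * ev w x + pow x (length w) * (ι c⁻¹ * ι c)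
      ≈⟨ solve 4 (λ i w p c → i :* w :+ p :* (i :* c) := i :* (w :+ p :* c))
           (ι c⁻¹) (ev w x) (pow x (length w)) (ι c) ⟩
    ι c⁻¹ * (ev w x + pow x (length w) * ι c)    ≈⟨ *-congˡ (ev-∷ʳ w c x) ⟨
    ι c⁻¹ * ev (w ∷ʳ c) x                        ∎
    where g = map (c⁻¹ ℚ.*_) w

  ev-∷ʳ-0 : ∀ x w → ev (w ∷ʳ 0ℚ) x ≈ ev w x
  ev-∷ʳ-0 x w = begin
    ev (w ∷ʳ 0ℚ) x                     ≈⟨ ev-∷ʳ w 0ℚ x ⟩
    ev w x + pow x (length w) * ι 0ℚ   ≈⟨ +-congˡ (*-congˡ 0#-homo) ⟩
    ev w x + pow x (length w) * 0#     ≈⟨ solve 2 (λ w p → w :+ p :* con 0ℚ := w) (ev w x) (pow x (length w)) ⟩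
    ev w x                             ∎

  exact-division : ∀ {f g q r} → g ≈ 0# → f ≈ g * q + r → f ≈ r
  exact-division {f} {g} {q} {r} g≈0 f≈gq+r = begin
    f             ≈⟨ f≈gq+r ⟩
    g * q + r     ≈⟨ +-congʳ (*-congʳ g≈0) ⟩
    0# * q + r    ≈⟨ solve 2 (λ q r → con 0ℚ :* q :+ r := r) q r ⟩
    r             ∎

  drop-zero : ∀ {f p r} → f ≈ p + r → r ≈ 0# → p ≈ f
  drop-zero {f} {p} {r} f≈p+r r≈0 = sym (trans f≈p+r (trans (+-congˡ r≈0) (+-identityʳ p)))

unsnoc⁺ : ∀ (a : ℚ) f → ∃[ w ] ∃[ c ] a ∷ f ≡ w ∷ʳ c
unsnoc⁺ a []      = [] , a , ≡.refl
unsnoc⁺ a (b ∷ f) with unsnoc⁺ b f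
... | w , c , eq = a ∷ w , c , cong (a ∷_) eq

length-∷ʳ : ∀ (f : List ℚ) c → length (f ∷ʳ c) ≡ suc (length f)
length-∷ʳ f c = ≡.trans (length-++ f) (ℕ.+-comm (length f) 1)

last-∷ʳ : ∀ (f : List ℚ) c → last (f ∷ʳ c) ≡ just c
last-∷ʳ []          c = ≡.refl
last-∷ʳ (_ ∷ [])    c = ≡.refl
last-∷ʳ (_ ∷ a ∷ f) c = last-∷ʳ (a ∷ f) c

last-∷ : ∀ a (f : List ℚ) {n} → length f ≡ suc n → last (a ∷ f) ≡ last f
last-∷ a (_ ∷ _) _ = ≡.refl

last-Zero : ∀ f {c} → Zero f → last f ≡ just c → c ≡ 0ℚ
last-Zero (a ∷ [])    (a≡0 ∷ []) eq = ≡.trans (≡.sym (just-injective eq)) a≡0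
last-Zero (_ ∷ b ∷ f) (_ ∷ f≡0)  eq = last-Zero (b ∷ f) f≡0 eq

length-+ᵠ : ∀ f g → length f ≡ length g → length (f +ᵠ g) ≡ length f
length-+ᵠ []      []      eq = ≡.refl
length-+ᵠ (_ ∷ f) (_ ∷ g) eq = cong suc (length-+ᵠ f g (ℕ.suc-injective eq))

-- The divisor is the monic polynomial g ∷ʳ 1.
record Division (g f : List ℚ) (k : ℕ) : Set₁ where
  field
    quotient residue : List ℚ
    length-quotient    : length quotient ≡ k
    length-residue   : length residue ≡ length g
    -- The divisor is monic, so the quotient inherits the leading coefficient of `f`; this is how a
    -- quotient is seen to be nonzero.
    last-quotient      : ∀ {c j} → k ≡ suc j → last f ≡ just c → last quotient ≡ just c
    short              : k ≡ 0 → residue ≡ f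
    -- One quotient and one residue for all algebras and points, to be evaluated at two roots lying
    -- in different algebras.
    division           : ∀ A x → IsDivision A f (g ∷ʳ 1ℚ) quotient residue x

divide-step : ∀ g a f k → length f ≡ k ℕ.+ length g → Division g f k → Division g (a ∷ f) (suc k)
divide-step g a f k len D = go (unsnoc⁺ a residue)
  where
  open Division D

  go : ∃[ w ] ∃[ c ] a ∷ residue ≡ w ∷ʳ c → Division g (a ∷ f) (suc k)
  go (w , c , a∷r≡w∷c) = record
    { quotient = c ∷ quotient
    ; residue = w -ᵠ map (c ℚ.*_) g
    ; length-quotient = cong suc length-quotient
    ; length-residue = ≡.trans (length-+ᵠ w (-ᵠ map (c ℚ.*_) g) (≡.trans |w| (≡.sym
        (≡.trans (length-map ℚ.-_ (map (c ℚ.*_) g)) (length-map (c ℚ.*_) g))))) |w|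
    ; last-quotient = λ _ → last-c∷q k ≡.refl
    ; short = λ ()
    ; division = λ A x → division-suc A x a c f g quotient residue w |w| a∷r≡w∷c (division A x)
    }
    where
    |w| : length w ≡ length g
    |w| = ℕ.suc-injective (≡.trans (≡.sym (length-∷ʳ w c))
      (≡.trans (cong length (≡.sym a∷r≡w∷c)) (cong suc length-residue)))

    last-c∷q : ∀ i → k ≡ i → ∀ {b} → last (a ∷ f) ≡ just b → last (c ∷ quotient) ≡ just b
    last-c∷q zero    k≡0 last-f with quotient | length-quotient
    ... | []    | _   = ≡.trans (≡.sym (last-∷ʳ w c)) (≡.trans (cong last (≡.sym a∷r≡w∷c))
      (≡.trans (cong (λ r → last (a ∷ r)) (short k≡0)) last-f))
    ... | _ ∷ _ | len = contradiction (≡.trans len k≡0) λ ()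
    last-c∷q (suc i) k≡1+i last-f = ≡.trans (last-∷ c quotient (≡.trans length-quotient k≡1+i))
      (last-quotient k≡1+i (≡.trans (≡.sym (last-∷ a f (≡.trans len (cong (ℕ._+ length g) k≡1+i)))) last-f))

divide : ∀ g f k → length f ≡ k ℕ.+ length g → Division g f k
divide g f zero len = record
  { quotient = [] ; residue = f ; length-quotient = ≡.refl ; length-residue = len
  ; last-quotient = λ () ; short = λ _ → ≡.refl
  ; division = λ A x → division-zero A (ℚ-Algebra.ev A f x) (ℚ-Algebra.ev A (g ∷ʳ 1ℚ) x)
  }
divide g (a ∷ f) (suc k) len = divide-step g a f k (ℕ.suc-injective len) (divide g f k (ℕ.suc-injective len))

-- Linear independence of 1, x, ..., x^(k-1) over ℚ. For a root x of a monic polynomial of degree k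
-- it says that this polynomial is minimal.
Independent : (A : ℚ-Algebra) → ℚ-Algebra.Carrier A → ℕ → Set
Independent A x k = ∀ f → length f ℕ.≤ k → ev f x ≈ 0# → Zero f
  where open ℚ-Algebra A

NonTrivial : ℚ-Algebra → Set
NonTrivial A = ¬ (ι 1ℚ ≈ 0#)
  where open ℚ-Algebra A

-- The negative form is the one that holds in ℝ: from x y = 0 one cannot decide which factor
-- vanishes.
Domain : ℚ-Algebra → Set
Domain A = ∀ x y → x * y ≈ 0# → ¬ x ≈ 0# → ¬ y ≈ 0# → ⊥
  where open ℚ-Algebra A

-- Coefficients are rational, so it is decidable whether the top one vanishes. If it does, the
-- relation is shorter; if not, a relation of full length can be divided by it and becomes monic of
-- degree `d`.
independent-suc : ∀ A x {d} → Independent A x d →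
  (∀ g → length g ≡ d → ¬ Root A (g ∷ʳ 1ℚ) x) → Independent A x (suc d)
independent-suc A x {d} indep no-monic []      _         _    = []
independent-suc A x {d} indep no-monic (a ∷ f) (s≤s |f|≤d) f≈0 = go (unsnoc⁺ a f)
  where
  open ℚ-Algebra A using (ev; ι; _≈_; 0#; trans; sym; reflexive; *-congˡ; zeroʳ)

  go : ∃[ w ] ∃[ c ] a ∷ f ≡ w ∷ʳ c → Zero (a ∷ f)
  go (w , c , eq) = ≡.subst Zero (≡.sym eq) (by-cases (c ℚ.≟ 0ℚ))
    where
    |w| : length w ≡ length f
    |w| = ℕ.suc-injective (≡.trans (≡.sym (length-∷ʳ w c)) (cong length (≡.sym eq)))

    wc≈0 : ev (w ∷ʳ c) x ≈ 0#
    wc≈0 = trans (reflexive (cong (λ f → ev f x) (≡.sym eq))) f≈0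

    by-cases : Dec (c ≡ 0ℚ) → Zero (w ∷ʳ c)
    by-cases (yes ≡.refl) = ++⁺ (indep w (≡.subst (ℕ._≤ d) (≡.sym |w|) |f|≤d)
      (trans (sym (ev-∷ʳ-0 A x w)) wc≈0)) (≡.refl ∷ [])
    by-cases (no c≢0) with ℕ.m≤n⇒m<n∨m≡n |f|≤d
    ... | inj₁ |f|<d = indep (w ∷ʳ c) (≡.subst (ℕ._≤ d) (≡.trans (cong suc (≡.sym |w|)) (≡.sym (length-∷ʳ w c))) |f|<d)
      wc≈0
    ... | inj₂ |f|≡d = contradiction monic≈0 (no-monic (map (c⁻¹ ℚ.*_) w)
      (≡.trans (length-map (c⁻¹ ℚ.*_) w) (≡.trans |w| |f|≡d)))
      where
      instance _ = ℚ.≢-nonZero c≢0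
      c⁻¹ = ℚ.1/ c

      monic≈0 : ev (map (c⁻¹ ℚ.*_) w ∷ʳ 1ℚ) x ≈ 0#
      monic≈0 = trans (ev-monic A x w c c⁻¹ (ℚ.*-inverseˡ c))
        (trans (*-congˡ wc≈0) (zeroʳ (ι c⁻¹)))

independent-zero : ∀ (A : ℚ-Algebra) x → Independent A x 0
independent-zero A x [] _ _ = []

-- A common root of F and of a monic polynomial of smaller degree would
-- make F reducible, by induction on that degree and division.
independent-transfer : ∀ A B x y → Domain A → NonTrivial B →
  ∀ F n → length F ≡ suc n → last F ≡ just 1ℚ →
  Independent A x n → Root A F x → Root B F y →
  ∀ d → d ℕ.≤ n → Independent B y d
independent-transfer A B x y domain 1≉0 F n |F| last-F indep Fx≈0 Fy≈0 = go
  where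
  module A = ℚ-Algebra A
  module B = ℚ-Algebra B

  no-monic : ∀ g → suc (length g) ℕ.≤ n → Independent B y (length g) → ¬ (B.ev (g ∷ʳ 1ℚ) y B.≈ B.0#)
  no-monic [] _ _ Gy≈0 = 1≉0 (B.trans (B.sym (ev-one B y)) Gy≈0)
  no-monic g@(_ ∷ g′) |g|<n indep-y Gy≈0 =
    domain (A.ev (g ∷ʳ 1ℚ) x) (A.ev quotient x) Gq≈0
      (λ Gx≈0 → 1≢0 (last-Zero (g ∷ʳ 1ℚ) (indep (g ∷ʳ 1ℚ) (≡.subst (ℕ._≤ n) (≡.sym (length-∷ʳ g 1ℚ)) |g|<n) Gx≈0) (last-∷ʳ g 1ℚ)))
      (λ qx≈0 → 1≢0 (last-Zero quotient (indep quotient (≡.subst (ℕ._≤ n) (≡.sym length-quotient) k≤n) qx≈0) (last-quotient k-suc last-F)))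
    where
    1≢0 : 1ℚ ≡ 0ℚ → ⊥
    1≢0 ()

    -- The length of the quotient: degree n minus degree `length g`, plus one.
    k = n ℕ.∸ length g′

    k≤n : k ℕ.≤ n
    k≤n = ℕ.m∸n≤m n (length g′)

    g′<n : length g′ ℕ.< n
    g′<n = ℕ.<-trans (ℕ.n<1+n _) |g|<n

    k-suc : k ≡ suc (ℕ.pred k)
    k-suc = ≡.sym (ℕ.suc-pred k {{ℕ.>-nonZero (ℕ.m<n⇒0<n∸m g′<n)}})

    |F|≡ : length F ≡ k ℕ.+ length g
    |F|≡ = ≡.trans |F| (≡.trans (cong suc (≡.sym (ℕ.m∸n+n≡m (ℕ.<⇒≤ g′<n)))) (≡.sym (ℕ.+-suc k (length g′))))

    open Division (divide g F k |F|≡)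

    -- The residue vanishes at `y` and is short enough for the independence already known there. As
    -- the zero polynomial it also vanishes at `x`, where F = G q then contradicts independence.
    residue≡0 : Zero residue
    residue≡0 = indep-y residue (ℕ.≤-reflexive length-residue)
      (B.trans (B.sym (exact-division B Gy≈0 (division B y))) Fy≈0)

    Gq≈0 : A.ev (g ∷ʳ 1ℚ) x A.* A.ev quotient x A.≈ A.0#
    Gq≈0 = A.trans (drop-zero A (division A x) (ev-Zero A x residue≡0)) Fx≈0

  go : ∀ d → d ℕ.≤ n → Independent B y d
  go zero    _    = independent-zero B y
  go (suc d) d<n = independent-suc B y (go d (ℕ.<⇒≤ d<n)) λ g |g| →
    no-monic g (≡.subst (λ j → suc j ℕ.≤ n) (≡.sym |g|) d<n) (≡.subst (Independent B y) (≡.sym |g|) (go d (ℕ.<⇒≤ d<n)))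

-- A polynomial vanishing at `x` is a multiple of the minimal polynomial of `x`, hence vanishes at
-- every other root of the latter.
vanishing-transfer : ∀ A B x y g →
  Independent A x (length g) → Root A (g ∷ʳ 1ℚ) x → Root B (g ∷ʳ 1ℚ) y →
  ∀ h k → length h ≡ k ℕ.+ length g → Root A h x → Root B h y
vanishing-transfer A B x y g indep Gx≈0 Gy≈0 h k |h| hx≈0 =
  B.trans (exact-division B Gy≈0 (division B y)) (ev-Zero B y residue≡0)
  where
  module A = ℚ-Algebra A
  module B = ℚ-Algebra B
  open Division (divide g h k |h|)

  residue≡0 : Zero residue
  residue≡0 = indep residue (ℕ.≤-reflexive length-residue)
    (A.trans (A.sym (exact-division A Gx≈0 (division A x))) hx≈0)

-- Ordered ℚ-algebras

-- The order is given by its strictly positive elements.  Apartness from 0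
-- is only available up to double negation, in the form of `tight`.
record Ordered : Set₁ where
  field
    algebra : ℚ-Algebra
  open ℚ-Algebra algebra public
  field
    Pos      : Carrier → Set
    pos-resp : ∀ {x y} → x ≈ y → Pos x → Pos y
    pos-+    : ∀ {x y} → Pos x → Pos y → Pos (x + y)
    pos-*    : ∀ {x y} → Pos x → Pos y → Pos (x * y)
    ¬pos-0   : ¬ Pos 0#
    tight    : ∀ {x} → ¬ Pos x → ¬ Pos (- x) → x ≈ 0#
    pos-ι    : ∀ {q} → 0ℚ ℚ.< q → Pos (ι q)

module OrderedProperties (O : Ordered) where
  open Ordered O
  open ℚ-Solver algebra

  NonNeg : Carrier → Set
  NonNeg x = ¬ Pos (- x)

  -- Trichotomy in the available form: a contradiction may be derived by cases on the sign of `x`.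
  sign : ∀ {x} → ¬ Pos x → ¬ (x ≈ 0#) → ¬ Pos (- x) → ⊥
  sign ¬pos x≉0 ¬neg = x≉0 (tight ¬pos ¬neg)

  pos⇒≉0 : ∀ {x} → Pos x → ¬ (x ≈ 0#)
  pos⇒≉0 pos x≈0 = ¬pos-0 (pos-resp x≈0 pos)

  -- `tight` asks only for negations, and these follow from a doubly negated hypothesis. Equalities
  -- may therefore be proved by contradiction.
  ≈0-stable : ∀ {x} → ¬ ¬ (x ≈ 0#) → x ≈ 0#
  ≈0-stable ¬¬x≈0 = tight (λ pos → ¬¬x≈0 (pos⇒≉0 pos))
    (λ neg → ¬¬x≈0 λ x≈0 → pos⇒≉0 neg (trans (-‿cong x≈0) -0≈0))
    where
    -0≈0 : - 0# ≈ 0#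
    -0≈0 = solve 0 (:- con 0ℚ := con 0ℚ)

  ≈⇒-≈0 : ∀ {x y} → x ≈ y → x - y ≈ 0#
  ≈⇒-≈0 {x} {y} x≈y = trans (+-congʳ x≈y) (-‿inverseʳ y)

  -≈0⇒≈ : ∀ {x y} → x - y ≈ 0# → x ≈ y
  -≈0⇒≈ {x} {y} eq = trans (solve 2 (λ x y → x := (x :- y) :+ y) x y)
    (trans (+-congʳ eq) (+-identityˡ y))

  ≈-stable : ∀ {x y} → ¬ ¬ (x ≈ y) → x ≈ y
  ≈-stable ¬¬x≈y = -≈0⇒≈ (≈0-stable λ ¬eq → ¬¬x≈y λ x≈y → ¬eq (≈⇒-≈0 x≈y))

  pos⇒nonNeg : ∀ {x} → Pos x → NonNeg x
  pos⇒nonNeg {x} pos neg = ¬pos-0 (pos-resp (-‿inverseʳ x) (pos-+ pos neg))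

  ≈0⇒nonNeg : ∀ {x} → x ≈ 0# → NonNeg x
  ≈0⇒nonNeg x≈0 neg = pos⇒≉0 neg (trans (-‿cong x≈0) (solve 0 (:- con 0ℚ := con 0ℚ)))

  nonNeg-resp : ∀ {x y} → x ≈ y → NonNeg x → NonNeg y
  nonNeg-resp x≈y nonneg neg = nonneg (pos-resp (-‿cong (sym x≈y)) neg)

  pos+nonNeg≉0 : ∀ {x y} → Pos x → NonNeg y → ¬ (x + y ≈ 0#)
  pos+nonNeg≉0 {x} {y} pos nonneg eq = nonneg (pos-resp
    (trans (solve 2 (λ x y → x := (x :+ y) :+ :- y) x y)
      (trans (+-congʳ eq) (+-identityˡ (- y)))) pos)

  nonNeg-+ : ∀ {x y} → NonNeg x → NonNeg y → NonNeg (x + y)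
  nonNeg-+ {x} {y} nx ny neg = sign {x}
    (λ px → ny (pos-resp (solve 2 (λ x y → :- (x :+ y) :+ x := :- y) x y) (pos-+ neg px)))
    (λ x≈0 → ny (pos-resp (-‿cong (trans (+-congʳ x≈0) (+-identityˡ y))) neg))
    nx

  neg-*ˡ : ∀ x y → (- x) * y ≈ - (x * y)
  neg-*ˡ = solve 2 (λ x y → (:- x) :* y := :- (x :* y))

  neg-*-neg : ∀ x y → (- x) * (- y) ≈ x * y
  neg-*-neg = solve 2 (λ x y → (:- x) :* (:- y) := x :* y)

  domain : Domain algebra
  domain x y xy≈0 x≉0 y≉0 = sign {x}
    (λ px → sign {y} (λ py → pos⇒≉0 (pos-* px py) xy≈0) y≉0
      (λ ny → pos⇒≉0 (pos-* px ny)
        (trans (solve 2 (λ x y → x :* (:- y) := :- (x :* y)) x y) -xy≈0)))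
    x≉0
    (λ nx → sign {y} (λ py → pos⇒≉0 (pos-* nx py) (trans (neg-*ˡ x y) -xy≈0)) y≉0
      (λ ny → pos⇒≉0 (pos-* nx ny) (trans (neg-*-neg x y) xy≈0)))
    where
    -xy≈0 : - (x * y) ≈ 0#
    -xy≈0 = trans (-‿cong xy≈0) (solve 0 (:- con 0ℚ := con 0ℚ))

  nonNeg-* : ∀ {x y} → NonNeg x → NonNeg y → NonNeg (x * y)
  nonNeg-* {x} {y} nx ny neg = sign {x}
    (λ px → sign {y} (λ py → pos⇒nonNeg (pos-* px py) neg)
      (λ y≈0 → ≈0⇒nonNeg (trans (*-congˡ y≈0) (zeroʳ x)) neg) ny)
    (λ x≈0 → ≈0⇒nonNeg (trans (*-congʳ x≈0) (zeroˡ y)) neg)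
    nx

  nonNeg-square : ∀ x → NonNeg (x * x)
  nonNeg-square x neg = sign {x}
    (λ px → pos⇒nonNeg (pos-* px px) neg)
    (λ x≈0 → ≈0⇒nonNeg (trans (*-congˡ x≈0) (zeroʳ x)) neg)
    (λ nx → pos⇒nonNeg (pos-resp (neg-*-neg x x) (pos-* nx nx)) neg)

  square≈0 : ∀ {x} → x * x ≈ 0# → x ≈ 0#
  square≈0 {x} eq = ≈0-stable λ x≉0 → domain x x eq x≉0 x≉0

  nonNeg-ι : ∀ {q} → 0ℚ ℚ.≤ q → NonNeg (ι q)
  nonNeg-ι {q} 0≤q with ℚ.<-cmp 0ℚ q
  ... | tri< 0<q _ _   = pos⇒nonNeg (pos-ι 0<q)
  ... | tri≈ _ ≡.refl _ = ≈0⇒nonNeg 0#-homo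
  ... | tri> _ _ q<0   = contradiction (ℚ.<-≤-trans q<0 0≤q) (ℚ.<-irrefl ≡.refl)

  ι-injective : ∀ {q} → ι q ≈ 0# → q ≡ 0ℚ
  ι-injective {q} ιq≈0 with ℚ.<-cmp 0ℚ q
  ... | tri< 0<q _ _ = contradiction ιq≈0 (pos⇒≉0 (pos-ι 0<q))
  ... | tri≈ _ 0≡q _ = ≡.sym 0≡q
  ... | tri> _ _ q<0 = contradiction
    (trans (-‿homo q) (trans (-‿cong ιq≈0) (solve 0 (:- con 0ℚ := con 0ℚ))))
    (pos⇒≉0 (pos-ι (ℚ.neg-antimono-< q<0)))

  nonTrivial : NonTrivial algebra
  nonTrivial 1≈0 with ι-injective 1≈0
  ... | ()

  nonNeg-ev : ∀ {f x} → All (0ℚ ℚ.≤_) f → NonNeg x → NonNeg (ev f x)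
  nonNeg-ev []           nx = ≈0⇒nonNeg refl
  nonNeg-ev (0≤a ∷ 0≤f) nx = nonNeg-+ (nonNeg-ι 0≤a) (nonNeg-* nx (nonNeg-ev 0≤f nx))

  -- The hypotheses are the real and imaginary part of z² - γ z + 1 = 0 for
  -- z = u + iv.
  unit-modulus : ∀ u v γ → ¬ ¬ Pos (ι (toℚ (+ 4)) - γ * γ) →
    (u * u - v * v) - γ * u + ι 1ℚ ≈ 0# → (u * v + v * u) - γ * v ≈ 0# →
    u * u + v * v ≈ ι 1ℚ
  unit-modulus u v γ ¬¬pos re≈0 im≈0 = ≈-stable λ u²+v²≉1 → ¬¬pos λ pos →
    -- The imaginary part factors as v (2u - γ). The case v = 0 would be a real root, impossible for
    -- the discriminant γ² - 4 < 0; the case 2u = γ gives the modulus.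
    domain v ((u + u) - γ)
      (trans (solve 3 (λ u v γ → v :* ((u :+ u) :- γ) := (u :* v :+ v :* u) :- γ :* v) u v γ) im≈0)
      (λ v≈0 → pos+nonNeg≉0 pos (nonNeg-square ((u + u) - γ)) (begin
        (ι four - γ * γ) + ((u + u) - γ) * ((u + u) - γ)
          ≈⟨ solve 3 (λ u v γ → (con four :- γ :* γ) :+ ((u :+ u) :- γ) :* ((u :+ u) :- γ)
               := con four :* ((u :* u :- v :* v) :- γ :* u :+ con 1ℚ) :+ con four :* (v :* v)) u v γ ⟩
        ι four * ((u * u - v * v) - γ * u + ι 1ℚ) + ι four * (v * v)
          ≈⟨ +-cong (*-congˡ re≈0) (*-congˡ (*-cong v≈0 v≈0)) ⟩
        ι four * 0# + ι four * (0# * 0#)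
          ≈⟨ solve 0 (con four :* con 0ℚ :+ con four :* (con 0ℚ :* con 0ℚ) := con 0ℚ) ⟩
        0# ∎))
      (λ 2u≈γ → u²+v²≉1 (-≈0⇒≈ (begin
        (u * u + v * v) - ι 1ℚ
          ≈⟨ solve 3 (λ u v γ → (u :* u :+ v :* v) :- con 1ℚ
               := u :* ((u :+ u) :- γ) :- ((u :* u :- v :* v) :- γ :* u :+ con 1ℚ)) u v γ ⟩
        u * ((u + u) - γ) - ((u * u - v * v) - γ * u + ι 1ℚ)
          ≈⟨ +-cong (*-congˡ 2u≈γ) (-‿cong re≈0) ⟩
        u * 0# - 0#
          ≈⟨ solve 1 (λ u → u :* con 0ℚ :- con 0ℚ := con 0ℚ) u ⟩
        0# ∎)))
    where
    open import Relation.Binary.Reasoning.Setoid setoid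
    four = toℚ (+ 4)

-- Reciprocal sextics and their trace cubics

2ℚ 3ℚ 4ℚ : ℚ
2ℚ = toℚ (+ 2)
3ℚ = toℚ (+ 3)
4ℚ = toℚ (+ 4)

-- y³ + p y² + q y + r and x⁶ + a x⁵ + b x⁴ + c x³ + b x² + a x + 1; the
-- latter is x³ times the former at y = x + 1/x when a = p, b = q + 3 and
-- c = r + 2p.
module Reciprocal (A : ℚ-Algebra) where
  open ℚ-Algebra A
  open ℚ-Solver A
  open import Relation.Binary.Reasoning.Setoid setoid

  cubic : Carrier → Carrier → Carrier → Carrier → Carrier
  cubic p q r y = r + y * (q + y * (p + y * (ι 1ℚ + y * 0#)))

  sextic : Carrier → Carrier → Carrier → Carrier → Carrier
  sextic a b c x = ι 1ℚ + x * (a + x * (b + x * (c + x * (b + x * (a + x * (ι 1ℚ + x * 0#))))))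

  quadratic : Carrier → Carrier → Carrier
  quadratic γ z = (z * z - γ * z) + ι 1ℚ

  -- Calculations modulo a relation d = 0 go through this lemma: the solver verifies e = e₀ + d k
  -- for an explicit cofactor k.
  drop-multiple : ∀ {e e₀ d} k → e ≈ e₀ + d * k → d ≈ 0# → e ≈ e₀
  drop-multiple {e} {e₀} {d} k eq d≈0 = begin
    e            ≈⟨ eq ⟩
    e₀ + d * k   ≈⟨ +-congˡ (*-congʳ d≈0) ⟩
    e₀ + 0# * k  ≈⟨ solve 2 (λ e k → e :+ con 0ℚ :* k := e) e₀ k ⟩
    e₀           ∎

  x*y≈x²+1 : ∀ {x x′} → x * x′ ≈ ι 1ℚ → x * (x + x′) - (x * x + ι 1ℚ) ≈ 0#
  x*y≈x²+1 {x} {x′} xx′≈1 = begin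
    x * (x + x′) - (x * x + ι 1ℚ)  ≈⟨ solve 2 (λ x x′ → x :* (x :+ x′) :- (x :* x :+ con 1ℚ) := x :* x′ :- con 1ℚ) x x′ ⟩
    x * x′ - ι 1ℚ                  ≈⟨ +-congʳ xx′≈1 ⟩
    ι 1ℚ - ι 1ℚ                    ≈⟨ -‿inverseʳ (ι 1ℚ) ⟩
    0#                             ∎

  cancel-unit : ∀ {x x′ e} → x * x′ ≈ ι 1ℚ → x * e ≈ 0# → e ≈ 0#
  cancel-unit {x} {x′} {e} xx′≈1 xe≈0 = begin
    e                ≈⟨ solve 1 (λ e → e := con 1ℚ :* e) e ⟩
    ι 1ℚ * e         ≈⟨ *-congʳ xx′≈1 ⟨
    x * x′ * e       ≈⟨ solve 3 (λ x x′ e → x :* x′ :* e := x′ :* (x :* e)) x x′ e ⟩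
    x′ * (x * e)     ≈⟨ *-congˡ xe≈0 ⟩
    x′ * 0#          ≈⟨ zeroʳ x′ ⟩
    0#               ∎

  sextic⇒cubic : ∀ {x x′} p q r → x * x′ ≈ ι 1ℚ →
    sextic p (q + ι 3ℚ) (r + ι 2ℚ * p) x ≈ 0# → cubic p q r (x + x′) ≈ 0#
  sextic⇒cubic {x} {x′} p q r xx′≈1 root =
    cancel-unit xx′≈1 (cancel-unit xx′≈1 (cancel-unit xx′≈1
      (trans (drop-multiple (w * w + w * v + v * v + p * x * (w + v) + q * (x * x))
        (solve 5 (λ x y p q r →
          let w = x :* y ; v = x :* x :+ con 1ℚ in
          x :* (x :* (x :* (r :+ y :* (q :+ y :* (p :+ y :* (con 1ℚ :+ y :* con 0ℚ))))))
          := (con 1ℚ :+ x :* (p :+ x :* ((q :+ con 3ℚ) :+ x :* ((r :+ con 2ℚ :* p) :+ x :* ((q :+ con 3ℚ)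
                :+ x :* (p :+ x :* (con 1ℚ :+ x :* con 0ℚ)))))))
             :+ (w :- v) :* (w :* w :+ w :* v :+ v :* v :+ p :* x :* (w :+ v) :+ q :* (x :* x))) x (x + x′) p q r)
        (x*y≈x²+1 xx′≈1)) root)))
    where
    w = x * (x + x′)
    v = x * x + ι 1ℚ

  sextic-factor : ∀ γ₀ γ₁ γ₂ z →
    sextic (- (γ₀ + γ₁ + γ₂)) ((γ₀ * γ₁ + γ₀ * γ₂ + γ₁ * γ₂) + ι 3ℚ)
      (- (γ₀ * γ₁ * γ₂) + ι 2ℚ * (- (γ₀ + γ₁ + γ₂))) z
    ≈ quadratic γ₀ z * (quadratic γ₁ z * quadratic γ₂ z)
  sextic-factor = solve 4 (λ γ₀ γ₁ γ₂ z →
    let a = :- (γ₀ :+ γ₁ :+ γ₂)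
        b = (γ₀ :* γ₁ :+ γ₀ :* γ₂ :+ γ₁ :* γ₂) :+ con 3ℚ
        c = :- (γ₀ :* γ₁ :* γ₂) :+ con 2ℚ :* a
        quad γ = (z :* z :- γ :* z) :+ con 1ℚ
    in (con 1ℚ :+ z :* (a :+ z :* (b :+ z :* (c :+ z :* (b :+ z :* (a :+ z :* (con 1ℚ :+ z :* con 0ℚ)))))))
       := quad γ₀ :* (quad γ₁ :* quad γ₂))

  sextic-cong : ∀ {a a′ b b′ c c′} x → a ≈ a′ → b ≈ b′ → c ≈ c′ → sextic a b c x ≈ sextic a′ b′ c′ x
  sextic-cong x a≈ b≈ c≈ =
    +-congˡ (*-congˡ (+-cong a≈ (*-congˡ (+-cong b≈ (*-congˡ (+-cong c≈ (*-congˡ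
      (+-cong b≈ (*-congˡ (+-congʳ a≈))))))))))

  -- From f(x) = x² (U(y) + V(y) x), y = x + 1/x, to the norm of U + V x.
  norm≈0 : ∀ {x x′} f₀ f₁ f₂ f₃ f₄ f₅ → x * x′ ≈ ι 1ℚ →
    f₀ + x * (f₁ + x * (f₂ + x * (f₃ + x * (f₄ + x * (f₅ + x * 0#))))) ≈ 0# →
    let y = x + x′
        U = ((f₂ - f₀) - f₄) + y * ((f₁ - f₅) + y * (f₀ + y * 0#))
        V = ((f₃ - f₁) - f₅) + y * ((f₄ - f₀) + y * (f₅ + y * 0#))
    in U * U + (y * (U * V) + V * V) ≈ 0#
  norm≈0 {x} {x′} f₀ f₁ f₂ f₃ f₄ f₅ xx′≈1 root = begin
    U * U + (y * (U * V) + V * V)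
      ≈⟨ drop-multiple (- (V * V)) (solve 4 (λ x x′ U V →
           U :* U :+ ((x :+ x′) :* (U :* V) :+ V :* V)
           := (U :+ V :* x) :* (U :+ V :* x′) :+ (x :* x′ :- con 1ℚ) :* (:- (V :* V))) x x′ U V)
           (trans (+-congʳ xx′≈1) (-‿inverseʳ (ι 1ℚ))) ⟩
    (U + V * x) * (U + V * x′)
      ≈⟨ *-congʳ (cancel-unit xx′≈1 (cancel-unit xx′≈1 (trans (drop-multiple
           (f₀ * (w + v) + (f₁ - f₅) * x + f₅ * x * (w + v) + (f₄ - f₀) * (x * x))
           (solve 8 (λ x y f₀ f₁ f₂ f₃ f₄ f₅ →
             let w = x :* y ; v = x :* x :+ con 1ℚ in
             x :* (x :* ((((f₂ :- f₀) :- f₄) :+ y :* ((f₁ :- f₅) :+ y :* (f₀ :+ y :* con 0ℚ)))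
               :+ (((f₃ :- f₁) :- f₅) :+ y :* ((f₄ :- f₀) :+ y :* (f₅ :+ y :* con 0ℚ))) :* x))
             := (f₀ :+ x :* (f₁ :+ x :* (f₂ :+ x :* (f₃ :+ x :* (f₄ :+ x :* (f₅ :+ x :* con 0ℚ))))))
                :+ (w :- v) :* (f₀ :* (w :+ v) :+ (f₁ :- f₅) :* x :+ f₅ :* x :* (w :+ v) :+ (f₄ :- f₀) :* (x :* x))) x y f₀ f₁ f₂ f₃ f₄ f₅)
           (x*y≈x²+1 xx′≈1)) root))) ⟩
    0# * (U + V * x′)
      ≈⟨ zeroˡ (U + V * x′) ⟩
    0# ∎
    where
    y = x + x′
    w = x * y
    v = x * x + ι 1ℚ
    U = ((f₂ - f₀) - f₄) + y * ((f₁ - f₅) + y * (f₀ + y * 0#))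
    V = ((f₃ - f₁) - f₅) + y * ((f₄ - f₀) + y * (f₅ + y * 0#))

  cubic-factor : ∀ γ₀ γ₁ γ₂ y →
    cubic (- (γ₀ + γ₁ + γ₂)) (γ₀ * γ₁ + γ₀ * γ₂ + γ₁ * γ₂) (- (γ₀ * γ₁ * γ₂)) y
    ≈ (y - γ₀) * ((y - γ₁) * (y - γ₂))
  cubic-factor = solve 4 (λ γ₀ γ₁ γ₂ y →
    (:- (γ₀ :* γ₁ :* γ₂)) :+ y :* ((γ₀ :* γ₁ :+ γ₀ :* γ₂ :+ γ₁ :* γ₂) :+ y :* ((:- (γ₀ :+ γ₁ :+ γ₂)) :+ y :* (con 1ℚ :+ y :* con 0ℚ)))
    := (y :- γ₀) :* ((y :- γ₁) :* (y :- γ₂)))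

  cubic-cong : ∀ {p p′ q q′ r r′} y → p ≈ p′ → q ≈ q′ → r ≈ r′ → cubic p q r y ≈ cubic p′ q′ r′ y
  cubic-cong y p≈ q≈ r≈ = +-cong r≈ (*-congˡ (+-cong q≈ (*-congˡ (+-congʳ p≈))))

  -- If z = γ² for a root γ of the cubic, then γ (z + q) = - (p z + r), and
  -- z + q is invertible with inverse M(z) d.
  module SquareRoot (p q r z d : Carrier)
    (resolvent : z * ((z + q) * (z + q)) - (p * z + r) * (p * z + r) ≈ 0#)
    (inverse : (r - p * q) * (r - p * q) * d ≈ ι 1ℚ) where

    M s E γ : Carrier
    -- With K(z) = z (z + q)² - (p z + r)² one has K(-q) = -(r - p q)² = -`E`, and `M` is the
    -- quotient of K(z) - K(-q) by z + q. At a root of K it inverts z + q up to the constant `E`.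
    M = (z * z + q * z - p * p * z) - (p * r + p * r) + p * p * q
    s = p * z + r
    E = (r - p * q) * (r - p * q)
    γ = - (s * (M * d))

    private
      [z+q]M≈E : (z + q) * M ≈ E
      [z+q]M≈E = drop-multiple (ι 1ℚ) (solve 4 (λ p q r z →
        (z :+ q) :* ((z :* z :+ q :* z :- p :* p :* z) :- (p :* r :+ p :* r) :+ p :* p :* q)
        := (r :- p :* q) :* (r :- p :* q)
           :+ (z :* ((z :+ q) :* (z :+ q)) :- (p :* z :+ r) :* (p :* z :+ r)) :* con 1ℚ) p q r z) resolvent

      unit : (z + q) * M * d ≈ ι 1ℚ
      unit = trans (*-congʳ [z+q]M≈E) inverse

    γ²≈z : γ * γ ≈ z
    γ²≈z = begin
      γ * γ
        ≈⟨ drop-multiple (- (M * d * (M * d))) (solve 5 (λ z u s M d →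
             (:- (s :* (M :* d))) :* (:- (s :* (M :* d)))
             := z :* (u :* M :* d) :* (u :* M :* d) :+ (z :* (u :* u) :- s :* s) :* (:- (M :* d :* (M :* d)))) z (z + q) s M d) resolvent ⟩
      z * ((z + q) * M * d) * ((z + q) * M * d)
        ≈⟨ *-cong (*-congˡ unit) unit ⟩
      z * ι 1ℚ * ι 1ℚ
        ≈⟨ solve 1 (λ z → z :* con 1ℚ :* con 1ℚ := z) z ⟩
      z ∎

    cubic-γ≈0 : cubic p q r γ ≈ 0#
    cubic-γ≈0 = begin
      cubic p q r γ
        ≈⟨ solve 4 (λ p q r γ → r :+ γ :* (q :+ γ :* (p :+ γ :* (con 1ℚ :+ γ :* con 0ℚ)))
             := γ :* (γ :* γ :+ q) :+ (p :* (γ :* γ) :+ r)) p q r γ ⟩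
      γ * (γ * γ + q) + (p * (γ * γ) + r)
        ≈⟨ +-cong (*-congˡ (+-congʳ γ²≈z)) (+-congʳ (*-congˡ γ²≈z)) ⟩
      γ * (z + q) + s
        ≈⟨ solve 4 (λ u s M d → (:- (s :* (M :* d))) :* u :+ s := s :* (con 1ℚ :- u :* M :* d)) (z + q) s M d ⟩
      s * (ι 1ℚ - (z + q) * M * d)
        ≈⟨ *-congˡ (trans (+-congˡ (-‿cong unit)) (-‿inverseʳ (ι 1ℚ))) ⟩
      s * 0#
        ≈⟨ zeroʳ s ⟩
      0# ∎

-- The roots of a reciprocal sextic

evalᵠ : List ℚ → ℚ → ℚ
evalᵠ = Polynomial.eval ℚ.+-*-rawRing

explicit₆ : ∀ f → length f ℕ.≤ 6 →
  f ≈ᵠ (coeffℚ f 0 ∷ coeffℚ f 1 ∷ coeffℚ f 2 ∷ coeffℚ f 3 ∷ coeffℚ f 4 ∷ coeffℚ f 5 ∷ [])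
explicit₆ f |f|≤6 0 = ≡.refl
explicit₆ f |f|≤6 1 = ≡.refl
explicit₆ f |f|≤6 2 = ≡.refl
explicit₆ f |f|≤6 3 = ≡.refl
explicit₆ f |f|≤6 4 = ≡.refl
explicit₆ f |f|≤6 5 = ≡.refl
explicit₆ f |f|≤6 (suc (suc (suc (suc (suc (suc n)))))) =
  beyond f (ℕ.≤-trans |f|≤6 (ℕ.m≤m+n 6 n))
  where
  beyond : ∀ f {n} → length f ℕ.≤ n → coeffℚ f n ≡ 0ℚ
  beyond []      _         = ≡.refl
  beyond (_ ∷ f) (s≤s |f|≤n) = beyond f |f|≤n

coeffs⇒Zero : ∀ f → (∀ n → coeffℚ f n ≡ 0ℚ) → Zero f
coeffs⇒Zero []      _   = []
coeffs⇒Zero (a ∷ f) f≡0 = f≡0 0 ∷ coeffs⇒Zero f (λ n → f≡0 (suc n))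

module SalemRoots (O : Ordered) where
  open Ordered O
  open OrderedProperties O
  open ℚ-Solver algebra
  open Reciprocal algebra
  open import Relation.Binary.Reasoning.Setoid setoid

  -- From β and τ alone: γ₀ = β + 1/β, γ₁ with γ₁² = 4 - τ², and γ₂ from the sum of the roots. The
  -- other two Vieta relations then have to be derived.
  module FromRoots (a b c q r d : ℚ)
    (b≡ : b ≡ q ℚ.+ 3ℚ) (c≡ : c ≡ r ℚ.+ 2ℚ ℚ.* a)
    (irreducible : ∀ t → evalᵠ (r ∷ q ∷ a ∷ 1ℚ ∷ []) t ≢ 0ℚ)
    (d-inverse : (r ℚ.- a ℚ.* q) ℚ.* (r ℚ.- a ℚ.* q) ℚ.* d ≡ 1ℚ)
    (signs : 0ℚ ℚ.< evalᵠ (r ∷ q ∷ a ∷ 1ℚ ∷ []) 2ℚ ℚ.* evalᵠ (r ∷ q ∷ a ∷ 1ℚ ∷ []) (ℚ.- 2ℚ))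
    (β τ : Carrier) (1<β : Pos (β - ι 1ℚ)) (0<τ : Pos τ)
    (β-root : ev (1ℚ ∷ a ∷ b ∷ c ∷ b ∷ a ∷ 1ℚ ∷ []) β ≈ 0#)
    (τ-root : (ι 4ℚ - τ * τ) * (((ι 4ℚ - τ * τ) + ι q) * ((ι 4ℚ - τ * τ) + ι q))
      - (ι a * (ι 4ℚ - τ * τ) + ι r) * (ι a * (ι 4ℚ - τ * τ) + ι r) ≈ 0#)
    where

    private
      G : List ℚ
      G = r ∷ q ∷ a ∷ 1ℚ ∷ []

    ι-cong : ∀ {s t} → s ≡ t → ι s ≈ ι t
    ι-cong eq = reflexive (cong ι eq)

    ι-sub : ∀ s t → ι (s ℚ.- t) ≈ ι s - ι t
    ι-sub s t = trans (+-homo s (ℚ.- t)) (+-congˡ (-‿homo t))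

    ιb : ι b ≈ ι q + ι 3ℚ
    ιb = trans (ι-cong b≡) (+-homo q 3ℚ)

    ιc : ι c ≈ ι r + ι 2ℚ * ι a
    ιc = trans (ι-cong c≡) (trans (+-homo r (2ℚ ℚ.* a)) (+-congˡ (*-homo 2ℚ a)))

    -- The inverse of β without a division: the constant term of P is 1, so P(β) = 1 + β k = 0 gives
    -- 1/β = -k.
    β′ : Carrier
    β′ = - (ι a + β * (ι b + β * (ι c + β * (ι b + β * (ι a + β * (ι 1ℚ + β * 0#))))))

    ββ′≈1 : β * β′ ≈ ι 1ℚ
    ββ′≈1 = drop-multiple (- ι 1ℚ) (solve 2 (λ β k → β :* (:- k) := con 1ℚ :+ (con 1ℚ :+ β :* k) :* (:- con 1ℚ)) β (ι a + β * (ι b + β * (ι c + β * (ι b + β * (ι a + β * (ι 1ℚ + β * 0#))))))) β-root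

    0<β : Pos β
    0<β = pos-resp (solve 1 (λ β → (β :- con 1ℚ) :+ con 1ℚ := β) β) (pos-+ 1<β (pos-ι {1ℚ} (ℚ.positive⁻¹ 1ℚ)))

    γ₀ : Carrier
    γ₀ = β + β′

    γ₀-root : cubic (ι a) (ι q) (ι r) γ₀ ≈ 0#
    γ₀-root = sextic⇒cubic (ι a) (ι q) (ι r) ββ′≈1 (trans (sextic-cong β refl (sym ιb) (sym ιc)) β-root)

    no-rational-root : ∀ t → ¬ (ev G (ι t) ≈ 0#)
    no-rational-root t root = irreducible t (ι-injective (trans (sym (ev-ι algebra G t)) root))

    -- A cubic without rational roots is irreducible. A quadratic relation would divide it and leave
    -- a monic linear quotient, whose root is rational.
    root-independent : ∀ y → cubic (ι a) (ι q) (ι r) y ≈ 0# → Independent algebra y 3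
    root-independent y y-root = independent-suc algebra y independent₂ no-monic₂
      where
      linear-root : ∀ e → ev (e ∷ 1ℚ ∷ []) (ι (ℚ.- e)) ≈ 0#
      linear-root e = begin
        ι e + ι (ℚ.- e) * (ι 1ℚ + ι (ℚ.- e) * 0#)    ≈⟨ +-congˡ (*-cong (-‿homo e) (+-congˡ (*-congʳ (-‿homo e)))) ⟩
        ι e + (- ι e) * (ι 1ℚ + (- ι e) * 0#)        ≈⟨ solve 1 (λ e → e :+ (:- e) :* (con 1ℚ :+ (:- e) :* con 0ℚ) := con 0ℚ) (ι e) ⟩
        0#                                           ∎

      no-monic₀ : ∀ g → length g ≡ 0 → ¬ (ev (g ∷ʳ 1ℚ) y ≈ 0#)
      no-monic₀ [] _ eq = nonTrivial (trans (sym (ev-one algebra y)) eq)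

      no-monic₁ : ∀ g → length g ≡ 1 → ¬ (ev (g ∷ʳ 1ℚ) y ≈ 0#)
      no-monic₁ (e ∷ []) _ eq = no-rational-root (ℚ.- e) (trans (ev-congˣ G (sym (begin
        y                                        ≈⟨ solve 2 (λ e y → y := (e :+ y :* (con 1ℚ :+ y :* con 0ℚ)) :- e) (ι e) y ⟩
        (ι e + y * (ι 1ℚ + y * 0#)) - ι e        ≈⟨ +-congʳ eq ⟩
        0# - ι e                                 ≈⟨ +-identityˡ (- ι e) ⟩
        - ι e                                    ≈⟨ -‿homo e ⟨
        ι (ℚ.- e)                                ∎))) y-root)

      independent₂ : Independent algebra y 2
      independent₂ = independent-suc algebra y
        (independent-suc algebra y (independent-zero algebra y) no-monic₀) no-monic₁

      no-monic₂ : ∀ g → length g ≡ 2 → ¬ (ev (g ∷ʳ 1ℚ) y ≈ 0#)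
      no-monic₂ g@(e₀ ∷ e₁ ∷ []) _ eq = go quotient length-quotient (last-quotient ≡.refl ≡.refl) (division algebra)
        where
        open Division (divide g G 2 ≡.refl)

        residue≡0 : Zero residue
        residue≡0 = independent₂ residue (ℕ.≤-reflexive length-residue)
          (trans (sym (exact-division algebra eq (division algebra y))) y-root)

        go : ∀ s → length s ≡ 2 → last s ≡ just 1ℚ →
          (∀ x → ev G x ≈ ev (g ∷ʳ 1ℚ) x * ev s x + ev residue x) → ⊥
        go (s ∷ .1ℚ ∷ []) _ ≡.refl G≈ = no-rational-root (ℚ.- s) (begin
          ev G (ι (ℚ.- s))
            ≈⟨ G≈ (ι (ℚ.- s)) ⟩
          ev (g ∷ʳ 1ℚ) (ι (ℚ.- s)) * ev (s ∷ 1ℚ ∷ []) (ι (ℚ.- s)) + ev residue (ι (ℚ.- s))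
            ≈⟨ +-cong (*-congˡ (linear-root s)) (ev-Zero algebra (ι (ℚ.- s)) residue≡0) ⟩
          ev (g ∷ʳ 1ℚ) (ι (ℚ.- s)) * 0# + 0#
            ≈⟨ solve 1 (λ g → g :* con 0ℚ :+ con 0ℚ := con 0ℚ) (ev (g ∷ʳ 1ℚ) (ι (ℚ.- s))) ⟩
          0# ∎)

    z : Carrier
    z = ι 4ℚ - τ * τ

    private
      ι-disc : ι (r ℚ.- a ℚ.* q) ≈ ι r - ι a * ι q
      ι-disc = trans (ι-sub r (a ℚ.* q)) (+-congˡ (-‿cong (*-homo a q)))

      ι-inverse : (ι r - ι a * ι q) * (ι r - ι a * ι q) * ι d ≈ ι 1ℚ
      ι-inverse = begin
        (ι r - ι a * ι q) * (ι r - ι a * ι q) * ι d         ≈⟨ *-congʳ (*-cong ι-disc ι-disc) ⟨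
        ι (r ℚ.- a ℚ.* q) * ι (r ℚ.- a ℚ.* q) * ι d         ≈⟨ *-congʳ (*-homo (r ℚ.- a ℚ.* q) (r ℚ.- a ℚ.* q)) ⟨
        ι ((r ℚ.- a ℚ.* q) ℚ.* (r ℚ.- a ℚ.* q)) * ι d       ≈⟨ *-homo ((r ℚ.- a ℚ.* q) ℚ.* (r ℚ.- a ℚ.* q)) d ⟨
        ι ((r ℚ.- a ℚ.* q) ℚ.* (r ℚ.- a ℚ.* q) ℚ.* d)       ≈⟨ ι-cong d-inverse ⟩
        ι 1ℚ                                                ∎

    open SquareRoot (ι a) (ι q) (ι r) z (ι d) τ-root ι-inverse public using ()
      renaming (γ to γ₁; γ²≈z to γ₁²≈z; cubic-γ≈0 to γ₁-root)

    0<4-γ₁² : Pos (ι 4ℚ - γ₁ * γ₁)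
    0<4-γ₁² = pos-resp (begin
      τ * τ                      ≈⟨ solve 1 (λ τ → τ :* τ := con 4ℚ :- (con 4ℚ :- τ :* τ)) τ ⟩
      ι 4ℚ - z                   ≈⟨ +-congˡ (-‿cong γ₁²≈z) ⟨
      ι 4ℚ - γ₁ * γ₁             ∎) (pos-* 0<τ 0<τ)

    -- The inequality γ₀ > 2 in a form cleared of denominators, from γ₀² - 4 = (β - 1/β)².
    β²[γ₀²-4]≈ : (β * β) * (γ₀ * γ₀ - ι 4ℚ) ≈ (β * β - ι 1ℚ) * (β * β - ι 1ℚ)
    β²[γ₀²-4]≈ = drop-multiple (β * γ₀ + (β * β + ι 1ℚ)) (solve 2 (λ β γ₀ →
      (β :* β) :* (γ₀ :* γ₀ :- con 4ℚ) := (β :* β :- con 1ℚ) :* (β :* β :- con 1ℚ)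
        :+ (β :* γ₀ :- (β :* β :+ con 1ℚ)) :* (β :* γ₀ :+ (β :* β :+ con 1ℚ))) β γ₀) (x*y≈x²+1 ββ′≈1)

    0<β²-1 : Pos (β * β - ι 1ℚ)
    0<β²-1 = pos-resp (solve 1 (λ β → (β :- con 1ℚ) :* (β :+ con 1ℚ) := β :* β :- con 1ℚ) β)
      (pos-* 1<β (pos-+ 0<β (pos-ι {1ℚ} (ℚ.positive⁻¹ 1ℚ))))

    0<β²[γ₀²-4] : Pos ((β * β) * (γ₀ * γ₀ - ι 4ℚ))
    0<β²[γ₀²-4] = pos-resp (sym β²[γ₀²-4]≈) (pos-* 0<β²-1 0<β²-1)

    γ₀≉γ₁ : ¬ (γ₀ - γ₁ ≈ 0#)
    γ₀≉γ₁ eq = pos⇒≉0 (pos-+ 0<β²[γ₀²-4] (pos-* (pos-* 0<β 0<β) 0<4-γ₁²)) (begin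
      (β * β) * (γ₀ * γ₀ - ι 4ℚ) + (β * β) * (ι 4ℚ - γ₁ * γ₁)
        ≈⟨ solve 3 (λ β γ₀ γ₁ → (β :* β) :* (γ₀ :* γ₀ :- con 4ℚ) :+ (β :* β) :* (con 4ℚ :- γ₁ :* γ₁)
             := (γ₀ :- γ₁) :* (β :* β :* (γ₀ :+ γ₁))) β γ₀ γ₁ ⟩
      (γ₀ - γ₁) * (β * β * (γ₀ + γ₁))
        ≈⟨ *-congʳ eq ⟩
      0# * (β * β * (γ₀ + γ₁))
        ≈⟨ zeroˡ _ ⟩
      0# ∎)

    γ₂ : Carrier
    γ₂ = - (ι a + γ₀ + γ₁)

    vieta₁ : ι a ≈ - (γ₀ + γ₁ + γ₂)
    vieta₁ = solve 3 (λ a γ₀ γ₁ → a := :- (γ₀ :+ γ₁ :+ :- (a :+ γ₀ :+ γ₁))) (ι a) γ₀ γ₁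

    private
      -- G(γ₀) - G(γ₁) is divisible by γ₀ - γ₁, and as γ₂ was chosen to make the sum of the roots
      -- correct, the quotient is exactly this difference. Since γ₀² > 4 > γ₁², the factor γ₀ - γ₁
      -- can be cancelled.
      vieta₂-0 : ι q - (γ₀ * γ₁ + γ₀ * γ₂ + γ₁ * γ₂) ≈ 0#
      vieta₂-0 = ≈0-stable λ ≉0 → domain (γ₀ - γ₁) _ (begin
        (γ₀ - γ₁) * (ι q - (γ₀ * γ₁ + γ₀ * γ₂ + γ₁ * γ₂))
          ≈⟨ solve 5 (λ a q r γ₀ γ₁ → let γ₂ = :- (a :+ γ₀ :+ γ₁)
                                          g = λ y → r :+ y :* (q :+ y :* (a :+ y :* (con 1ℚ :+ y :* con 0ℚ))) in
               (γ₀ :- γ₁) :* (q :- (γ₀ :* γ₁ :+ γ₀ :* γ₂ :+ γ₁ :* γ₂)) := g γ₀ :- g γ₁) (ι a) (ι q) (ι r) γ₀ γ₁ ⟩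
        cubic (ι a) (ι q) (ι r) γ₀ - cubic (ι a) (ι q) (ι r) γ₁
          ≈⟨ +-cong γ₀-root (-‿cong γ₁-root) ⟩
        0# - 0#
          ≈⟨ -‿inverseʳ 0# ⟩
        0# ∎) γ₀≉γ₁ ≉0

    vieta₂ : ι q ≈ γ₀ * γ₁ + γ₀ * γ₂ + γ₁ * γ₂
    vieta₂ = -≈0⇒≈ vieta₂-0

    vieta₃ : ι r ≈ - (γ₀ * γ₁ * γ₂)
    vieta₃ = -≈0⇒≈ (trans (drop-multiple (- γ₀) (solve 5 (λ a q r γ₀ γ₁ →
      let γ₂ = :- (a :+ γ₀ :+ γ₁) in
      r :- (:- (γ₀ :* γ₁ :* γ₂)) := (r :+ γ₀ :* (q :+ γ₀ :* (a :+ γ₀ :* (con 1ℚ :+ γ₀ :* con 0ℚ))))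
        :+ (q :- (γ₀ :* γ₁ :+ γ₀ :* γ₂ :+ γ₁ :* γ₂)) :* (:- γ₀)) (ι a) (ι q) (ι r) γ₀ γ₁) vieta₂-0) γ₀-root)

    ev-G : ∀ y → ev G y ≈ (y - γ₀) * ((y - γ₁) * (y - γ₂))
    ev-G y = trans (cubic-cong y vieta₁ vieta₂ vieta₃) (cubic-factor γ₀ γ₁ γ₂ y)

    -- The product of the 4 - γᵢ² is - G(2) G(-2) < 0.
    0<4-γ₂² : ¬ ¬ Pos (ι 4ℚ - γ₂ * γ₂)
    0<4-γ₂² ¬pos = sign ¬pos
      (λ eq → pos⇒≉0 product-pos (trans (*-congˡ eq) (zeroʳ _)))
      (λ neg → pos⇒nonNeg product-pos
        (pos-resp (solve 2 (λ s t → s :* (:- t) := :- (s :* t)) _ _)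
          (pos-* (pos-* 0<β²[γ₀²-4] 0<4-γ₁²) neg)))
      where
      product-pos : Pos (((β * β) * (γ₀ * γ₀ - ι 4ℚ)) * (ι 4ℚ - γ₁ * γ₁) * (ι 4ℚ - γ₂ * γ₂))
      product-pos = pos-resp (begin
        (β * β) * ι (evalᵠ G 2ℚ ℚ.* evalᵠ G (ℚ.- 2ℚ))
          ≈⟨ *-congˡ (trans (*-homo _ _) (*-cong (sym (ev-ι algebra G 2ℚ)) (sym (ev-ι algebra G (ℚ.- 2ℚ))))) ⟩
        (β * β) * (ev G (ι 2ℚ) * ev G (ι (ℚ.- 2ℚ)))
          ≈⟨ *-congˡ (*-cong (ev-G (ι 2ℚ)) (ev-G (ι (ℚ.- 2ℚ)))) ⟩
        (β * β) * ((ι 2ℚ - γ₀) * ((ι 2ℚ - γ₁) * (ι 2ℚ - γ₂)) * ((ι (ℚ.- 2ℚ) - γ₀) * ((ι (ℚ.- 2ℚ) - γ₁) * (ι (ℚ.- 2ℚ) - γ₂))))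
          ≈⟨ solve 4 (λ β γ₀ γ₁ γ₂ →
               (β :* β) :* ((con 2ℚ :- γ₀) :* ((con 2ℚ :- γ₁) :* (con 2ℚ :- γ₂)) :* ((con (ℚ.- 2ℚ) :- γ₀) :* ((con (ℚ.- 2ℚ) :- γ₁) :* (con (ℚ.- 2ℚ) :- γ₂))))
               := ((β :* β) :* (γ₀ :* γ₀ :- con 4ℚ)) :* (con 4ℚ :- γ₁ :* γ₁) :* (con 4ℚ :- γ₂ :* γ₂)) β γ₀ γ₁ γ₂ ⟩
        ((β * β) * (γ₀ * γ₀ - ι 4ℚ)) * (ι 4ℚ - γ₁ * γ₁) * (ι 4ℚ - γ₂ * γ₂) ∎)
        (pos-* (pos-* 0<β 0<β) (pos-ι signs))

    -- The norm of U + V β over ℚ(γ₀) vanishes, hence so does its conjugate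
    -- U² + γ₁ U V + V² at γ₁; this form is definite since γ₁² < 4.
    definite : ∀ u v → u * u + (γ₁ * (u * v) + v * v) ≈ 0# → u ≈ 0# × v ≈ 0#
    definite u v eq = square≈0 (begin
        u * u                                              ≈⟨ solve 3 (λ u v γ → u :* u := (u :* u :+ (γ :* (u :* v) :+ v :* v)) :+ v :* (:- (γ :* u :+ v))) u v γ₁ ⟩
        (u * u + (γ₁ * (u * v) + v * v)) + v * (- (γ₁ * u + v))  ≈⟨ +-cong eq (*-congʳ v≈0) ⟩
        0# + 0# * (- (γ₁ * u + v))                         ≈⟨ solve 1 (λ k → con 0ℚ :+ con 0ℚ :* k := con 0ℚ) _ ⟩
        0#                                                 ∎) , v≈0
      where
      v≈0 : v ≈ 0#
      v≈0 = ≈0-stable λ v≉0 → nonNeg-square v (≉0⇒neg v≉0)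
        where
        ≉0⇒neg : ¬ (v ≈ 0#) → Pos (- (v * v))
        ≉0⇒neg v≉0 = ⊥-elim (sign {v} (λ pos → contra (pos-* pos pos)) v≉0
          (λ neg → contra (pos-resp (neg-*-neg v v) (pos-* neg neg))))
          where
          contra : ¬ Pos (v * v)
          -- Completing the square: four times the form is (4 - γ₁²) v² + (2u + γ₁ v)².
          contra 0<v² = pos+nonNeg≉0 (pos-* 0<4-γ₁² 0<v²) (nonNeg-square ((u + u) + γ₁ * v)) (begin
            (ι 4ℚ - γ₁ * γ₁) * (v * v) + ((u + u) + γ₁ * v) * ((u + u) + γ₁ * v)
              ≈⟨ solve 3 (λ u v γ → (con 4ℚ :- γ :* γ) :* (v :* v) :+ ((u :+ u) :+ γ :* v) :* ((u :+ u) :+ γ :* v)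
                   := con 4ℚ :* (u :* u :+ (γ :* (u :* v) :+ v :* v))) u v γ₁ ⟩
            ι 4ℚ * (u * u + (γ₁ * (u * v) + v * v))
              ≈⟨ trans (*-congˡ eq) (zeroʳ (ι 4ℚ)) ⟩
            0# ∎)

    private
      independent-explicit : ∀ f₀ f₁ f₂ f₃ f₄ f₅ → ev (f₀ ∷ f₁ ∷ f₂ ∷ f₃ ∷ f₄ ∷ f₅ ∷ []) β ≈ 0# →
        Zero (f₀ ∷ f₁ ∷ f₂ ∷ f₃ ∷ f₄ ∷ f₅ ∷ [])
      independent-explicit f₀ f₁ f₂ f₃ f₄ f₅ f≈0 = conclude
        (root-independent γ₁ γ₁-root U ℕ.≤-refl (proj₁ UV≈0)) (root-independent γ₁ γ₁-root V ℕ.≤-refl (proj₂ UV≈0))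
        where
        U V N : List ℚ
        U = (f₂ ℚ.- f₀) ℚ.- f₄ ∷ f₁ ℚ.- f₅ ∷ f₀ ∷ []
        V = (f₃ ℚ.- f₁) ℚ.- f₅ ∷ f₄ ℚ.- f₀ ∷ f₅ ∷ []
        N = (U *ᵠ U) +ᵠ ((0ℚ ∷ U *ᵠ V) +ᵠ (V *ᵠ V))

        ev-N : ∀ y → ev N y ≈ ev U y * ev U y + (y * (ev U y * ev V y) + ev V y * ev V y)
        ev-N y = trans (ev-+ (U *ᵠ U) ((0ℚ ∷ U *ᵠ V) +ᵠ (V *ᵠ V)) y) (+-cong (ev-* U U y) (trans (ev-+ (0ℚ ∷ U *ᵠ V) (V *ᵠ V) y)
          (+-cong (trans (+-cong 0#-homo (*-congˡ (ev-* U V y))) (+-identityˡ _)) (ev-* V V y))))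

        coeff₂ : ∀ s t w → ι ((s ℚ.- t) ℚ.- w) ≈ (ι s - ι t) - ι w
        coeff₂ s t w = trans (ι-sub (s ℚ.- t) w) (+-congʳ (ι-sub s t))

        ev-U : ev U γ₀ ≈ ((ι f₂ - ι f₀) - ι f₄) + γ₀ * ((ι f₁ - ι f₅) + γ₀ * (ι f₀ + γ₀ * 0#))
        ev-U = +-cong (coeff₂ f₂ f₀ f₄) (*-congˡ (+-congʳ (ι-sub f₁ f₅)))

        ev-V : ev V γ₀ ≈ ((ι f₃ - ι f₁) - ι f₅) + γ₀ * ((ι f₄ - ι f₀) + γ₀ * (ι f₅ + γ₀ * 0#))
        ev-V = +-cong (coeff₂ f₃ f₁ f₅) (*-congˡ (+-congʳ (ι-sub f₄ f₀)))

        Nγ₀≈0 : ev N γ₀ ≈ 0#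
        Nγ₀≈0 = trans (ev-N γ₀) (trans
          (+-cong (*-cong ev-U ev-U) (+-cong (*-congˡ (*-cong ev-U ev-V)) (*-cong ev-V ev-V)))
          (norm≈0 (ι f₀) (ι f₁) (ι f₂) (ι f₃) (ι f₄) (ι f₅) ββ′≈1 f≈0))

        UV≈0 : ev U γ₁ ≈ 0# × ev V γ₁ ≈ 0#
        UV≈0 = definite (ev U γ₁) (ev V γ₁) (trans (sym (ev-N γ₁))
          (vanishing-transfer algebra algebra γ₀ γ₁ (r ∷ q ∷ a ∷ []) (root-independent γ₀ γ₀-root) γ₀-root γ₁-root N 3 ≡.refl Nγ₀≈0))

        -0-cancel : ∀ s → s ℚ.- 0ℚ ≡ 0ℚ → s ≡ 0ℚ
        -0-cancel s eq = ≡.trans (≡.sym (ℚ.+-identityʳ s)) eq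

        conclude : Zero U → Zero V → Zero (f₀ ∷ f₁ ∷ f₂ ∷ f₃ ∷ f₄ ∷ f₅ ∷ [])
        -- f₀ and f₅ are the leading coefficients of `U` and `V`. Once they vanish, the middle
        -- coefficients give f₁ and f₄, and then the constant terms give f₂ and f₃.
        conclude (u₀ ∷ u₁ ∷ ≡.refl ∷ []) (v₀ ∷ v₁ ∷ ≡.refl ∷ [])
          with -0-cancel f₁ u₁ | -0-cancel f₄ v₁
        ... | ≡.refl | ≡.refl = ≡.refl ∷ ≡.refl ∷ -0-cancel f₂ (-0-cancel _ u₀) ∷ -0-cancel f₃ (-0-cancel _ v₀) ∷ ≡.refl ∷ ≡.refl ∷ []

    independent : Independent algebra β 6
    independent f |f|≤6 f≈0 = coeffs⇒Zero f λ n → ≡.trans (explicit n) (zeros n)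
      where
      explicit = explicit₆ f |f|≤6
      g = coeffℚ f 0 ∷ coeffℚ f 1 ∷ coeffℚ f 2 ∷ coeffℚ f 3 ∷ coeffℚ f 4 ∷ coeffℚ f 5 ∷ []
      g≡0 = independent-explicit (coeffℚ f 0) (coeffℚ f 1) (coeffℚ f 2) (coeffℚ f 3) (coeffℚ f 4) (coeffℚ f 5)
        (trans (sym (ev-cong ≡.sym f g β explicit)) f≈0)
      zeros : ∀ n → coeffℚ g n ≡ 0ℚ
      zeros = Zero⇒coeffs g≡0

    -- Real and imaginary part of (γ₁ + iτ)/2, a root of z² - γ₁ z + 1; its modulus is 1 because γ₁²
    -- + τ² = 4.
    u v : Carrier
    u = ι ½ * γ₁
    v = ι ½ * τ

    u²+v²≈1 : u * u + v * v ≈ ι 1ℚ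
    u²+v²≈1 = begin
      u * u + v * v                    ≈⟨ solve 2 (λ γ τ → (con ½ :* γ) :* (con ½ :* γ) :+ (con ½ :* τ) :* (con ½ :* τ)
                                            := con (½ ℚ.* ½) :* (γ :* γ :+ τ :* τ)) γ₁ τ ⟩
      ι (½ ℚ.* ½) * (γ₁ * γ₁ + τ * τ)  ≈⟨ *-congˡ (+-congʳ γ₁²≈z) ⟩
      ι (½ ℚ.* ½) * (z + τ * τ)        ≈⟨ solve 1 (λ τ → con (½ ℚ.* ½) :* ((con 4ℚ :- τ :* τ) :+ τ :* τ) := con 1ℚ) τ ⟩
      ι 1ℚ                             ∎

    v≉0 : ¬ (v ≈ 0#)
    v≉0 = pos⇒≉0 (pos-* (pos-ι (ℚ.positive⁻¹ ½)) 0<τ)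

    quadratic-re : ((u * u - v * v) - γ₁ * u) + ι 1ℚ ≈ 0#
    quadratic-re = begin
      ((u * u - v * v) - γ₁ * u) + ι 1ℚ   ≈⟨ solve 2 (λ γ τ →
                                               let u = con ½ :* γ ; v = con ½ :* τ in
                                               ((u :* u :- v :* v) :- γ :* u) :+ con 1ℚ := con 1ℚ :- (u :* u :+ v :* v)) γ₁ τ ⟩
      ι 1ℚ - (u * u + v * v)              ≈⟨ +-congˡ (-‿cong u²+v²≈1) ⟩
      ι 1ℚ - ι 1ℚ                         ≈⟨ -‿inverseʳ (ι 1ℚ) ⟩
      0#                                  ∎

    quadratic-im : (u * v + v * u) - γ₁ * v ≈ 0#
    quadratic-im = solve 2 (λ γ τ → let u = con ½ :* γ ; v = con ½ :* τ in
      (u :* v :+ v :* u) :- γ :* v := con 0ℚ) γ₁ τ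

    -- Multiplication by β² > 0 turns this into β² - 1 > 0. Doubly negated, it still refutes a
    -- conjugate 1/β outside the unit disc.
    0<1-β′² : ¬ ¬ Pos (ι 1ℚ - β′ * β′)
    0<1-β′² ¬pos = sign ¬pos
      (λ eq → pos⇒≉0 0<β²-1 (trans (sym scaled) (trans (*-congˡ eq) (zeroʳ _))))
      (λ neg → pos⇒nonNeg 0<β²-1 (pos-resp (trans (solve 2 (λ s t → s :* (:- t) := :- (s :* t)) (β * β) _) (-‿cong scaled))
        (pos-* (pos-* 0<β 0<β) neg)))
      where
      scaled : (β * β) * (ι 1ℚ - β′ * β′) ≈ β * β - ι 1ℚ
      scaled = drop-multiple (- (β * β′ + ι 1ℚ)) (solve 2 (λ β β′ →
        (β :* β) :* (con 1ℚ :- β′ :* β′) := (β :* β :- con 1ℚ) :+ (β :* β′ :- con 1ℚ) :* (:- (β :* β′ :+ con 1ℚ))) β β′) (trans (+-congʳ ββ′≈1) (-‿inverseʳ (ι 1ℚ)))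

-- ℝ and ℂ as ℚ-algebras

-- The operations of ℝ are made opaque: deciding equality of real terms by
-- unfolding compares Cauchy proofs and does not terminate in practice.
infixl 7 _⊗_
infixl 6 _⊕_
infix  4 _≋_

opaque
  _⊕_ _⊗_ : ℝ → ℝ → ℝ
  _⊕_ = _+ᵣ_
  _⊗_ = _*ᵣ_

  ⊖_ : ℝ → ℝ
  ⊖_ = -ᵣ_

  _≋_ : ℝ → ℝ → Set
  _≋_ = _≈ᵣ_

  Positive : ℝ → Set
  Positive = Posᵣ

  ≋-isCommutativeRing : IsCommutativeRing _≋_ _⊕_ _⊗_ ⊖_ 0ᵣ 1ᵣ
  ≋-isCommutativeRing = ℝ-isCommutativeRing

  ⊕≡+ᵣ : ∀ x y → x ⊕ y ≡ x +ᵣ y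
  ⊕≡+ᵣ x y = ≡.refl

  ⊗≡*ᵣ : ∀ x y → x ⊗ y ≡ x *ᵣ y
  ⊗≡*ᵣ x y = ≡.refl

  ⊖≡-ᵣ : ∀ x → ⊖ x ≡ -ᵣ x
  ⊖≡-ᵣ x = ≡.refl

  ≋⇒≈ᵣ : ∀ {x y} → x ≋ y → x ≈ᵣ y
  ≋⇒≈ᵣ x≋y = x≋y

  ≈ᵣ⇒≋ : ∀ {x y} → x ≈ᵣ y → x ≋ y
  ≈ᵣ⇒≋ x≈y = x≈y

  <ᵣ⇒positive : ∀ {x y} → x <ᵣ y → Positive (y ⊕ ⊖ x)
  <ᵣ⇒positive {x} {y} = <ᵣ⇒pos x y

  positive⇒<ᵣ : ∀ {x y} → Positive (y ⊕ ⊖ x) → x <ᵣ y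
  positive⇒<ᵣ {x} {y} = pos⇒<ᵣ x y

  fromℚ-+ : ∀ p q → fromℚ (p ℚ.+ q) ≋ fromℚ p ⊕ fromℚ q
  fromℚ-+ p q = ≈ᵣ-refl (fromℚ (p ℚ.+ q))

  fromℚ-* : ∀ p q → fromℚ (p ℚ.* q) ≋ fromℚ p ⊗ fromℚ q
  fromℚ-* p q = ≈ᵣ-refl (fromℚ (p ℚ.* q))

  fromℚ-neg : ∀ p → fromℚ (ℚ.- p) ≋ ⊖ fromℚ p
  fromℚ-neg p = ≈ᵣ-refl (fromℚ (ℚ.- p))

  positive-resp : ∀ {x y} → x ≋ y → Positive x → Positive y
  positive-resp {x} {y} = posᵣ-resp x y

  positive-⊕ : ∀ {x y} → Positive x → Positive y → Positive (x ⊕ y)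
  positive-⊕ {x} {y} = posᵣ-+ x y

  positive-⊗ : ∀ {x y} → Positive x → Positive y → Positive (x ⊗ y)
  positive-⊗ {x} {y} = posᵣ-* x y

  ¬positive-0 : ¬ Positive 0ᵣ
  ¬positive-0 = ¬posᵣ-0

  ≋-tight : ∀ {x} → ¬ Positive x → ¬ Positive (⊖ x) → x ≋ 0ᵣ
  ≋-tight {x} = tightᵣ x

  positive-fromℚ : ∀ {q} → 0ℚ ℚ.< q → Positive (fromℚ q)
  positive-fromℚ {q} = posᵣ-fromℚ q

⊕⊖≡-ᵣ : ∀ x y → x ⊕ ⊖ y ≡ x -ᵣ y
⊕⊖≡-ᵣ x y = ≡.trans (cong (x ⊕_) (⊖≡-ᵣ y)) (≡.trans (⊕≡+ᵣ x (-ᵣ y)) ≡.refl)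

ℝ-raw : RawRing 0ℓ 0ℓ
ℝ-raw = record
  { Carrier = ℝ ; _≈_ = _≋_ ; _+_ = _⊕_ ; _*_ = _⊗_ ; -_ = ⊖_ ; 0# = 0ᵣ ; 1# = 1ᵣ }

private
  module ≋ = IsCommutativeRing ≋-isCommutativeRing

ℝ-algebra : ℚ-Algebra
ℝ-algebra = record
  { raw   = ℝ-raw
  ; isCR  = ≋-isCommutativeRing
  ; ι     = fromℚ
  ; ι-hom = record
    { isSemiringHomomorphism = record
      { isNearSemiringHomomorphism = record
        { +-isMonoidHomomorphism = record
          { isMagmaHomomorphism = record
            { isRelHomomorphism = record { cong = λ { ≡.refl → ≋.refl } }
            ; homo = fromℚ-+ }
          ; ε-homo = ≋.refl }
        ; *-homo = fromℚ-* }
      ; 1#-homo = ≋.refl }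
    ; -‿homo = fromℚ-neg }
  }

ℝ-ordered : Ordered
ℝ-ordered = record
  { algebra  = ℝ-algebra
  ; Pos      = Positive
  ; pos-resp = positive-resp
  ; pos-+    = positive-⊕
  ; pos-*    = positive-⊗
  ; ¬pos-0   = ¬positive-0
  ; tight    = ≋-tight
  ; pos-ι    = positive-fromℚ
  }

-- Real and imaginary parts of the ring laws of ℂ

module ComplexIdentities (A : ℚ-Algebra) where
  open ℚ-Algebra A
  open ℚ-Solver A

  assoc-re : ∀ a b c d e f →
    (a * c - b * d) * e - (a * d + b * c) * f ≈ a * (c * e - d * f) - b * (c * f + d * e)
  assoc-re = solve 6 (λ a b c d e f → (a :* c :- b :* d) :* e :- (a :* d :+ b :* c) :* f
    := a :* (c :* e :- d :* f) :- b :* (c :* f :+ d :* e))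

  assoc-im : ∀ a b c d e f →
    (a * c - b * d) * f + (a * d + b * c) * e ≈ a * (c * f + d * e) + b * (c * e - d * f)
  assoc-im = solve 6 (λ a b c d e f → (a :* c :- b :* d) :* f :+ (a :* d :+ b :* c) :* e
    := a :* (c :* f :+ d :* e) :+ b :* (c :* e :- d :* f))

  distribˡ-re : ∀ a b c d e f → a * (c + e) - b * (d + f) ≈ (a * c - b * d) + (a * e - b * f)
  distribˡ-re = solve 6 (λ a b c d e f → a :* (c :+ e) :- b :* (d :+ f) := (a :* c :- b :* d) :+ (a :* e :- b :* f))

  distribˡ-im : ∀ a b c d e f → a * (d + f) + b * (c + e) ≈ (a * d + b * c) + (a * f + b * e)
  distribˡ-im = solve 6 (λ a b c d e f → a :* (d :+ f) :+ b :* (c :+ e) := (a :* d :+ b :* c) :+ (a :* f :+ b :* e))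

  comm-re : ∀ a b c d → a * c - b * d ≈ c * a - d * b
  comm-re = solve 4 (λ a b c d → a :* c :- b :* d := c :* a :- d :* b)

  comm-im : ∀ a b c d → a * d + b * c ≈ c * b + d * a
  comm-im = solve 4 (λ a b c d → a :* d :+ b :* c := c :* b :+ d :* a)

  identity-re : ∀ a b → ι 1ℚ * a - 0# * b ≈ a
  identity-re = solve 2 (λ a b → con 1ℚ :* a :- con 0ℚ :* b := a)

  identity-im : ∀ a b → ι 1ℚ * b + 0# * a ≈ b
  identity-im = solve 2 (λ a b → con 1ℚ :* b :+ con 0ℚ :* a := b)

  real-*-re : ∀ a b → a * b ≈ a * b - 0# * 0#
  real-*-re = solve 2 (λ a b → a :* b := a :* b :- con 0ℚ :* con 0ℚ)

  real-*-im : ∀ a b → 0# ≈ a * 0# + 0# * b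
  real-*-im = solve 2 (λ a b → con 0ℚ := a :* con 0ℚ :+ con 0ℚ :* b)

  real-scale-re : ∀ a c d → a * c - 0# * d ≈ a * c
  real-scale-re = solve 3 (λ a c d → a :* c :- con 0ℚ :* d := a :* c)

  real-scale-im : ∀ a c d → a * d + 0# * c ≈ a * d
  real-scale-im = solve 3 (λ a c d → a :* d :+ con 0ℚ :* c := a :* d)

  neg-0 : 0# ≈ - 0#
  neg-0 = solve 0 (con 0ℚ := :- con 0ℚ)

  0+0 : 0# ≈ 0# + 0#
  0+0 = solve 0 (con 0ℚ := con 0ℚ :+ con 0ℚ)

  conj-*-re : ∀ a b c d → a * c - (- b) * (- d) ≈ a * c - b * d
  conj-*-re = solve 4 (λ a b c d → a :* c :- (:- b) :* (:- d) := a :* c :- b :* d)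

  conj-*-im : ∀ a b c d → a * (- d) + (- b) * c ≈ - (a * d + b * c)
  conj-*-im = solve 4 (λ a b c d → a :* (:- d) :+ (:- b) :* c := :- (a :* d :+ b :* c))

  conj-norm-re : ∀ a b → a * a - b * (- b) ≈ a * a + b * b
  conj-norm-re = solve 2 (λ a b → a :* a :- b :* (:- b) := a :* a :+ b :* b)

  conj-norm-im : ∀ a b → a * (- b) + b * a ≈ 0#
  conj-norm-im = solve 2 (λ a b → a :* (:- b) :+ b :* a := con 0ℚ)

  norm-* : ∀ a b c d →
    (a * c - b * d) * (a * c - b * d) + (a * d + b * c) * (a * d + b * c) ≈ (a * a + b * b) * (c * c + d * d)
  norm-* = solve 4 (λ a b c d → (a :* c :- b :* d) :* (a :* c :- b :* d) :+ (a :* d :+ b :* c) :* (a :* d :+ b :* c)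
    := (a :* a :+ b :* b) :* (c :* c :+ d :* d))

module ℝA = ℚ-Algebra ℝ-algebra

private module ℝᶜ = ComplexIdentities ℝ-algebra

infix 4 _≋ᶜ_

-- A record instead of a product: `z` and `w` remain visible in the type and can be inferred as
-- implicit arguments.
record _≋ᶜ_ (z w : ℂ) : Set where
  constructor _,_
  field
    re≋ : re z ≋ re w
    im≋ : im z ≋ im w

open _≋ᶜ_ public

infixl 7 _⊗ᶜ_
infixl 6 _⊕ᶜ_

_⊕ᶜ_ _⊗ᶜ_ : ℂ → ℂ → ℂ
z ⊕ᶜ w = (re z ⊕ re w) +i (im z ⊕ im w)
z ⊗ᶜ w = (re z ⊗ re w ⊕ ⊖ (im z ⊗ im w)) +i (re z ⊗ im w ⊕ im z ⊗ re w)

⊖ᶜ_ : ℂ → ℂ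
⊖ᶜ z = (⊖ re z) +i (⊖ im z)

ℂ-raw : RawRing 0ℓ 0ℓ
ℂ-raw = record
  { Carrier = ℂ ; _≈_ = _≋ᶜ_ ; _+_ = _⊕ᶜ_ ; _*_ = _⊗ᶜ_ ; -_ = ⊖ᶜ_ ; 0# = ofℝ 0ᵣ ; 1# = ofℝ 1ᵣ }

private
  transᶜ : ∀ {z w t} → z ≋ᶜ w → w ≋ᶜ t → z ≋ᶜ t
  transᶜ (p , q) (p′ , q′) = ≋.trans p p′ , ≋.trans q q′

  +ᶜ-cong : ∀ {z z′ w w′} → z ≋ᶜ z′ → w ≋ᶜ w′ → z ⊕ᶜ w ≋ᶜ z′ ⊕ᶜ w′
  +ᶜ-cong (p , q) (p′ , q′) = ≋.+-cong p p′ , ≋.+-cong q q′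

  *ᶜ-cong : ∀ {z z′ w w′} → z ≋ᶜ z′ → w ≋ᶜ w′ → z ⊗ᶜ w ≋ᶜ z′ ⊗ᶜ w′
  *ᶜ-cong (p , q) (p′ , q′) =
      ≋.+-cong (≋.*-cong p p′) (≋.-‿cong (≋.*-cong q q′))
    , ≋.+-cong (≋.*-cong p q′) (≋.*-cong q p′)

  *ᶜ-comm : ∀ z w → z ⊗ᶜ w ≋ᶜ w ⊗ᶜ z
  *ᶜ-comm z w = ℝᶜ.comm-re (re z) (im z) (re w) (im w) , ℝᶜ.comm-im (re z) (im z) (re w) (im w)

  *ᶜ-identityˡ : ∀ z → ofℝ 1ᵣ ⊗ᶜ z ≋ᶜ z
  *ᶜ-identityˡ z = ℝᶜ.identity-re (re z) (im z) , ℝᶜ.identity-im (re z) (im z)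

  *ᶜ-distribˡ : ∀ t z w → t ⊗ᶜ (z ⊕ᶜ w) ≋ᶜ t ⊗ᶜ z ⊕ᶜ t ⊗ᶜ w
  *ᶜ-distribˡ t z w = ℝᶜ.distribˡ-re (re t) (im t) (re z) (im z) (re w) (im w)
                    , ℝᶜ.distribˡ-im (re t) (im t) (re z) (im z) (re w) (im w)

ℂ-isCommutativeRing : IsCommutativeRing _≋ᶜ_ _⊕ᶜ_ _⊗ᶜ_ ⊖ᶜ_ (ofℝ 0ᵣ) (ofℝ 1ᵣ)
ℂ-isCommutativeRing = record
  { isRing = record
    { +-isAbelianGroup = record
      { isGroup = record
        { isMonoid = record
          { isSemigroup = record
            { isMagma = record
              { isEquivalence = record
                { refl  = ≋.refl , ≋.refl
                ; sym   = λ (p , q) → ≋.sym p , ≋.sym q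
                ; trans = transᶜ
                }
              ; ∙-cong = +ᶜ-cong
              }
            ; assoc = λ z w t → ≋.+-assoc (re z) (re w) (re t) , ≋.+-assoc (im z) (im w) (im t)
            }
          ; identity = (λ z → ≋.+-identityˡ (re z) , ≋.+-identityˡ (im z))
                     , (λ z → ≋.+-identityʳ (re z) , ≋.+-identityʳ (im z))
          }
        ; inverse = (λ z → ≋.-‿inverseˡ (re z) , ≋.-‿inverseˡ (im z))
                  , (λ z → ≋.-‿inverseʳ (re z) , ≋.-‿inverseʳ (im z))
        ; ⁻¹-cong = λ (p , q) → ≋.-‿cong p , ≋.-‿cong q
        }
      ; comm = λ z w → ≋.+-comm (re z) (re w) , ≋.+-comm (im z) (im w)
      }
    ; *-cong = *ᶜ-cong
    ; *-assoc = λ z w t →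
          ℝᶜ.assoc-re (re z) (im z) (re w) (im w) (re t) (im t)
        , ℝᶜ.assoc-im (re z) (im z) (re w) (im w) (re t) (im t)
    ; *-identity = *ᶜ-identityˡ , λ z → transᶜ (*ᶜ-comm z (ofℝ 1ᵣ)) (*ᶜ-identityˡ z)
    ; distrib = *ᶜ-distribˡ , λ t z w → transᶜ (*ᶜ-comm (z ⊕ᶜ w) t)
        (transᶜ (*ᶜ-distribˡ t z w) (+ᶜ-cong (*ᶜ-comm t z) (*ᶜ-comm t w)))
    }
  ; *-comm = *ᶜ-comm
  }

ofℝ-⊕ : ∀ x y → ofℝ (x ⊕ y) ≋ᶜ ofℝ x ⊕ᶜ ofℝ y
ofℝ-⊕ x y = ≋.refl , ℝᶜ.0+0

ofℝ-⊗ : ∀ x y → ofℝ (x ⊗ y) ≋ᶜ ofℝ x ⊗ᶜ ofℝ y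
ofℝ-⊗ x y = ℝᶜ.real-*-re x y , ℝᶜ.real-*-im x y

ofℝ-⊖ : ∀ x → ofℝ (⊖ x) ≋ᶜ ⊖ᶜ ofℝ x
ofℝ-⊖ x = ≋.refl , ℝᶜ.neg-0

ofℝ-cong : ∀ {x y} → x ≋ y → ofℝ x ≋ᶜ ofℝ y
ofℝ-cong x≋y = x≋y , ≋.refl

ℂ-algebra : ℚ-Algebra
ℂ-algebra = record
  { raw   = ℂ-raw
  ; isCR  = ℂ-isCommutativeRing
  ; ι     = λ q → ofℝ (fromℚ q)
  ; ι-hom = record
    { isSemiringHomomorphism = record
      { isNearSemiringHomomorphism = record
        { +-isMonoidHomomorphism = record
          { isMagmaHomomorphism = record
            { isRelHomomorphism = record { cong = λ { ≡.refl → ≋.refl , ≋.refl } }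
            ; homo = λ p q → transᶜ (ofℝ-cong (fromℚ-+ p q)) (ofℝ-⊕ (fromℚ p) (fromℚ q)) }
          ; ε-homo = ≋.refl , ≋.refl }
        ; *-homo = λ p q → transᶜ (ofℝ-cong (fromℚ-* p q)) (ofℝ-⊗ (fromℚ p) (fromℚ q)) }
      ; 1#-homo = ≋.refl , ≋.refl }
    ; -‿homo = λ p → transᶜ (ofℝ-cong (fromℚ-neg p)) (ofℝ-⊖ (fromℚ p)) }
  }

module ℂA = ℚ-Algebra ℂ-algebra

-- The opaque operations equal the original ones only propositionally and pointwise, so evaluation
-- is transported along these equalities one coefficient at a time.
foldr-eval : ∀ {C : Set} {_+₁_ _*₁_ _+₂_ _*₂_ : C → C → C} {z : C} →
  (∀ x y → x +₁ y ≡ x +₂ y) → (∀ x y → x *₁ y ≡ x *₂ y) → ∀ x f →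
  foldr (λ a v → a +₁ (x *₁ v)) z f ≡ foldr (λ a v → a +₂ (x *₂ v)) z f
foldr-eval +≡ *≡ x []      = ≡.refl
foldr-eval {_+₁_ = _+₁_} {_*₂_ = _*₂_} +≡ *≡ x (a ∷ f) = ≡.trans
  (cong (a +₁_) (≡.trans (*≡ x _) (cong (x *₂_) (foldr-eval +≡ *≡ x f))))
  (+≡ a _)

eval-ℝ-raw : ∀ f x → Polynomial.eval ℝ-raw f x ≡ Polynomial.eval ℝ-rawRing f x
eval-ℝ-raw f x = foldr-eval {ℝ} {RawRing._+_ ℝ-raw} {RawRing._*_ ℝ-raw}
  {RawRing._+_ ℝ-rawRing} {RawRing._*_ ℝ-rawRing} ⊕≡+ᵣ ⊗≡*ᵣ x f

eval-ℂ-raw : ∀ f z → Polynomial.eval ℂ-raw f z ≡ Polynomial.eval ℂ-rawRing f z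
eval-ℂ-raw f z = foldr-eval {ℂ} {RawRing._+_ ℂ-raw} {RawRing._*_ ℂ-raw}
  {RawRing._+_ ℂ-rawRing} {RawRing._*_ ℂ-rawRing} ⊕ᶜ≡ ⊗ᶜ≡ z f
  where
  ⊕ᶜ≡ : ∀ z w → z ⊕ᶜ w ≡ RawRing._+_ ℂ-rawRing z w
  ⊕ᶜ≡ z w = cong₂ _+i_ (⊕≡+ᵣ (re z) (re w)) (⊕≡+ᵣ (im z) (im w))

  ⊗ᶜ≡ : ∀ z w → z ⊗ᶜ w ≡ RawRing._*_ ℂ-rawRing z w
  ⊗ᶜ≡ z w = cong₂ _+i_
    (≡.trans (cong₂ (λ p q → p ⊕ ⊖ q) (⊗≡*ᵣ (re z) (re w)) (⊗≡*ᵣ (im z) (im w)))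
      (⊕⊖≡-ᵣ (re z *ᵣ re w) (im z *ᵣ im w)))
    (≡.trans (cong₂ _⊕_ (⊗≡*ᵣ (re z) (im w)) (⊗≡*ᵣ (im z) (re w)))
      (⊕≡+ᵣ (re z *ᵣ im w) (im z *ᵣ re w)))

conj : ℂ → ℂ
conj z = re z +i (⊖ im z)

-- Minimal polynomials

module ℤ-Eval (A : ℚ-Algebra) where
  open ℚ-Algebra A

  toℚ-hom : RingMorphisms.IsRingHomomorphism ℤ.+-*-rawRing raw (λ k → ι (toℚ k))
  toℚ-hom = record
    { isSemiringHomomorphism = record
      { isNearSemiringHomomorphism = record
        { +-isMonoidHomomorphism = record
          { isMagmaHomomorphism = record
            { isRelHomomorphism = record { cong = λ eq → reflexive (cong (λ k → ι (toℚ k)) eq) }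
            ; homo = λ i j → trans (reflexive (cong ι (toℚ-+ i j))) (+-homo (toℚ i) (toℚ j)) }
          ; ε-homo = 0#-homo }
        ; *-homo = λ i j → trans (reflexive (cong ι (toℚ-* i j))) (*-homo (toℚ i) (toℚ j)) }
      ; 1#-homo = 1#-homo }
    ; -‿homo = λ i → trans (reflexive (cong ι (toℚ-neg i))) (-‿homo (toℚ i)) }

  private module E = EvalHom ℤ.+-*-rawRing raw isCR (λ k → ι (toℚ k)) toℚ-hom
  open E public using () renaming
    (ev to evᶻ; ev-- to evᶻ--; ev-scale to evᶻ-scale; ev-* to evᶻ-*)

  evᶻ-cong : ∀ F G x → F ≈ₚ G → evᶻ F x ≈ evᶻ G x
  evᶻ-cong = E.ev-cong ≡.sym

  evᶻ≡ev : ∀ F x → evᶻ F x ≡ ev (map toℚ F) x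
  evᶻ≡ev F x = cong (λ f → Polynomial.eval raw f x) (map-∘ F)

  open ℚ-Solver A
  open import Relation.Binary.Reasoning.Setoid setoid

  -- The reciprocal polynomial is x^deg F(1/x); the accumulator `G` of `reverse` makes the induction
  -- go through, and the extra factor x on the left avoids an exponent smaller by one.
  evᶻ-ʳ++ : ∀ {x x′} → x * x′ ≈ ι 1ℚ → ∀ F G →
    x * evᶻ (F ʳ++ G) x ≈ E.pow x (length F) * (evᶻ F x′ + x * evᶻ G x)
  evᶻ-ʳ++ {x} {x′} xx′≈1 []      G = trans (solve 2 (λ x g → x :* g := con 1ℚ :* (con 0ℚ :+ x :* g)) x (evᶻ G x))
    (*-congʳ 1#-homo)
  evᶻ-ʳ++ {x} {x′} xx′≈1 (a ∷ F) G = begin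
    x * evᶻ (F ʳ++ (a ∷ G)) x
      ≈⟨ evᶻ-ʳ++ xx′≈1 F (a ∷ G) ⟩
    p * (f + x * (α + x * g))
      ≈⟨ solve 5 (λ p f x α g → p :* (f :+ x :* (α :+ x :* g)) := (x :* p) :* ((α :+ con 0ℚ) :+ x :* g) :+ p :* f :* con 1ℚ) p f x α g ⟩
    (x * p) * ((α + 0#) + x * g) + p * f * ι 1ℚ
      ≈⟨ +-congˡ (*-congˡ xx′≈1) ⟨
    (x * p) * ((α + 0#) + x * g) + p * f * (x * x′)
      ≈⟨ solve 6 (λ p f x x′ α g → (x :* p) :* ((α :+ con 0ℚ) :+ x :* g) :+ p :* f :* (x :* x′)
           := (x :* p) :* ((α :+ x′ :* f) :+ x :* g)) p f x x′ α g ⟩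
    (x * p) * ((α + x′ * f) + x * g) ∎
    where
    p = E.pow x (length F)
    f = evᶻ F x′
    α = ι (toℚ a)
    g = evᶻ G x

  evᶻ-reverse : ∀ {x x′} → x * x′ ≈ ι 1ℚ → ∀ F → evᶻ F x′ ≈ 0# → evᶻ (reverse F) x ≈ 0#
  evᶻ-reverse {x} {x′} xx′≈1 F F≈0 = begin
    evᶻ (reverse F) x                      ≈⟨ solve 1 (λ e → e := con 1ℚ :* e) (evᶻ (reverse F) x) ⟩
    ι 1ℚ * evᶻ (reverse F) x               ≈⟨ *-congʳ xx′≈1 ⟨
    x * x′ * evᶻ (reverse F) x             ≈⟨ solve 3 (λ x x′ e → x :* x′ :* e := x′ :* (x :* e)) x x′ (evᶻ (reverse F) x) ⟩
    x′ * (x * evᶻ (reverse F) x)           ≈⟨ *-congˡ (evᶻ-ʳ++ xx′≈1 F []) ⟩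
    x′ * (E.pow x (length F) * (evᶻ F x′ + x * 0#))  ≈⟨ *-congˡ (*-congˡ (+-congʳ F≈0)) ⟩
    x′ * (E.pow x (length F) * (0# + x * 0#))        ≈⟨ solve 3 (λ x x′ p → x′ :* (p :* (con 0ℚ :+ x :* con 0ℚ)) := con 0ℚ) x x′ (E.pow x (length F)) ⟩
    0#                                     ∎

coeff-map-toℚ : ∀ F k → coeffℚ (map toℚ F) k ≡ toℚ (coeffℤ F k)
coeff-map-toℚ []      k       = ≡.refl
coeff-map-toℚ (a ∷ F) zero    = ≡.refl
coeff-map-toℚ (a ∷ F) (suc k) = coeff-map-toℚ F k

coeff-+ₚ : ∀ F G k → coeffℤ (F +ₚ G) k ≡ coeffℤ F k ℤ.+ coeffℤ G k
coeff-+ₚ []      G       k       = ≡.sym (ℤ.+-identityˡ (coeffℤ G k))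
coeff-+ₚ (a ∷ F) []      k       = ≡.sym (ℤ.+-identityʳ (coeffℤ (a ∷ F) k))
coeff-+ₚ (a ∷ F) (b ∷ G) zero    = ≡.refl
coeff-+ₚ (a ∷ F) (b ∷ G) (suc k) = coeff-+ₚ F G k

coeff-negₚ : ∀ F k → coeffℤ (-ₚ F) k ≡ ℤ.- coeffℤ F k
coeff-negₚ []      k       = ≡.refl
coeff-negₚ (a ∷ F) zero    = ≡.refl
coeff-negₚ (a ∷ F) (suc k) = coeff-negₚ F k

coeff--ₚ : ∀ F G k → coeffℤ (F -ₚ G) k ≡ coeffℤ F k ℤ.- coeffℤ G k
coeff--ₚ F G k = ≡.trans (coeff-+ₚ F (-ₚ G) k) (cong (λ z → coeffℤ F k ℤ.+ z) (coeff-negₚ G k))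

coeff-scaleₚ : ∀ a F k → coeffℤ (map (a ℤ.*_) F) k ≡ a ℤ.* coeffℤ F k
coeff-scaleₚ a []      k       = ≡.sym (ℤ.*-zeroʳ a)
coeff-scaleₚ a (b ∷ F) zero    = ≡.refl
coeff-scaleₚ a (b ∷ F) (suc k) = coeff-scaleₚ a F k

coeff-beyond : ∀ F k → length F ℕ.≤ k → coeffℤ F k ≡ 0ℤ
coeff-beyond []      k       _         = ≡.refl
coeff-beyond (a ∷ F) (suc k) (s≤s |F|≤k) = coeff-beyond F k |F|≤k

take-≈ : ∀ n f → (∀ k → n ℕ.≤ k → coeffℚ f k ≡ 0ℚ) → take n f ≈ᵠ f
take-≈ zero    f       f≡0 k       = ≡.sym (f≡0 k z≤n)
take-≈ (suc n) []      f≡0 k       = ≡.refl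
take-≈ (suc n) (a ∷ f) f≡0 zero    = ≡.refl
take-≈ (suc n) (a ∷ f) f≡0 (suc k) = take-≈ n f (λ k n≤k → f≡0 (suc k) (s≤s n≤k)) k

module _ (A : ℚ-Algebra) where
  open ℚ-Algebra A using (ev; _≈_; 0#; trans; sym; reflexive; ev-cong)
  open ℤ-Eval A using (evᶻ; evᶻ≡ev)

  -- `Independent` bounds the length of a list, while polynomials may carry trailing zeros; `take`
  -- cuts them off.
  independent-coeffs : ∀ {x n} → Independent A x n → ∀ f → (∀ k → n ℕ.≤ k → coeffℚ f k ≡ 0ℚ) →
    ev f x ≈ 0# → ∀ k → coeffℚ f k ≡ 0ℚ
  independent-coeffs {x} {n} indep f high f≈0 k = ≡.trans (≡.sym (take-≈ n f high k))
    (Zero⇒coeffs (indep (take n f) (≡.subst (ℕ._≤ n) (≡.sym (length-take n f)) (ℕ.m⊓n≤m n (length f)))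
      (trans (ev-cong ≡.sym (take n f) f x (take-≈ n f high)) f≈0)) k)

  independent-coeffsᶻ : ∀ {x n} → Independent A x n → ∀ F → (∀ k → n ℕ.≤ k → coeffℤ F k ≡ 0ℤ) →
    evᶻ F x ≈ 0# → ∀ k → coeffℤ F k ≡ 0ℤ
  independent-coeffsᶻ {x} indep F high F≈0 k = toℚ-injective (≡.trans (≡.sym (coeff-map-toℚ F k))
    (independent-coeffs indep (map toℚ F) (λ k n≤k → ≡.trans (coeff-map-toℚ F k) (cong toℚ (high k n≤k)))
      (trans (reflexive (≡.sym (evᶻ≡ev F x))) F≈0) k))

degree : ∀ f → Zero f ⊎ ∃[ e ] (e ℕ.< length f × HasDegreeℚ f e)
degree [] = inj₁ []
degree (a ∷ f) with degree f | a ℚ.≟ 0ℚ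
... | inj₂ (e , e<|f| , f≢0 , high) | _ =
  inj₂ (suc e , s≤s e<|f| , f≢0 , λ { (suc k) (s≤s e<k) → high k e<k })
... | inj₁ f≡0 | yes a≡0 = inj₁ (a≡0 ∷ f≡0)
... | inj₁ f≡0 | no  a≢0 = inj₂ (0 , s≤s z≤n , a≢0 , λ { (suc k) _ → Zero⇒coeffs f≡0 k })

degree-unique : ∀ {F d e} → HasDegreeℤ F d → HasDegreeℤ F e → d ≡ e
degree-unique {F} {d} {e} (F≢0 , high) (F≢0′ , high′) with ℕ.<-cmp d e
... | tri< d<e _ _ = contradiction (high e d<e) F≢0′
... | tri≈ _ d≡e _ = d≡e
... | tri> _ _ e<d = contradiction (high′ d e<d) F≢0

monic⇒degree : ∀ {F} (m : Monic F) → HasDegreeℤ F (proj₁ m)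
monic⇒degree (d , lead , high) = (λ lead≡0 → contradiction (≡.trans (≡.sym lead) lead≡0) λ ()) , high

degree-toℚ : ∀ {F d} → HasDegreeℤ F d → HasDegreeℚ (map toℚ F) d
degree-toℚ {F} {d} (lead , high) =
  (λ eq → lead (toℚ-injective (≡.trans (≡.sym (coeff-map-toℚ F d)) eq))) ,
  (λ k d<k → ≡.trans (coeff-map-toℚ F k) (cong toℚ (high k d<k)))

module ℝᶻ = ℤ-Eval ℝ-algebra
module ℂᶻ = ℤ-Eval ℂ-algebra

rootℤ⇒ : ∀ {F β} → evalℤ F β ≈ᵣ 0ᵣ → ℝᶻ.evᶻ F β ≋ 0ᵣ
rootℤ⇒ {F} {β} root = ≈ᵣ⇒≋ (≡.subst (_≈ᵣ 0ᵣ) (≡.sym (eval-ℝ-raw (map fromℤ F) β)) root)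

rootℤ⇐ : ∀ {F β} → ℝᶻ.evᶻ F β ≋ 0ᵣ → evalℤ F β ≈ᵣ 0ᵣ
rootℤ⇐ {F} {β} root = ≡.subst (_≈ᵣ 0ᵣ) (eval-ℝ-raw (map fromℤ F) β) (≋⇒≈ᵣ root)

rootℚ⇒ : ∀ {f β} → evalℚ f β ≈ᵣ 0ᵣ → ℝA.ev f β ≋ 0ᵣ
rootℚ⇒ {f} {β} root = ≈ᵣ⇒≋ (≡.subst (_≈ᵣ 0ᵣ) (≡.sym (eval-ℝ-raw (map fromℚ f) β)) root)

rootℚ⇐ : ∀ {f β} → ℝA.ev f β ≋ 0ᵣ → evalℚ f β ≈ᵣ 0ᵣ
rootℚ⇐ {f} {β} root = ≡.subst (_≈ᵣ 0ᵣ) (eval-ℝ-raw (map fromℚ f) β) (≋⇒≈ᵣ root)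

rootℂ⇒ : ∀ {F α} → evalℂ F α ≈ᶜ ofℝ 0ᵣ → ℂᶻ.evᶻ F α ≋ᶜ ofℝ 0ᵣ
rootℂ⇒ {F} {α} (re≈0 , im≈0) =
    ≈ᵣ⇒≋ (≡.subst (λ z → re z ≈ᵣ 0ᵣ) (≡.sym eq) re≈0)
  , ≈ᵣ⇒≋ (≡.subst (λ z → im z ≈ᵣ 0ᵣ) (≡.sym eq) im≈0)
  where eq = eval-ℂ-raw (map (λ k → ofℝ (fromℤ k)) F) α

rootℂ⇐ : ∀ {F α} → ℂᶻ.evᶻ F α ≋ᶜ ofℝ 0ᵣ → evalℂ F α ≈ᶜ ofℝ 0ᵣ
rootℂ⇐ {F} {α} (re≋0 , im≋0) =
    ≡.subst (λ z → re z ≈ᵣ 0ᵣ) eq (≋⇒≈ᵣ re≋0)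
  , ≡.subst (λ z → im z ≈ᵣ 0ᵣ) eq (≋⇒≈ᵣ im≋0)
  where eq = eval-ℂ-raw (map (λ k → ofℝ (fromℤ k)) F) α

minPoly⇒independent : ∀ {β P n} → IsMinPoly β P → HasDegreeℤ P n → Independent ℝ-algebra β n
minPoly⇒independent {β} {P} {n} (_ , _ , minimal) degP f |f|≤n f≈0 = go (degree f)
  where
  go : Zero f ⊎ ∃[ e ] (e ℕ.< length f × HasDegreeℚ f e) → Zero f
  go (inj₁ f≡0) = f≡0
  go (inj₂ (e , e<|f| , degf)) = contradiction (ℕ.≤-trans e<|f| |f|≤n)
    (ℕ.≤⇒≯ (minimal f n e degP degf (rootℚ⇐ {f} {β} f≈0)))

independent⇒minPoly : ∀ {β P n} → Independent ℝ-algebra β n → Monic P → HasDegreeℤ P n →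
  ℝᶻ.evᶻ P β ≋ 0ᵣ → IsMinPoly β P
independent⇒minPoly {β} {P} {n} indep monic degP root = monic , rootℤ⇐ {P} {β} root ,
  λ F d e degP′ (F≢0 , high) F≈0 → ≡.subst (ℕ._≤ e) (degree-unique {P} degP degP′)
    (ℕ.≮⇒≥ λ e<n → F≢0 (independent-coeffs ℝ-algebra indep F (λ k n≤k → high k (ℕ.<-≤-trans e<n n≤k)) (rootℚ⇒ {F} {β} F≈0) e))

-- Minimality applied both ways gives equal degrees; both polynomials being monic, their difference
-- has smaller degree and vanishes at β. Needed because `IsOtherConjugate` and `C[_]` each bring a
-- minimal polynomial of their own.
minPoly-unique : ∀ {β P P′ n} → IsMinPoly β P → HasDegreeℤ P n → IsMinPoly β P′ → P ≈ₚ P′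
minPoly-unique {β} {P} {P′} {n} m@(monic , root , minimal) degP m′@(monic′ , root′ , minimal′) k =
  difference≡0 (≡.trans (≡.sym (coeff--ₚ P P′ k)) (independent-coeffsᶻ ℝ-algebra (minPoly⇒independent {β} {P} m degP)
    (P -ₚ P′) high evD k))
  where
  difference≡0 : ∀ {i j} → i ℤ.- j ≡ 0ℤ → i ≡ j
  difference≡0 {i} {j} = ℤ.i-j≡0⇒i≡j i j

  to-ℚ : ∀ F → evalℤ F β ≈ᵣ 0ᵣ → evalℚ (map toℚ F) β ≈ᵣ 0ᵣ
  to-ℚ F F≈0 = rootℚ⇐ {map toℚ F} {β} (ℝA.trans (ℝA.reflexive (≡.sym (ℝᶻ.evᶻ≡ev F β))) (rootℤ⇒ {F} {β} F≈0))

  degP′ : HasDegreeℤ P′ n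
  degP′ = ≡.subst (HasDegreeℤ P′) (ℕ.≤-antisym
      (minimal′ (map toℚ P) (proj₁ monic′) n (monic⇒degree {P′} monic′) (degree-toℚ {P} degP)
        (to-ℚ P root))
      (minimal (map toℚ P′) n (proj₁ monic′) degP (degree-toℚ {P′} (monic⇒degree {P′} monic′))
        (to-ℚ P′ root′)))
    (monic⇒degree {P′} monic′)

  lead : ∀ {F} → Monic F → HasDegreeℤ F n → coeffℤ F n ≡ 1ℤ
  lead {F} mon degF = ≡.subst (λ d → coeffℤ F d ≡ 1ℤ) (degree-unique {F} (monic⇒degree {F} mon) degF) (proj₁ (proj₂ mon))

  high : ∀ k → n ℕ.≤ k → coeffℤ (P -ₚ P′) k ≡ 0ℤ
  high k n≤k = ≡.trans (coeff--ₚ P P′ k) (difference (ℕ.m≤n⇒m<n∨m≡n n≤k))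
    where
    difference : n ℕ.< k ⊎ n ≡ k → coeffℤ P k ℤ.- coeffℤ P′ k ≡ 0ℤ
    difference (inj₁ n<k) = cong₂ ℤ._-_ (proj₂ degP k n<k) (proj₂ degP′ k n<k)
    difference (inj₂ ≡.refl) = cong₂ ℤ._-_ (lead {P} monic degP) (lead {P′} monic′ degP′)

  evD : ℝᶻ.evᶻ (P -ₚ P′) β ≋ 0ᵣ
  evD = ℝA.trans (ℝᶻ.evᶻ-- P P′ β)
    (ℝA.trans (ℝA.+-cong (rootℤ⇒ {P} {β} root) (ℝA.-‿cong (rootℤ⇒ {P′} {β} root′))) (ℝA.-‿inverseʳ 0ᵣ))

-- Reciprocity of the minimal polynomial

module ℝO = OrderedProperties ℝ-ordered

∣∣²≡ : ∀ α → re α ⊗ re α ⊕ im α ⊗ im α ≡ ∣ α ∣²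
∣∣²≡ α = ≡.trans (cong₂ _⊕_ (⊗≡*ᵣ (re α) (re α)) (⊗≡*ᵣ (im α) (im α)))
  (⊕≡+ᵣ (re α *ᵣ re α) (im α *ᵣ im α))

module _ where
  private module I = ComplexIdentities ℝ-algebra

  evᶻ-conj : ∀ F α → ℂᶻ.evᶻ F (conj α) ≋ᶜ conj (ℂᶻ.evᶻ F α)
  evᶻ-conj []      α = ℝA.refl , I.neg-0
  evᶻ-conj (a ∷ F) α = ℂA.trans (ℂA.+-congˡ (ℂA.*-congˡ (evᶻ-conj F α)))
    ( ℝA.+-congˡ (I.conj-*-re (re α) (im α) (re v) (im v))
    , ℝA.trans (ℝA.+-congˡ (I.conj-*-im (re α) (im α) (re v) (im v)))
        (ℝA.trans (ℝA.+-identityˡ _) (ℝA.-‿cong (ℝA.sym (ℝA.+-identityˡ _)))))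
    where v = ℂᶻ.evᶻ F α

  conj-root : ∀ F {α} → ℂᶻ.evᶻ F α ≋ᶜ ofℝ 0ᵣ → ℂᶻ.evᶻ F (conj α) ≋ᶜ ofℝ 0ᵣ
  conj-root F {α} root = ℂA.trans (evᶻ-conj F α)
    (re≋ root , ℝA.trans (ℝA.-‿cong (im≋ root)) (ℝA.sym I.neg-0))

  unit-conj : ∀ {α} → re α ⊗ re α ⊕ im α ⊗ im α ≋ 1ᵣ → α ⊗ᶜ conj α ≋ᶜ ofℝ 1ᵣ
  unit-conj {α} unit = ℝA.trans (I.conj-norm-re (re α) (im α)) unit , I.conj-norm-im (re α) (im α)

ℂ-nonTrivial : NonTrivial ℂ-algebra
ℂ-nonTrivial 1≋0 = ℝO.nonTrivial (re≋ 1≋0)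

i*i≡1 : ∀ i → 1ℤ ℤ.- i ℤ.* i ≡ 0ℤ → i ≡ 1ℤ ⊎ i ≡ -1ℤ
i*i≡1 i eq with ℤ.i*j≡0⇒i≡0∨j≡0 (1ℤ ℤ.- i) (≡.trans (factor i) eq)
  where
  open ℤ-Solver
  factor : ∀ i → (1ℤ ℤ.- i) ℤ.* (1ℤ ℤ.+ i) ≡ 1ℤ ℤ.- i ℤ.* i
  factor = solve 1 (λ i → (con 1ℤ :- i) :* (con 1ℤ :+ i) := con 1ℤ :- i :* i)
... | inj₁ 1-i≡0 = inj₁ (≡.sym (ℤ.i-j≡0⇒i≡j 1ℤ i 1-i≡0))
... | inj₂ 1+i≡0 = inj₂ (≡.trans (solve 1 (λ i → i := (con 1ℤ :+ i) :- con 1ℤ) i) (cong (ℤ._- 1ℤ) 1+i≡0))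
  where open ℤ-Solver

Reciprocal₆ : ℤ → ℤ → ℤ → ℤ[x]
Reciprocal₆ a b c = 1ℤ ∷ a ∷ b ∷ c ∷ b ∷ a ∷ 1ℤ ∷ []

explicit₇ : ∀ P → (∀ k → 6 ℕ.< k → coeffℤ P k ≡ 0ℤ) → coeffℤ P 6 ≡ 1ℤ →
  P ≈ₚ (coeffℤ P 0 ∷ coeffℤ P 1 ∷ coeffℤ P 2 ∷ coeffℤ P 3 ∷ coeffℤ P 4 ∷ coeffℤ P 5 ∷ 1ℤ ∷ [])
explicit₇ P high lead 0 = ≡.refl
explicit₇ P high lead 1 = ≡.refl
explicit₇ P high lead 2 = ≡.refl
explicit₇ P high lead 3 = ≡.refl
explicit₇ P high lead 4 = ≡.refl
explicit₇ P high lead 5 = ≡.refl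
explicit₇ P high lead 6 = lead
explicit₇ P high lead (suc (suc (suc (suc (suc (suc (suc k))))))) =
  high (7 ℕ.+ k) (ℕ.m≤m+n 7 k)

module _ (A : ℚ-Algebra) where
  open ℚ-Algebra A
  open ℚ-Solver A

  ev-linear : ∀ x → - ι 1ℚ + x * (ι 1ℚ + x * 0#) ≈ x - ι 1ℚ
  ev-linear = solve 1 (λ x → (:- con 1ℚ) :+ x :* (con 1ℚ :+ x :* con 0ℚ) := x :- con 1ℚ)

-- The antireciprocal case: P(1) = 0, so P is not minimal.
antireciprocal-absurd : ∀ {β} p q → Independent ℝ-algebra β 6 → ¬ (β ⊕ ⊖ 1ᵣ ≋ 0ᵣ) →
  ¬ (ℝᶻ.evᶻ (-1ℤ ∷ p ∷ q ∷ 0ℤ ∷ ℤ.- q ∷ ℤ.- p ∷ 1ℤ ∷ []) β ≋ 0ᵣ)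
antireciprocal-absurd {β} p q indep β≉1 root = ℝO.domain (ℝᶻ.evᶻ linear β) (ℝᶻ.evᶻ quintic β)
  (ℝA.trans (ℝA.sym (ℝᶻ.evᶻ-* linear quintic β)) (ℝA.trans (ℝᶻ.evᶻ-cong (linear *ₚ quintic) _ β factored) root))
  (λ eq → β≉1 (ℝA.trans (ℝA.sym linear≈) eq))
  (λ eq → contradiction (independent-coeffsᶻ ℝ-algebra indep quintic (coeff-beyond quintic) eq 0) λ ())
  where
  linear quintic : ℤ[x]
  linear  = -1ℤ ∷ 1ℤ ∷ []
  quintic = 1ℤ ∷ 1ℤ ℤ.- p ∷ 1ℤ ℤ.- p ℤ.- q ∷ 1ℤ ℤ.- p ℤ.- q ∷ 1ℤ ℤ.- p ∷ 1ℤ ∷ []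

  open ℤ-Solver
  factored : linear *ₚ quintic ≈ₚ (-1ℤ ∷ p ∷ q ∷ 0ℤ ∷ ℤ.- q ∷ ℤ.- p ∷ 1ℤ ∷ [])
  factored 0 = ≡.refl
  factored 1 = solve 1 (λ p → con -1ℤ :* (con 1ℤ :- p) :+ con 1ℤ := p) p
  factored 2 = solve 2 (λ p q → con -1ℤ :* (con 1ℤ :- p :- q) :+ con 1ℤ :* (con 1ℤ :- p) := q) p q
  factored 3 = solve 2 (λ p q → con -1ℤ :* (con 1ℤ :- p :- q) :+ con 1ℤ :* (con 1ℤ :- p :- q) := con 0ℤ) p q
  factored 4 = solve 2 (λ p q → con -1ℤ :* (con 1ℤ :- p) :+ con 1ℤ :* (con 1ℤ :- p :- q) := :- q) p q
  factored 5 = solve 1 (λ p → con -1ℤ :+ con 1ℤ :* (con 1ℤ :- p) := :- p) p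
  factored 6 = ≡.refl
  factored (suc (suc (suc (suc (suc (suc (suc k))))))) = ≡.refl

  linear≈ : ℝᶻ.evᶻ linear β ≋ β ⊕ ⊖ 1ᵣ
  linear≈ = ℝA.trans (ℝA.+-congʳ (fromℚ-neg 1ℚ)) (ev-linear ℝ-algebra β)

-- On the unit circle the conjugate of α is 1/α, and it is again a root of P, so the reversed
-- polynomial vanishes at α. Minimality is given at β, hence the transfer of independence to α.
reciprocal : ∀ {β α P} → IsMinPoly β P → HasDegreeℤ P 6 → ¬ (β ⊕ ⊖ 1ᵣ ≋ 0ᵣ) →
  ℂᶻ.evᶻ P α ≋ᶜ ofℝ 0ᵣ → re α ⊗ re α ⊕ im α ⊗ im α ≋ 1ᵣ →
  ∃[ a ] ∃[ b ] ∃[ c ] (P ≈ₚ Reciprocal₆ a b c)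
reciprocal {β} {α} {P} minP degP β≉1 P[α]≈0 unit = by-sign (i*i≡1 p₀ (D≡0 0))
  where
  p₀ = coeffℤ P 0
  p₁ = coeffℤ P 1
  p₂ = coeffℤ P 2
  p₃ = coeffℤ P 3
  p₄ = coeffℤ P 4
  p₅ = coeffℤ P 5

  L : ℤ[x]
  L = p₀ ∷ p₁ ∷ p₂ ∷ p₃ ∷ p₄ ∷ p₅ ∷ 1ℤ ∷ []

  P≈L : P ≈ₚ L
  P≈L = explicit₇ P (proj₂ degP) (≡.subst (λ d → coeffℤ P d ≡ 1ℤ)
    (degree-unique {P} (monic⇒degree {P} (proj₁ minP)) degP) (proj₁ (proj₂ (proj₁ minP))))

  independent : Independent ℝ-algebra β 6
  independent = minPoly⇒independent {β} {P} minP degP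

  L[β]≈0 : ℝᶻ.evᶻ L β ≋ 0ᵣ
  L[β]≈0 = ℝA.trans (ℝA.sym (ℝᶻ.evᶻ-cong P L β P≈L)) (rootℤ⇒ {P} {β} (proj₁ (proj₂ minP)))

  L[α]≈0 : ℂᶻ.evᶻ L α ≋ᶜ ofℝ 0ᵣ
  L[α]≈0 = ℂA.trans (ℂA.sym (ℂᶻ.evᶻ-cong P L α P≈L)) P[α]≈0

  independentᶜ : Independent ℂ-algebra α 6
  independentᶜ = independent-transfer ℝ-algebra ℂ-algebra β α ℝO.domain ℂ-nonTrivial (map toℚ L) 6 ≡.refl ≡.refl
    independent (ℝA.trans (ℝA.reflexive (≡.sym (ℝᶻ.evᶻ≡ev L β))) L[β]≈0)
    (ℂA.trans (ℂA.reflexive (≡.sym (ℂᶻ.evᶻ≡ev L α))) L[α]≈0) 6 ℕ.≤-refl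

  -- The leading coefficient of the reversed polynomial is p₀; subtracting p₀ times the monic `L`
  -- brings the degree below 6, so `D` is zero. Its constant coefficient then reads 1 - p₀² = 0.
  D : ℤ[x]
  D = reverse L -ₚ map (p₀ ℤ.*_) L

  D-high : ∀ k → 6 ℕ.≤ k → coeffℤ D k ≡ 0ℤ
  D-high k 6≤k = by-cases (ℕ.m≤n⇒m<n∨m≡n 6≤k)
    where
    by-cases : 6 ℕ.< k ⊎ 6 ≡ k → coeffℤ D k ≡ 0ℤ
    by-cases (inj₁ 6<k)    = coeff-beyond D k 6<k
    by-cases (inj₂ ≡.refl) = ≡.trans (cong (λ z → p₀ ℤ.+ ℤ.- z) (ℤ.*-identityʳ p₀)) (ℤ.+-inverseʳ p₀)

  D[α]≈0 : ℂᶻ.evᶻ D α ≋ᶜ ofℝ 0ᵣ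
  D[α]≈0 = ℂA.trans (ℂᶻ.evᶻ-- (reverse L) (map (p₀ ℤ.*_) L) α)
    (ℂA.trans (ℂA.+-cong (ℂᶻ.evᶻ-reverse (unit-conj unit) L (conj-root L L[α]≈0))
        (ℂA.-‿cong (ℂA.trans (ℂᶻ.evᶻ-scale p₀ L α) (ℂA.trans (ℂA.*-congˡ L[α]≈0) (ℂA.zeroʳ _)))))
      (ℂA.-‿inverseʳ (ofℝ 0ᵣ)))

  D≡0 : ∀ k → coeffℤ D k ≡ 0ℤ
  D≡0 = independent-coeffsᶻ ℂ-algebra independentᶜ D D-high D[α]≈0

  by-sign : p₀ ≡ 1ℤ ⊎ p₀ ≡ -1ℤ → ∃[ a ] ∃[ b ] ∃[ c ] (P ≈ₚ Reciprocal₆ a b c)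
  by-sign (inj₁ p₀≡1) = p₁ , p₂ , p₃ , λ k → ≡.trans (P≈L k) (L≈ k)
    where
    same : ∀ {s t} → s ℤ.+ ℤ.- (p₀ ℤ.* t) ≡ 0ℤ → s ≡ t
    same {s} {t} eq = ℤ.i-j≡0⇒i≡j s t (≡.trans (cong (λ z → s ℤ.+ ℤ.- z)
      (≡.sym (≡.trans (cong (ℤ._* t) p₀≡1) (ℤ.*-identityˡ t)))) eq)

    L≈ : L ≈ₚ Reciprocal₆ p₁ p₂ p₃
    L≈ 0 = p₀≡1
    L≈ 1 = ≡.refl
    L≈ 2 = ≡.refl
    L≈ 3 = ≡.refl
    L≈ 4 = same (D≡0 2)
    L≈ 5 = same (D≡0 1)
    L≈ 6 = ≡.refl
    L≈ (suc (suc (suc (suc (suc (suc (suc k))))))) = ≡.refl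
  by-sign (inj₂ p₀≡-1) = ⊥-elim (antireciprocal-absurd p₁ p₂ independent β≉1
    (ℝA.trans (ℝA.sym (ℝᶻ.evᶻ-cong L _ β L≈)) L[β]≈0))
    where
    open ℤ-Solver
    opposite : ∀ {s t} → s ℤ.+ ℤ.- (p₀ ℤ.* t) ≡ 0ℤ → s ≡ ℤ.- t
    opposite {s} {t} eq = ≡.trans (solve 2 (λ s t → s := (s :- con -1ℤ :* t) :- t) s t)
      (≡.trans (cong (λ z → (s ℤ.- z ℤ.* t) ℤ.- t) (≡.sym p₀≡-1)) (≡.trans (cong (ℤ._- t) eq) (ℤ.+-identityˡ (ℤ.- t))))

    self-opposite : ∀ i → i ≡ ℤ.- i → i ≡ 0ℤ
    self-opposite (+ 0) _ = ≡.refl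

    L≈ : L ≈ₚ (-1ℤ ∷ p₁ ∷ p₂ ∷ 0ℤ ∷ ℤ.- p₂ ∷ ℤ.- p₁ ∷ 1ℤ ∷ [])
    L≈ 0 = p₀≡-1
    L≈ 1 = ≡.refl
    L≈ 2 = ≡.refl
    L≈ 3 = self-opposite p₃ (opposite (D≡0 3))
    L≈ 4 = opposite (D≡0 2)
    L≈ 5 = opposite (D≡0 1)
    L≈ 6 = ≡.refl
    L≈ (suc (suc (suc (suc (suc (suc (suc k))))))) = ≡.refl

-- Cofactors of reciprocal sextics

module CofactorArithmetic where

  open import Data.Integer.Base using (_+_; _*_; -_; _-_; _≤_)

  infixl 6 _⊹_
  infixl 7 _⊛_

  _⊹_ : ∀ {i j} → 0ℤ ≤ i → 0ℤ ≤ j → 0ℤ ≤ i + j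
  _⊹_ = ℤ.+-mono-≤

  _⊛_ : ∀ {i j} → 0ℤ ≤ i → 0ℤ ≤ j → 0ℤ ≤ i * j
  _⊛_ {+ m} {+ n} _ _ = subst (0ℤ ≤_) (ℤ.pos-* m n) (ℤ.+≤+ z≤n)

  nat : ∀ n → 0ℤ ≤ + n
  nat n = ℤ.+≤+ z≤n

  -- The common shape of the contradictions below: a combination of the coefficient equations equals
  -- 1 plus products of visibly nonnegative terms.
  1+nonneg≢0 : ∀ {i} → 0ℤ ≤ i → ¬ (1ℤ + i ≡ 0ℤ)
  1+nonneg≢0 {+ n} _ ()

  nonneg-cancel : ∀ {i m} → 0ℤ ≤ m → 0ℤ ≤ i * (1ℤ + m) → 0ℤ ≤ i
  nonneg-cancel {i} {+ n} _ h = ℤ.*-cancelʳ-≤-pos 0ℤ i (+ suc n) h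

  difference : ∀ {i j} → i ≤ j → 0ℤ ≤ j - i
  difference = ℤ.i≤j⇒0≤j-i

  private
    eliminate : ∀ {e f g} k → e ≡ 0ℤ → f ≡ e * k + g → f ≡ g
    eliminate {g = g} k ≡.refl eq = ≡.trans eq (≡.trans (cong (_+ g) (ℤ.*-zeroˡ k)) (ℤ.+-identityˡ g))

    solved : ∀ {e f g} → e ≡ 0ℤ → f ≡ e + g → f ≡ g
    solved {g = g} ≡.refl eq = ≡.trans eq (ℤ.+-identityˡ g)

  zero-sum : ∀ {x n j} → 0ℤ ≤ x → 0ℤ ≤ n → 0ℤ ≤ j → x + n + j * (1ℤ + n) ≡ 0ℤ → n ≡ 0ℤ × j ≡ 0ℤ
  zero-sum {x} {n} {+ suc j} 0≤x 0≤n _ eq = contradiction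
    (≡.trans (solve 3 (λ x n j → con 1ℤ :+ (x :+ n :+ n :+ j :* (con 1ℤ :+ n)) := x :+ n :+ (con 1ℤ :+ j) :* (con 1ℤ :+ n)) x n (+ j)) eq)
    (1+nonneg≢0 (0≤x ⊹ 0≤n ⊹ 0≤n ⊹ nat j ⊛ (nat 1 ⊹ 0≤n)))
    where open ℤ-Solver
  zero-sum {x} {+ suc n} {+ 0} 0≤x _ _ eq = contradiction
    (≡.trans (solve 2 (λ x n → con 1ℤ :+ (x :+ n) := x :+ (con 1ℤ :+ n) :+ con 0ℤ :* (con 1ℤ :+ (con 1ℤ :+ n))) x (+ n)) eq)
    (1+nonneg≢0 (0≤x ⊹ nat n))
    where open ℤ-Solver
  zero-sum {x} {+ 0} {+ 0} _ _ _ _ = ≡.refl , ≡.refl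

  -- The coefficients of (x⁶ + a x⁵ + b x⁴ + c x³ + b x² + a x + 1)(x² + q₁ x + q₀),
  -- compared with x⁸ - c₁ x⁷ - … - c₆ x² - (c₇ + 1) x - (c₈ - c₁).
  record Factorization (a b c q₀ q₁ c₁ c₂ c₃ c₄ c₅ c₆ c₇ c₈ : ℤ) : Set where
    field
      x⁷ : a + q₁ + c₁ ≡ 0ℤ
      x⁶ : b + a * q₁ + q₀ + c₂ ≡ 0ℤ
      x⁵ : c + b * q₁ + a * q₀ + c₃ ≡ 0ℤ
      x⁴ : b + c * q₁ + b * q₀ + c₄ ≡ 0ℤ
      x³ : a + b * q₁ + c * q₀ + c₅ ≡ 0ℤ
      x² : 1ℤ + a * q₁ + b * q₀ + c₆ ≡ 0ℤ
      x¹ : q₁ + a * q₀ + c₇ + 1ℤ ≡ 0ℤ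
      x⁰ : q₀ - c₁ + c₈ ≡ 0ℤ

  record Digit (c₁ k : ℤ) : Set where
    constructor _,_
    field
      0≤ : 0ℤ ≤ k
      ≤c₁ : k ≤ c₁

  NonNegative : ℤ → ℤ → ℤ → Set
  NonNegative a b c = 0ℤ ≤ a × 0ℤ ≤ b × 0ℤ ≤ c

  module _ {a b c c₁ c₂ c₃ c₄ c₅ c₆ c₇ c₈ : ℤ} (0≤c₁ : 0ℤ ≤ c₁ - 1ℤ)
    (d₂ : Digit c₁ c₂) (d₃ : Digit c₁ c₃) (d₄ : Digit c₁ c₄) (d₅ : Digit c₁ c₅)
    (d₆ : Digit c₁ c₆) (d₇ : Digit c₁ c₇) (d₈ : Digit c₁ c₈) where

    open ℤ-Solver
    open Digit

    -- Here Q = x² + x + 1 has the primitive cube roots of unity ω as roots. The combination `x⁴` -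
    -- `x⁶` - `x⁵` + 2 `x⁷` eliminates a, b and c.
    ω-absurd : ¬ Factorization a b c 1ℤ 1ℤ c₁ c₂ c₃ c₄ c₅ c₆ c₇ c₈
    ω-absurd F = 1+nonneg≢0 (0≤ d₄ ⊹ difference (≤c₁ d₂) ⊹ difference (≤c₁ d₃))
      (≡.trans (solve 7 (λ a b c c₁ c₂ c₃ c₄ →
        con 1ℤ :+ (c₄ :+ (c₁ :- c₂) :+ (c₁ :- c₃)) :=
        (b :+ c :* con 1ℤ :+ b :* con 1ℤ :+ c₄) :- (b :+ a :* con 1ℤ :+ con 1ℤ :+ c₂)
          :- (c :+ b :* con 1ℤ :+ a :* con 1ℤ :+ c₃) :+ con (+ 2) :* (a :+ con 1ℤ :+ c₁)) a b c c₁ c₂ c₃ c₄)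
        (zeros x⁴ x⁶ x⁵ x⁷))
      where
      open Factorization F
      zeros : ∀ {e f g h} → e ≡ 0ℤ → f ≡ 0ℤ → g ≡ 0ℤ → h ≡ 0ℤ → e - f - g + + 2 * h ≡ 0ℤ
      zeros ≡.refl ≡.refl ≡.refl ≡.refl = ≡.refl

    -- With t and 1/t the roots of Q = x² + k x + 1, k = 3 + j, the equations `x⁷`, `x⁶`, `x⁵`, `x⁴`
    -- are multiplied by -(t³ + t⁻³), -(t² + t⁻²), -(t + t⁻¹), -1. As P is palindromic, a, b and c
    -- cancel; for k ≥ 3 the term c₁ (k³ - 3k) outweighs the negative terms c₂ (k² - 2) and c₄.
    large-q₁-absurd : ∀ {j} → 0ℤ ≤ j → ¬ Factorization a b c 1ℤ (+ 3 + j) c₁ c₂ c₃ c₄ c₅ c₆ c₇ c₈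
    large-q₁-absurd {j} 0≤j F = 1+nonneg≢0
      (nat 46 ⊹ nat 84 ⊛ 0≤j ⊹ nat 50 ⊛ (0≤j ⊛ 0≤j) ⊹ nat 12 ⊛ (0≤j ⊛ 0≤j ⊛ 0≤j) ⊹ 0≤j ⊛ 0≤j ⊛ 0≤j ⊛ 0≤j
        ⊹ difference (≤c₁ d₂) ⊛ (nat 7 ⊹ nat 6 ⊛ 0≤j ⊹ 0≤j ⊛ 0≤j) ⊹ difference (≤c₁ d₄)
        ⊹ (0≤c₁ ⊹ nat 1) ⊛ (nat 10 ⊹ nat 18 ⊛ 0≤j ⊹ nat 8 ⊛ (0≤j ⊛ 0≤j) ⊹ 0≤j ⊛ 0≤j ⊛ 0≤j)
        ⊹ 0≤ d₃ ⊛ (nat 3 ⊹ 0≤j))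
      (≡.trans (solve 8 (λ a b c c₁ c₂ c₃ c₄ j →
        let k = con (+ 3) :+ j in
        con 1ℤ :+
        (con (+ 46) :+ con (+ 84) :* j :+ con (+ 50) :* (j :* j) :+ con (+ 12) :* (j :* j :* j) :+ j :* j :* j :* j
        :+ (c₁ :- c₂) :* (con (+ 7) :+ con (+ 6) :* j :+ j :* j) :+ (c₁ :- c₄)
        :+ ((c₁ :- con 1ℤ) :+ con 1ℤ) :* (con (+ 10) :+ con (+ 18) :* j :+ con (+ 8) :* (j :* j) :+ j :* j :* j)
        :+ c₃ :* (con (+ 3) :+ j))
        :=
        (a :+ k :+ c₁) :* (k :* (k :* k :- con (+ 3)))
          :+ (b :+ a :* k :+ con 1ℤ :+ c₂) :* (con (+ 2) :- k :* k)
          :+ (c :+ b :* k :+ a :* con 1ℤ :+ c₃) :* k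
          :+ (b :+ c :* k :+ b :* con 1ℤ :+ c₄) :* con -1ℤ) a b c c₁ c₂ c₃ c₄ j)
        (zeros _ _ _ x⁷ x⁶ x⁵ x⁴))
      where
      open Factorization F
      zeros : ∀ {e f g h} k l m → e ≡ 0ℤ → f ≡ 0ℤ → g ≡ 0ℤ → h ≡ 0ℤ → e * k + f * l + g * m + h * -1ℤ ≡ 0ℤ
      zeros k l m ≡.refl ≡.refl ≡.refl ≡.refl =
        cong₂ (λ u v → u + v + 0ℤ) (cong₂ _+_ (ℤ.*-zeroˡ k) (ℤ.*-zeroˡ l)) (ℤ.*-zeroˡ m)

    -- With q₁ = -s, s ≥ 2, the equations give s a = b + c₂ + 1 and s c = 2b + c₄. Inserted into s
    -- times the equation of x⁵ they leave (s² - 3) b = c₂ + c₄ + 1 + s c₃ ≥ 0, and the signs of a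
    -- and c follow.
    negative-q₁ : ∀ {j} → 0ℤ ≤ j → Factorization a b c 1ℤ (- (+ 2 + j)) c₁ c₂ c₃ c₄ c₅ c₆ c₇ c₈ → NonNegative a b c
    negative-q₁ {j} 0≤j F = 0≤a , 0≤b , 0≤c
      where
      open Factorization F
      s = + 2 + j

      as≡ : a * (1ℤ + (1ℤ + j)) ≡ b + c₂ + 1ℤ
      as≡ = eliminate -1ℤ x⁶ (solve 4 (λ a b c₂ j → a :* (con 1ℤ :+ (con 1ℤ :+ j))
        := (b :+ a :* (:- (con (+ 2) :+ j)) :+ con 1ℤ :+ c₂) :* con -1ℤ :+ (b :+ c₂ :+ con 1ℤ)) a b c₂ j)

      cs≡ : c * (1ℤ + (1ℤ + j)) ≡ b + b + c₄
      cs≡ = eliminate -1ℤ x⁴ (solve 4 (λ b c c₄ j → c :* (con 1ℤ :+ (con 1ℤ :+ j))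
        := (b :+ c :* (:- (con (+ 2) :+ j)) :+ b :* con 1ℤ :+ c₄) :* con -1ℤ :+ (b :+ b :+ c₄)) b c c₄ j)

      bs²≡ : b * (1ℤ + (+ 4 * j + j * j)) ≡ c₄ + c₂ + 1ℤ + c₃ * s
      bs²≡ = eliminate (- s) x⁵ (eliminate -1ℤ x⁶ (eliminate -1ℤ x⁴ (solve 7 (λ a b c c₂ c₃ c₄ j →
        let s = con (+ 2) :+ j in
        b :* (con 1ℤ :+ (con (+ 4) :* j :+ j :* j))
        := (b :+ c :* (:- s) :+ b :* con 1ℤ :+ c₄) :* con -1ℤ
           :+ ((b :+ a :* (:- s) :+ con 1ℤ :+ c₂) :* con -1ℤ
           :+ ((c :+ b :* (:- s) :+ a :* con 1ℤ :+ c₃) :* (:- s)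
           :+ (c₄ :+ c₂ :+ con 1ℤ :+ c₃ :* s)))) a b c c₂ c₃ c₄ j)))

      0≤b : 0ℤ ≤ b
      0≤b = nonneg-cancel (nat 4 ⊛ 0≤j ⊹ 0≤j ⊛ 0≤j)
        (subst (0ℤ ≤_) (≡.sym bs²≡) (0≤ d₄ ⊹ 0≤ d₂ ⊹ nat 1 ⊹ 0≤ d₃ ⊛ (nat 2 ⊹ 0≤j)))

      0≤a : 0ℤ ≤ a
      0≤a = nonneg-cancel (nat 1 ⊹ 0≤j) (subst (0ℤ ≤_) (≡.sym as≡) (0≤b ⊹ 0≤ d₂ ⊹ nat 1))

      0≤c : 0ℤ ≤ c
      0≤c = nonneg-cancel (nat 1 ⊹ 0≤j) (subst (0ℤ ≤_) (≡.sym cs≡) (0≤b ⊹ 0≤b ⊹ 0≤ d₄))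

    -- As P is palindromic, subtracting the equation of x^(8-i) from that of x^i cancels the terms
    -- with q₁ for i = 1, 2, 3. This determines N a, N b and N c with N = q₀ - 1 ≥ 1; the remaining
    -- equations then decide the signs.
    large-q₀ : ∀ {n q₁} → 0ℤ ≤ n → Factorization a b c (+ 2 + n) q₁ c₁ c₂ c₃ c₄ c₅ c₆ c₇ c₈ → NonNegative a b c
    large-q₀ {n} {q₁} 0≤n F = by-sign a ≡.refl
      where
      open Factorization F
      N = 1ℤ + n

      q₁≡ : q₁ ≡ - (c₁ + a)
      q₁≡ = solved x⁷ (solve 3 (λ a q c₁ → q := (a :+ q :+ c₁) :+ (:- (c₁ :+ a))) a q₁ c₁)

      open Factorization (subst (λ q → Factorization a b c (+ 2 + n) q c₁ c₂ c₃ c₄ c₅ c₆ c₇ c₈) q₁≡ F)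
        using () renaming (x⁶ to x⁶′; x⁵ to x⁵′; x⁴ to x⁴′; x³ to x³′; x² to x²′)

      aN≡ : a * N ≡ c₁ - c₇ - 1ℤ
      aN≡ = eliminate 1ℤ x¹ (eliminate -1ℤ x⁷ (solve 5 (λ a q n c₁ c₇ → a :* (con 1ℤ :+ n)
        := (a :+ q :+ c₁) :* con -1ℤ :+ ((q :+ a :* (con (+ 2) :+ n) :+ c₇ :+ con 1ℤ) :* con 1ℤ :+ (c₁ :- c₇ :- con 1ℤ))) a q₁ n c₁ c₇))

      bN≡ : b * N ≡ N + c₂ - c₆
      bN≡ = eliminate 1ℤ x²′ (eliminate -1ℤ x⁶′ (solve 6 (λ a b n c₁ c₂ c₆ → b :* (con 1ℤ :+ n)
        := (b :+ a :* (:- (c₁ :+ a)) :+ (con (+ 2) :+ n) :+ c₂) :* con -1ℤ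
           :+ ((con 1ℤ :+ a :* (:- (c₁ :+ a)) :+ b :* (con (+ 2) :+ n) :+ c₆) :* con 1ℤ :+ ((con 1ℤ :+ n) :+ c₂ :- c₆))) a b n c₁ c₂ c₆))

      cN≡ : c * N ≡ a * N + c₃ - c₅
      cN≡ = eliminate 1ℤ x³′ (eliminate -1ℤ x⁵′ (solve 7 (λ a b c n c₁ c₃ c₅ → c :* (con 1ℤ :+ n)
        := (c :+ b :* (:- (c₁ :+ a)) :+ a :* (con (+ 2) :+ n) :+ c₃) :* con -1ℤ
           :+ ((a :+ b :* (:- (c₁ :+ a)) :+ c :* (con (+ 2) :+ n) :+ c₅) :* con 1ℤ :+ (a :* (con 1ℤ :+ n) :+ c₃ :- c₅))) a b c n c₁ c₃ c₅))

      -- N times the coefficient of x⁵, with c eliminated.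
      bSN≡ : b * (c₁ + a) * N ≡ a * N + c₃ - c₅ + a * N * (+ 2 + n) + c₃ * N
      bSN≡ = ≡.trans (eliminate (- N) x⁵′ (solve 6 (λ a b c n c₁ c₃ → b :* (c₁ :+ a) :* (con 1ℤ :+ n)
        := (c :+ b :* (:- (c₁ :+ a)) :+ a :* (con (+ 2) :+ n) :+ c₃) :* (:- (con 1ℤ :+ n))
           :+ (c :* (con 1ℤ :+ n) :+ a :* (con 1ℤ :+ n) :* (con (+ 2) :+ n) :+ c₃ :* (con 1ℤ :+ n))) a b c n c₁ c₃)) (cong (λ z → z + a * N * (+ 2 + n) + c₃ * N) cN≡)

      -- a = - 1 - j forces j = n = 0 and then c₆ > c₁.
      negative-a : ∀ {j} → 0ℤ ≤ j → ¬ (a ≡ - (1ℤ + j))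
      negative-a {j} 0≤j a≡ = conclude (zero-sum (difference (≤c₁ d₇)) 0≤n 0≤j (≡.trans (solve 4 (λ j n c₁ c₇ →
          (c₁ :- c₇) :+ n :+ j :* (con 1ℤ :+ n) := (c₁ :- c₇ :- con 1ℤ) :- (:- (con 1ℤ :+ j)) :* (con 1ℤ :+ n)) j n c₁ c₇)
          (≡.trans (cong (_- (- (1ℤ + j)) * N) (≡.sym aN≡)) (≡.trans (cong (λ z → a * N - z * N) (≡.sym a≡)) (ℤ.+-inverseʳ (a * N))))))
        where
        conclude : n ≡ 0ℤ × j ≡ 0ℤ → ⊥
        conclude (n≡0 , j≡0) = 1+nonneg≢0 (difference (≤c₁ d₆) ⊹ 0≤ d₂ ⊹ 0≤ d₂ ⊹ nat 1)
          (≡.trans (solve 4 (λ b c₁ c₂ c₆ → con 1ℤ :+ ((c₁ :- c₆) :+ c₂ :+ c₂ :+ con 1ℤ)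
            := (b :+ con -1ℤ :* (:- (c₁ :+ con -1ℤ)) :+ con (+ 2) :+ c₂) :+ ((con 1ℤ :+ c₂ :- c₆) :- b :* con 1ℤ)) b c₁ c₂ c₆)
            (cong₂ _+_ x⁶″ (≡.trans (cong (_- b * 1ℤ) (≡.sym bN″)) (ℤ.+-inverseʳ (b * 1ℤ)))))
          where
          a≡-1 : a ≡ -1ℤ
          a≡-1 = ≡.trans a≡ (cong (λ z → - (1ℤ + z)) j≡0)

          x⁶″ : b + -1ℤ * (- (c₁ + -1ℤ)) + + 2 + c₂ ≡ 0ℤ
          x⁶″ = subst₂ (λ z w → b + z * (- (c₁ + z)) + (+ 2 + w) + c₂ ≡ 0ℤ) a≡-1 n≡0 x⁶′

          bN″ : b * 1ℤ ≡ 1ℤ + c₂ - c₆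
          bN″ = subst (λ w → b * (1ℤ + w) ≡ (1ℤ + w) + c₂ - c₆) n≡0 bN≡

      -- For a = 0 the equation of x⁶ gives b ≤ -2, whereas `bSN≡` gives b c₁ N ≥ -c₅ ≥ -c₁.
      zero-a : ¬ (a ≡ 0ℤ)
      zero-a a≡0 = 1+nonneg≢0
        (0≤ d₃ ⊹ 0≤ d₃ ⊛ (nat 1 ⊹ 0≤n) ⊹ difference (≤c₁ d₅) ⊹ 0≤c₁
          ⊹ (0≤c₁ ⊹ nat 1) ⊛ (nat 3 ⊛ 0≤n ⊹ 0≤n ⊛ 0≤n ⊹ 0≤ d₂ ⊹ 0≤n ⊛ 0≤ d₂))
        (≡.trans (solve 6 (λ b n c₁ c₂ c₃ c₅ →
          let N = con 1ℤ :+ n ; o = con 0ℤ in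
          con 1ℤ :+ (c₃ :+ c₃ :* N :+ (c₁ :- c₅) :+ (c₁ :- con 1ℤ)
            :+ ((c₁ :- con 1ℤ) :+ con 1ℤ) :* (con (+ 3) :* n :+ n :* n :+ c₂ :+ n :* c₂))
          := (b :+ o :* (:- (c₁ :+ o)) :+ (con (+ 2) :+ n) :+ c₂) :* (c₁ :* N)
             :+ ((o :* N :+ c₃ :- c₅ :+ o :* N :* (con (+ 2) :+ n) :+ c₃ :* N) :- b :* (c₁ :+ o) :* N)) b n c₁ c₂ c₃ c₅)
          (cong₂ _+_ (≡.trans (cong (_* (c₁ * N)) x⁶″) (ℤ.*-zeroˡ (c₁ * N)))
            (≡.trans (cong (_- b * (c₁ + 0ℤ) * N) (≡.sym bSN″)) (ℤ.+-inverseʳ (b * (c₁ + 0ℤ) * N)))))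
        where
        x⁶″ : b + 0ℤ * (- (c₁ + 0ℤ)) + (+ 2 + n) + c₂ ≡ 0ℤ
        x⁶″ = subst (λ z → b + z * (- (c₁ + z)) + (+ 2 + n) + c₂ ≡ 0ℤ) a≡0 x⁶′

        bSN″ : b * (c₁ + 0ℤ) * N ≡ 0ℤ * N + c₃ - c₅ + 0ℤ * N * (+ 2 + n) + c₃ * N
        bSN″ = subst (λ z → b * (c₁ + z) * N ≡ z * N + c₃ - c₅ + z * N * (+ 2 + n) + c₃ * N) a≡0 bSN≡

      positive-a : ∀ {i} → 0ℤ ≤ i → a ≡ 1ℤ + i → NonNegative a b c
      positive-a {i} 0≤i a≡ = 0≤a , 0≤b , 0≤c
        where
        0≤a : 0ℤ ≤ a
        0≤a = subst (0ℤ ≤_) (≡.sym a≡) (nat 1 ⊹ 0≤i)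

        -- For b ≤ -1 the left side of `bSN≡` is at most -(c₁ + a) N, while the right side is
        -- greater than -c₅ ≥ -c₁.
        ¬negative-b : ∀ {e} → 0ℤ ≤ e → ¬ (b ≡ - (1ℤ + e))
        ¬negative-b {e} 0≤e b≡ = 1+nonneg≢0
          (difference (≤c₁ d₅) ⊹ 0≤ d₃ ⊹ 0≤ d₃ ⊛ (nat 1 ⊹ 0≤n) ⊹ (0≤c₁ ⊹ nat 1) ⊛ (0≤n ⊹ 0≤e ⊹ 0≤e ⊛ 0≤n)
            ⊹ (nat 1 ⊹ 0≤e) ⊛ (nat 1 ⊹ 0≤i) ⊛ (nat 1 ⊹ 0≤n) ⊹ (nat 1 ⊹ 0≤i) ⊛ (nat 1 ⊹ 0≤n) ⊛ (nat 2 ⊹ 0≤n)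
            ⊹ (0≤i ⊹ 0≤n ⊹ 0≤i ⊛ 0≤n))
          (≡.trans (solve 6 (λ e i n c₁ c₃ c₅ →
            let N = con 1ℤ :+ n ; a = con 1ℤ :+ i in
            con 1ℤ :+ ((c₁ :- c₅) :+ c₃ :+ c₃ :* N :+ ((c₁ :- con 1ℤ) :+ con 1ℤ) :* (n :+ e :+ e :* n)
              :+ (con 1ℤ :+ e) :* a :* N :+ a :* N :* (con (+ 2) :+ n) :+ (i :+ n :+ i :* n))
            := (a :* N :+ c₃ :- c₅ :+ a :* N :* (con (+ 2) :+ n) :+ c₃ :* N) :- (:- (con 1ℤ :+ e)) :* (c₁ :+ a) :* N) e i n c₁ c₃ c₅)
            (≡.trans (cong (_- (- (1ℤ + e)) * (c₁ + (1ℤ + i)) * N) (≡.sym bSN″)) (ℤ.+-inverseʳ ((- (1ℤ + e)) * (c₁ + (1ℤ + i)) * N))))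
          where
          bSN″ : (- (1ℤ + e)) * (c₁ + (1ℤ + i)) * N
            ≡ (1ℤ + i) * N + c₃ - c₅ + (1ℤ + i) * N * (+ 2 + n) + c₃ * N
          bSN″ = subst₂ (λ y z → y * (c₁ + z) * N ≡ z * N + c₃ - c₅ + z * N * (+ 2 + n) + c₃ * N) b≡ a≡ bSN≡

        0≤b : 0ℤ ≤ b
        0≤b = go b ≡.refl
          where
          go : ∀ k → b ≡ k → 0ℤ ≤ b
          go (+ k)    eq = subst (0ℤ ≤_) (≡.sym eq) (nat k)
          go -[1+ k ] eq = ⊥-elim (¬negative-b (nat k) eq)

        cS≡ : c * (1ℤ + ((c₁ - 1ℤ) + a)) ≡ b + b * (+ 2 + n) + c₄
        cS≡ = eliminate -1ℤ x⁴′ (solve 6 (λ a b c n c₁ c₄ → c :* (con 1ℤ :+ ((c₁ :- con 1ℤ) :+ a))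
          := (b :+ c :* (:- (c₁ :+ a)) :+ b :* (con (+ 2) :+ n) :+ c₄) :* con -1ℤ :+ (b :+ b :* (con (+ 2) :+ n) :+ c₄)) a b c n c₁ c₄)

        0≤c : 0ℤ ≤ c
        0≤c = nonneg-cancel (0≤c₁ ⊹ 0≤a) (subst (0ℤ ≤_) (≡.sym cS≡) (0≤b ⊹ 0≤b ⊛ (nat 2 ⊹ 0≤n) ⊹ 0≤ d₄))

      by-sign : ∀ i → a ≡ i → NonNegative a b c
      by-sign (+ 0)      a≡ = ⊥-elim (zero-a a≡)
      by-sign (+ suc i)  a≡ = positive-a (nat i) a≡
      by-sign -[1+ j ]   a≡ = ⊥-elim (negative-a (nat j) a≡)

    cofactor-cases : ∀ {q₀ q₁} → ¬ (c₈ ≡ c₁) → ¬ NonNegative a b c →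
      Factorization a b c q₀ q₁ c₁ c₂ c₃ c₄ c₅ c₆ c₇ c₈ →
      q₀ ≡ 1ℤ × (q₁ ≡ -1ℤ ⊎ q₁ ≡ 0ℤ ⊎ q₁ ≡ + 2)
    cofactor-cases {q₀} {q₁} c₈≢c₁ ¬nonneg F = by-q₀ q₀ q₁ F
      where
      by-q₀ : ∀ q₀ q₁ → Factorization a b c q₀ q₁ c₁ c₂ c₃ c₄ c₅ c₆ c₇ c₈ →
        q₀ ≡ 1ℤ × (q₁ ≡ -1ℤ ⊎ q₁ ≡ 0ℤ ⊎ q₁ ≡ + 2)
      by-q₀ -[1+ n ] q₁ F = contradiction
        (≡.trans (solve 3 (λ n c₁ c₈ → con 1ℤ :+ (n :+ (c₁ :- c₈)) := :- (:- (con 1ℤ :+ n) :- c₁ :+ c₈)) (+ n) c₁ c₈)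
          (cong -_ (Factorization.x⁰ F)))
        (1+nonneg≢0 (nat n ⊹ difference (≤c₁ d₈)))
      by-q₀ (+ 0) q₁ F = contradiction
        (solved (Factorization.x⁰ F) (solve 2 (λ c₁ c₈ → c₈ := (con 0ℤ :- c₁ :+ c₈) :+ c₁) c₁ c₈)) c₈≢c₁
      by-q₀ (+ suc (suc n)) q₁ F = contradiction (large-q₀ (nat n) F) ¬nonneg
      by-q₀ (+ 1) (+ 0) F = ≡.refl , inj₂ (inj₁ ≡.refl)
      by-q₀ (+ 1) (+ 1) F = contradiction F ω-absurd
      by-q₀ (+ 1) (+ 2) F = ≡.refl , inj₂ (inj₂ ≡.refl)
      by-q₀ (+ 1) (+ suc (suc (suc j))) F = contradiction F (large-q₁-absurd (nat j))
      by-q₀ (+ 1) -[1+ 0 ] F = ≡.refl , inj₁ ≡.refl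
      by-q₀ (+ 1) -[1+ suc j ] F = contradiction (negative-q₁ (nat j) F) ¬nonneg

open CofactorArithmetic using (Factorization; Digit; NonNegative; cofactor-cases; _,_)

-- Greedy expansions

toℚ-nonneg : ∀ {k} → 0ℤ ℤ.≤ k → 0ℚ ℚ.≤ toℚ k
toℚ-nonneg {+ zero}  _ = ℚ.≤-refl
toℚ-nonneg {+ suc n} _ = ℚ.<⇒≤ (toℚ-mono-< {0ℤ} {+ suc n} (ℤ.+<+ ℕ.z<s))

module FloorProperties (O : Ordered) where
  open Ordered O
  open OrderedProperties O
  open ℚ-Solver algebra

  ιᶻ : ℤ → Carrier
  ιᶻ k = ι (toℚ k)

  ιᶻ-sub : ∀ i j → ιᶻ (i ℤ.- j) ≈ ιᶻ i - ιᶻ j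
  ιᶻ-sub i j = trans (reflexive (cong ι (≡.trans (toℚ-+ i (ℤ.- j)) (cong (toℚ i ℚ.+_) (toℚ-neg j)))))
    (trans (+-homo (toℚ i) (ℚ.- toℚ j)) (+-congˡ (-‿homo (toℚ j))))

  ιᶻ-suc : ∀ k → ιᶻ (ℤ.suc k) ≈ ι 1ℚ + ιᶻ k
  ιᶻ-suc k = trans (reflexive (cong ι (toℚ-+ 1ℤ k))) (+-homo 1ℚ (toℚ k))

  floor-≤ : ∀ {x} k l → Pos (ιᶻ (ℤ.suc k) - x) → NonNeg (x - ιᶻ l) → l ℤ.≤ k
  floor-≤ {x} k l x<1+k l≤x = ℤ.≮⇒≥ λ k<l →
    pos+nonNeg≉0 x<1+k (nonNeg-+ l≤x (nonNeg-ι (toℚ-nonneg (ℤ.i≤j⇒0≤j-i (ℤ.i<j⇒suc[i]≤j k<l)))))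
      (trans (+-congˡ (+-congˡ (ιᶻ-sub l (ℤ.suc k))))
        (solve 3 (λ x k l → (k :- x) :+ ((x :- l) :+ (l :- k)) := con 0ℚ) x (ιᶻ (ℤ.suc k)) (ιᶻ l)))

  neg-sub : ∀ x y → - (x - y) ≈ y - x
  neg-sub = solve 2 (λ x y → :- (x :- y) := y :- x)

  remainder-≤1 : ∀ x k → Pos (ιᶻ (ℤ.suc k) - x) → NonNeg (ι 1ℚ - (x - ιᶻ k))
  remainder-≤1 x k x<1+k = pos⇒nonNeg (pos-resp (trans (+-congʳ (ιᶻ-suc k))
    (solve 2 (λ x k → (con 1ℚ :+ k) :- x := con 1ℚ :- (x :- k)) x (ιᶻ k))) x<1+k)

  digit-nonneg : ∀ β ρ k → NonNeg β → NonNeg ρ → Pos (ιᶻ (ℤ.suc k) - β * ρ) → 0ℤ ℤ.≤ k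
  digit-nonneg β ρ k 0≤β 0≤ρ βρ<1+k = floor-≤ k 0ℤ βρ<1+k
    (nonNeg-resp (trans (solve 1 (λ x → x := x :- con 0ℚ) (β * ρ)) (+-congˡ (-‿cong (sym 0#-homo))))
      (nonNeg-* 0≤β 0≤ρ))

  -- Remainders are at most 1, so β ρ ≤ β < 1 + c₁: the first digit is the largest.
  digit-≤ : ∀ β ρ c₁ k → NonNeg β → NonNeg (ι 1ℚ - ρ) → Pos (ιᶻ (ℤ.suc c₁) - β) → NonNeg (β * ρ - ιᶻ k) → k ℤ.≤ c₁
  digit-≤ β ρ c₁ k 0≤β ρ≤1 β<1+c₁ k≤βρ = floor-≤ c₁ k β<1+c₁
    (nonNeg-resp (solve 3 (λ β ρ k → (β :* ρ :- k) :+ β :* (con 1ℚ :- ρ) := β :- k) β ρ (ιᶻ k))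
      (nonNeg-+ k≤βρ (nonNeg-* 0≤β ρ≤1)))

  0<-from-1< : ∀ β → Pos (β - ι 1ℚ) → Pos β
  0<-from-1< β 1<β = pos-resp (solve 1 (λ β → (β :- con 1ℚ) :+ con 1ℚ := β) β)
    (pos-+ 1<β (pos-ι (ℚ.positive⁻¹ 1ℚ)))

  one-≤-floor : ∀ β c₁ → Pos (β - ι 1ℚ) → Pos (ιᶻ (ℤ.suc c₁) - β) → 1ℤ ℤ.≤ c₁
  one-≤-floor β c₁ 1<β β<1+c₁ = floor-≤ c₁ 1ℤ β<1+c₁ (pos⇒nonNeg 1<β)

  *-one : ∀ β → β * ι 1ℚ ≈ β
  *-one β = solve 1 (λ β → β :* con 1ℚ := β) β

  one-nonneg : NonNeg (ι 1ℚ)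
  one-nonneg = nonNeg-ι (ℚ.<⇒≤ (ℚ.positive⁻¹ 1ℚ))

  one-≤-one : NonNeg (ι 1ℚ - ι 1ℚ)
  one-≤-one = ≈0⇒nonNeg (-‿inverseʳ (ι 1ℚ))

  reciprocal-nonneg-absurd : ∀ {β} f → All (0ℚ ℚ.≤_) f → NonNeg β → ¬ (ev (1ℚ ∷ f) β ≈ 0#)
  reciprocal-nonneg-absurd f 0≤f 0≤β = pos+nonNeg≉0 (pos-ι (ℚ.positive⁻¹ 1ℚ)) (nonNeg-* 0≤β (nonNeg-ev 0≤f 0≤β))

module ℝF = FloorProperties ℝ-ordered

module Expansion (β : ℝ) (c : ℕ → ℤ) where

  ρ : ℕ → ℝ
  ρ zero    = 1ᵣ
  ρ (suc n) = β ⊗ ρ n ⊕ ⊖ fromℤ (c (suc n))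

  ρ≡remainder : ∀ n → ρ n ≡ remainder β c n
  β⊗ρ≡ : ∀ n → β ⊗ ρ n ≡ β *ᵣ remainder β c n
  ρ≡remainder zero    = ≡.refl
  ρ≡remainder (suc n) = ≡.trans (cong (λ x → x ⊕ ⊖ fromℤ (c (suc n))) (β⊗ρ≡ n))
    (⊕⊖≡-ᵣ (β *ᵣ remainder β c n) (fromℤ (c (suc n))))
  β⊗ρ≡ n = ≡.trans (cong (β ⊗_) (ρ≡remainder n)) (⊗≡*ᵣ β (remainder β c n))

  module _ (greedy : IsGreedyExpansion β c) where

    floor : ∀ n → IsFloor (β ⊗ ρ n) (c (suc n))
    floor n = ≡.subst (λ x → IsFloor x (c (suc n))) (≡.sym (β⊗ρ≡ n)) (greedy n)

    floor-upper : ∀ n → Positive (fromℤ (ℤ.suc (c (suc n))) ⊕ ⊖ (β ⊗ ρ n))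
    floor-upper n = <ᵣ⇒positive {β ⊗ ρ n} {fromℤ (ℤ.suc (c (suc n)))} (proj₂ (floor n))

    floor-lower : ∀ n → ℝO.NonNeg (β ⊗ ρ n ⊕ ⊖ fromℤ (c (suc n)))
    floor-lower n neg = proj₁ (floor n) (positive⇒<ᵣ {β ⊗ ρ n} {fromℤ (c (suc n))}
      (positive-resp (ℝF.neg-sub (β ⊗ ρ n) (fromℤ (c (suc n)))) neg))

    ρ-nonneg : ∀ n → ℝO.NonNeg (ρ n)
    ρ-nonneg zero    = ℝF.one-nonneg
    ρ-nonneg (suc n) = floor-lower n

    ρ-≤1 : ∀ n → ℝO.NonNeg (1ᵣ ⊕ ⊖ ρ n)
    ρ-≤1 zero    = ℝF.one-≤-one
    ρ-≤1 (suc n) = ℝF.remainder-≤1 (β ⊗ ρ n) (c (suc n)) (floor-upper n)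

    β<1+c₁ : Positive (fromℤ (ℤ.suc (c 1)) ⊕ ⊖ β)
    β<1+c₁ = positive-resp (ℝA.+-congˡ (ℝA.-‿cong (ℝF.*-one β))) (floor-upper 0)

    module _ (1<β : Positive (β ⊕ ⊖ 1ᵣ)) where
      0≤β : ℝO.NonNeg β
      0≤β = ℝO.pos⇒nonNeg (ℝF.0<-from-1< β 1<β)

      digit : ∀ n → Digit (c 1) (c (suc n))
      digit n = ℝF.digit-nonneg β (ρ n) (c (suc n)) 0≤β (ρ-nonneg n) (floor-upper n)
              , ℝF.digit-≤ β (ρ n) (c 1) (c (suc n)) 0≤β (ρ-≤1 n) β<1+c₁ (floor-lower n)

      1≤c₁ : 1ℤ ℤ.≤ c 1
      1≤c₁ = ℝF.one-≤-floor β (c 1) 1<β β<1+c₁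

-- Equal remainders have equal floors, and equal digits give equal next remainders. The index starts
-- at 1 because the value at 0 is unconstrained.
expansion-unique : ∀ {β c c′} → IsGreedyExpansion β c → IsGreedyExpansion β c′ → ∀ n → c (suc n) ≡ c′ (suc n)
expansion-unique {β} {c} {c′} g g′ = digits
  where
  same-remainder : ∀ n → Expansion.ρ β c n ≋ Expansion.ρ β c′ n
  digits : ∀ n → c (suc n) ≡ c′ (suc n)
  same-remainder zero    = ℝA.refl
  same-remainder (suc n) = ℝA.+-cong (ℝA.*-congˡ (same-remainder n))
    (ℝA.-‿cong (ℝA.reflexive (cong fromℤ (digits n))))
  digits n = ℤ.≤-antisym
    (ℝF.floor-≤ (c′ (suc n)) (c (suc n)) (Expansion.floor-upper β c′ g′ n)
      (ℝO.nonNeg-resp (ℝA.+-congʳ (ℝA.*-congˡ (same-remainder n))) (Expansion.floor-lower β c g n)))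
    (ℝF.floor-≤ (c (suc n)) (c′ (suc n)) (Expansion.floor-upper β c g n)
      (ℝO.nonNeg-resp (ℝA.+-congʳ (ℝA.*-congˡ (ℝA.sym (same-remainder n)))) (Expansion.floor-lower β c′ g′ n)))

periodic-cong : ∀ {c c′ m p} → (∀ n → c (suc n) ≡ c′ (suc n)) → IsPeriodic c m p → IsPeriodic c′ m p
periodic-cong {c} {c′} {m} {p} c≡c′ (1≤p , period) = 1≤p , λ { (suc n) 1≤n →
  ≡.trans (≡.sym (c≡c′ (n ℕ.+ m))) (≡.trans (period (suc n) 1≤n) (c≡c′ (n ℕ.+ m ℕ.+ p))) }

-- `C[_]` and `P[_,_]` each quantify over an expansion and its lengths; minimality in both
-- coordinates identifies them, so that the cofactor is one of the companion polynomial with m = 1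
-- and p = 7.
parry-unique : ∀ {β c c′ m m′ p p′} → IsParryExpansion β c m p → IsParryExpansion β c′ m′ p′ →
  (∀ n → c (suc n) ≡ c′ (suc n)) × m ≡ m′ × p ≡ p′
parry-unique {β} {c} {c′} {m} {m′} {p} {p′} (greedy , _ , periodic , least) (greedy′ , _ , periodic′ , least′) =
  same , ℕ.≤-antisym (proj₁ smaller) (proj₁ larger) , ℕ.≤-antisym (proj₂ smaller) (proj₂ larger)
  where
  same = expansion-unique {β} {c} {c′} greedy greedy′
  smaller = least m′ p′ (periodic-cong {c′} {c} (λ n → ≡.sym (same n)) periodic′)
  larger = least′ m p (periodic-cong {c} {c′} same periodic)

-- Classification of the cofactors

coeff-*ₚ-zero : ∀ a F G → coeffℤ ((a ∷ F) *ₚ G) 0 ≡ a ℤ.* coeffℤ G 0 ℤ.+ 0ℤ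
coeff-*ₚ-zero a F G = ≡.trans (coeff-+ₚ (map (a ℤ.*_) G) (0ℤ ∷ F *ₚ G) 0) (cong (ℤ._+ 0ℤ) (coeff-scaleₚ a G 0))

coeff-*ₚ-suc : ∀ a F G k → coeffℤ ((a ∷ F) *ₚ G) (suc k) ≡ a ℤ.* coeffℤ G (suc k) ℤ.+ coeffℤ (F *ₚ G) k
coeff-*ₚ-suc a F G k = ≡.trans (coeff-+ₚ (map (a ℤ.*_) G) (0ℤ ∷ F *ₚ G) (suc k))
  (cong (ℤ._+ coeffℤ (F *ₚ G) k) (coeff-scaleₚ a G (suc k)))

zero-*ₚ : ∀ F G → (∀ k → coeffℤ F k ≡ 0ℤ) → ∀ k → coeffℤ (F *ₚ G) k ≡ 0ℤ
zero-*ₚ []      G F≡0 k       = ≡.refl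
zero-*ₚ (a ∷ F) G F≡0 zero    = ≡.trans (coeff-*ₚ-zero a F G)
  (cong (λ z → z ℤ.* coeffℤ G 0 ℤ.+ 0ℤ) (F≡0 0))
zero-*ₚ (a ∷ F) G F≡0 (suc k) = ≡.trans (coeff-*ₚ-suc a F G k)
  (cong₂ (λ z w → z ℤ.* coeffℤ G (suc k) ℤ.+ w) (F≡0 0) (zero-*ₚ F G (λ k → F≡0 (suc k)) k))

*ₚ-congˡ : ∀ F F′ G → F ≈ₚ F′ → F *ₚ G ≈ₚ F′ *ₚ G
*ₚ-congˡ []      F′       G F≈ k       = ≡.sym (zero-*ₚ F′ G (λ k → ≡.sym (F≈ k)) k)
*ₚ-congˡ (a ∷ F) []       G F≈ k       = zero-*ₚ (a ∷ F) G F≈ k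
*ₚ-congˡ (a ∷ F) (b ∷ F′) G F≈ zero    = ≡.trans (coeff-*ₚ-zero a F G)
  (≡.trans (cong (λ z → z ℤ.* coeffℤ G 0 ℤ.+ 0ℤ) (F≈ 0)) (≡.sym (coeff-*ₚ-zero b F′ G)))
*ₚ-congˡ (a ∷ F) (b ∷ F′) G F≈ (suc k) = ≡.trans (coeff-*ₚ-suc a F G k)
  (≡.trans (cong₂ (λ z w → z ℤ.* coeffℤ G (suc k) ℤ.+ w) (F≈ 0) (*ₚ-congˡ F F′ G (λ k → F≈ (suc k)) k))
    (≡.sym (coeff-*ₚ-suc b F′ G k)))

*ₚ-congʳ : ∀ F G G′ → G ≈ₚ G′ → F *ₚ G ≈ₚ F *ₚ G′
*ₚ-congʳ []      G G′ G≈ k       = ≡.refl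
*ₚ-congʳ (a ∷ F) G G′ G≈ zero    = ≡.trans (coeff-*ₚ-zero a F G)
  (≡.trans (cong (λ z → a ℤ.* z ℤ.+ 0ℤ) (G≈ 0)) (≡.sym (coeff-*ₚ-zero a F G′)))
*ₚ-congʳ (a ∷ F) G G′ G≈ (suc k) = ≡.trans (coeff-*ₚ-suc a F G k)
  (≡.trans (cong₂ (λ z w → a ℤ.* z ℤ.+ w) (G≈ (suc k)) (*ₚ-congʳ F G G′ G≈ k)) (≡.sym (coeff-*ₚ-suc a F G′ k)))

coeff-one-*ₚ : ∀ G k → coeffℤ ((1ℤ ∷ []) *ₚ G) k ≡ coeffℤ G k
coeff-one-*ₚ G zero    = ≡.trans (coeff-*ₚ-zero 1ℤ [] G) (≡.trans (ℤ.+-identityʳ _) (ℤ.*-identityˡ (coeffℤ G 0)))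
coeff-one-*ₚ G (suc k) = ≡.trans (coeff-*ₚ-suc 1ℤ [] G k) (≡.trans (ℤ.+-identityʳ _) (ℤ.*-identityˡ (coeffℤ G (suc k))))

coeff-leading : ∀ a b c Q k → (∀ i → k ℕ.< i → coeffℤ Q i ≡ 0ℤ) →
  coeffℤ (Reciprocal₆ a b c *ₚ Q) (6 ℕ.+ k) ≡ coeffℤ Q k
coeff-leading a b c Q k high =
  drop 1ℤ (a ∷ b ∷ c ∷ b ∷ a ∷ 1ℤ ∷ []) 5 (drop a (b ∷ c ∷ b ∷ a ∷ 1ℤ ∷ []) 4 (drop b (c ∷ b ∷ a ∷ 1ℤ ∷ []) 3
    (drop c (b ∷ a ∷ 1ℤ ∷ []) 2 (drop b (a ∷ 1ℤ ∷ []) 1 (drop a (1ℤ ∷ []) 0 (coeff-one-*ₚ Q k))))))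
  where
  drop : ∀ a F j → coeffℤ (F *ₚ Q) (j ℕ.+ k) ≡ coeffℤ Q k → coeffℤ ((a ∷ F) *ₚ Q) (suc (j ℕ.+ k)) ≡ coeffℤ Q k
  drop a F j eq = ≡.trans (coeff-*ₚ-suc a F Q (j ℕ.+ k))
    (≡.trans (cong₂ (λ z w → a ℤ.* z ℤ.+ w) (high (suc (j ℕ.+ k)) (s≤s (ℕ.m≤n+m k j))) eq)
      (≡.trans (cong (ℤ._+ coeffℤ Q k) (ℤ.*-zeroʳ a)) (ℤ.+-identityˡ (coeffℤ Q k))))

module _ {a b c Q R} (R≈PQ : R ≈ₚ Reciprocal₆ a b c *ₚ Q)
  (R-high : ∀ k → 8 ℕ.< k → coeffℤ R k ≡ 0ℤ) (R-lead : coeffℤ R 8 ≡ 1ℤ) where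

  -- `Q` is a list of unknown length. The induction descends from its end: once everything above x^k
  -- vanishes, coefficient k of `Q` is coefficient 6 + k of the companion polynomial.
  cofactor-high : ∀ k → 2 ℕ.< k → coeffℤ Q k ≡ 0ℤ
  cofactor-high k 2<k = go (length Q) k 2<k (ℕ.m≤n+m (length Q) k)
    where
    go : ∀ d k → 2 ℕ.< k → length Q ℕ.≤ k ℕ.+ d → coeffℤ Q k ≡ 0ℤ
    go zero    k 2<k |Q|≤ = coeff-beyond Q k (≡.subst (length Q ℕ.≤_) (ℕ.+-identityʳ k) |Q|≤)
    go (suc d) k 2<k |Q|≤ = ≡.trans (≡.sym (coeff-leading a b c Q k λ i k<i →
        go d i (ℕ.<-trans 2<k k<i) (ℕ.≤-trans |Q|≤ (ℕ.≤-trans (ℕ.≤-reflexive (ℕ.+-suc k d)) (ℕ.+-monoˡ-≤ d k<i)))))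
      (≡.trans (≡.sym (R≈PQ (6 ℕ.+ k))) (R-high (6 ℕ.+ k) (ℕ.+-monoʳ-< 6 2<k)))

  cofactor-≈ : Q ≈ₚ (coeffℤ Q 0 ∷ coeffℤ Q 1 ∷ 1ℤ ∷ [])
  cofactor-≈ 0 = ≡.refl
  cofactor-≈ 1 = ≡.refl
  cofactor-≈ 2 = ≡.trans (≡.sym (coeff-leading a b c Q 2 (λ i 2<i → cofactor-high i 2<i))) (≡.trans (≡.sym (R≈PQ 8)) R-lead)
  cofactor-≈ (suc (suc (suc k))) = cofactor-high (3 ℕ.+ k) (s≤s (s≤s (s≤s z≤n)))

-- Coefficient i of the hypothesis is the equation of x^i, the solver terms spelling out what `_*ₚ_`
-- and `companion` compute. Subtracting P₁ = x - c₁ turns c₇ and c₈ into c₇ + 1 and c₈ - c₁.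
factorization : ∀ {a b c q₀ q₁} (d : ℕ → ℤ) →
  companion d 1 7 ≈ₚ Reciprocal₆ a b c *ₚ (q₀ ∷ q₁ ∷ 1ℤ ∷ []) →
  Factorization a b c q₀ q₁ (d 1) (d 2) (d 3) (d 4) (d 5) (d 6) (d 7) (d 8)
factorization {a} {b} {c} {q₀} {q₁} d R≈PQ = record
  { x⁷ = by (R≈PQ 7) (solve 3 (λ a q₁ d → a :+ q₁ :+ d := (a :* one :+ one :* q₁) :- (:- d)) a q₁ (d 1))
  ; x⁶ = by (R≈PQ 6) (solve 5 (λ a b q₀ q₁ d → b :+ a :* q₁ :+ q₀ :+ d
      := (b :* one :+ (a :* q₁ :+ (one :* q₀ :+ con 0ℤ))) :- (:- d)) a b q₀ q₁ (d 2))
  ; x⁵ = by (R≈PQ 5) (solve 6 (λ a b c q₀ q₁ d → c :+ b :* q₁ :+ a :* q₀ :+ d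
      := (c :* one :+ (b :* q₁ :+ (a :* q₀ :+ con 0ℤ))) :- (:- d)) a b c q₀ q₁ (d 3))
  ; x⁴ = by (R≈PQ 4) (solve 5 (λ b c q₀ q₁ d → b :+ c :* q₁ :+ b :* q₀ :+ d
      := (b :* one :+ (c :* q₁ :+ (b :* q₀ :+ con 0ℤ))) :- (:- d)) b c q₀ q₁ (d 4))
  ; x³ = by (R≈PQ 3) (solve 6 (λ a b c q₀ q₁ d → a :+ b :* q₁ :+ c :* q₀ :+ d
      := (a :* one :+ (b :* q₁ :+ (c :* q₀ :+ con 0ℤ))) :- (:- d)) a b c q₀ q₁ (d 5))
  ; x² = by (R≈PQ 2) (solve 5 (λ a b q₀ q₁ d → one :+ a :* q₁ :+ b :* q₀ :+ d
      := (one :* one :+ (a :* q₁ :+ (b :* q₀ :+ con 0ℤ))) :- (:- d)) a b q₀ q₁ (d 6))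
  ; x¹ = by (R≈PQ 1) (solve 4 (λ a q₀ q₁ d → q₁ :+ a :* q₀ :+ d :+ one
      := (one :* q₁ :+ (a :* q₀ :+ con 0ℤ)) :- (:- d :+ con -1ℤ)) a q₀ q₁ (d 7))
  ; x⁰ = by (R≈PQ 0) (solve 3 (λ q₀ c₁ d → q₀ :- c₁ :+ d := (one :* q₀ :+ con 0ℤ) :- (:- d :+ :- (:- c₁))) q₀ (d 1) (d 8))
  }
  where
  open ℤ-Solver
  one : ∀ {n} → Expr ℤ n
  one = con 1ℤ

  by : ∀ {i j e} → i ≡ j → e ≡ j ℤ.- i → e ≡ 0ℤ
  by {i} ≡.refl eq = ≡.trans eq (ℤ.+-inverseʳ i)

expansionPoly-cong : ∀ {c c′} → (∀ n → c (suc n) ≡ c′ (suc n)) → ∀ k → expansionPoly c k ≡ expansionPoly c′ k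
expansionPoly-cong c≡c′ zero    = ≡.refl
expansionPoly-cong c≡c′ (suc k) = cong₂ (λ z F → ℤ.- z ∷ F) (c≡c′ k) (expansionPoly-cong c≡c′ k)

companion-cong : ∀ {c c′} → (∀ n → c (suc n) ≡ c′ (suc n)) → ∀ m p → companion c m p ≡ companion c′ m p
companion-cong c≡c′ m p = cong₂ _-ₚ_ (expansionPoly-cong c≡c′ (m ℕ.+ p)) (expansionPoly-cong c≡c′ m)

Cofactors : ℤ[x] → Set
Cofactors = (_≈ₚ (1ℤ ∷ -1ℤ ∷ 1ℤ ∷ [])) ∪ (_≈ₚ (1ℤ ∷ 0ℤ ∷ 1ℤ ∷ [])) ∪ (_≈ₚ (1ℤ ∷ + 2 ∷ 1ℤ ∷ []))

module _ {β : ℝ} {P Q : ℤ[x]} {c : ℕ → ℤ} {α : ℂ} (1<β : 1ᵣ <ᵣ β) (minP : IsMinPoly β P) (degP : HasDegreeℤ P 6)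
  (parry : IsParryExpansion β c 1 7) (R≈PQ : companion c 1 7 ≈ₚ P *ₚ Q)
  (conjugate : IsOtherConjugate β α) (unit : ∣ α ∣² ≈ᵣ 1ᵣ) where

  private
    0<β-1 : Positive (β ⊕ ⊖ 1ᵣ)
    0<β-1 = <ᵣ⇒positive {1ᵣ} {β} 1<β

    P[α]≈0 : ℂᶻ.evᶻ P α ≋ᶜ ofℝ 0ᵣ
    P[α]≈0 = go (proj₂ conjugate)
      where
      go : ∃[ P′ ] (IsMinPoly β P′ × evalℂ P′ α ≈ᶜ ofℝ 0ᵣ) → ℂᶻ.evᶻ P α ≋ᶜ ofℝ 0ᵣ
      go (P′ , minP′ , root) = ℂA.trans (ℂᶻ.evᶻ-cong P P′ α (minPoly-unique {β} {P} {P′} minP degP minP′))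
        (rootℂ⇒ {P′} {α} root)

    unit′ : re α ⊗ re α ⊕ im α ⊗ im α ≋ 1ᵣ
    unit′ = ≡.subst (_≋ 1ᵣ) (≡.sym (∣∣²≡ α)) (≈ᵣ⇒≋ {∣ α ∣²} {1ᵣ} unit)

    palindrome : ∃[ p ] ∃[ q ] ∃[ r ] (P ≈ₚ Reciprocal₆ p q r)
    palindrome = reciprocal {β} {α} {P} minP degP (ℝO.pos⇒≉0 0<β-1) P[α]≈0 unit′

    no-nonneg : ∀ {p q r} → P ≈ₚ Reciprocal₆ p q r → ¬ NonNegative p q r
    no-nonneg {p} {q} {r} P≈ (0≤p , 0≤q , 0≤r) = ℝF.reciprocal-nonneg-absurd
      (map toℚ (p ∷ q ∷ r ∷ q ∷ p ∷ 1ℤ ∷ []))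
      (toℚ-nonneg 0≤p ∷ toℚ-nonneg 0≤q ∷ toℚ-nonneg 0≤r ∷ toℚ-nonneg 0≤q ∷ toℚ-nonneg 0≤p ∷ ℚ.<⇒≤ (ℚ.positive⁻¹ 1ℚ) ∷ [])
      (Expansion.0≤β β c (proj₁ parry) 0<β-1)
      (ℝA.trans (ℝA.reflexive (≡.sym (ℝᶻ.evᶻ≡ev (Reciprocal₆ p q r) β)))
        (ℝA.trans (ℝA.sym (ℝᶻ.evᶻ-cong P (Reciprocal₆ p q r) β P≈)) (rootℤ⇒ {P} {β} (proj₁ (proj₂ minP)))))

    digit : ∀ n → Digit (c 1) (c (suc n))
    digit = Expansion.digit β c (proj₁ parry) 0<β-1

    -- Otherwise the expansion would be purely periodic.
    c₈≢c₁ : ¬ (c 8 ≡ c 1)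
    c₈≢c₁ c₈≡c₁ = ℕ.1+n≰n (proj₁ (proj₂ (proj₂ (proj₂ parry)) 0 7 (s≤s z≤n , period)))
      where
      period : ∀ n → 1 ℕ.≤ n → c (n ℕ.+ 0) ≡ c (n ℕ.+ 0 ℕ.+ 7)
      period 1 _ = ≡.sym c₈≡c₁
      period (suc (suc n)) _ = ≡.subst (λ k → c k ≡ c (k ℕ.+ 7))
        (≡.trans (ℕ.+-comm (suc n) 1) (≡.sym (ℕ.+-identityʳ (suc (suc n)))))
        (proj₂ (proj₁ (proj₂ (proj₂ parry))) (suc n) (s≤s z≤n))

  classify : Cofactors Q
  classify = go palindrome
    where
    go : ∃[ p ] ∃[ q ] ∃[ r ] (P ≈ₚ Reciprocal₆ p q r) → Cofactors Q
    go (p , q , r , P≈) = conclude (cofactor-cases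
        (ℤ.i≤j⇒0≤j-i (Expansion.1≤c₁ β c (proj₁ parry) 0<β-1))
        (digit 1) (digit 2) (digit 3) (digit 4) (digit 5) (digit 6) (digit 7)
        c₈≢c₁ (no-nonneg P≈) (factorization c R≈P′Q′))
      where
      R≈P′Q : companion c 1 7 ≈ₚ Reciprocal₆ p q r *ₚ Q
      R≈P′Q k = ≡.trans (R≈PQ k) (*ₚ-congˡ P (Reciprocal₆ p q r) Q P≈ k)

      Q≈ : Q ≈ₚ (coeffℤ Q 0 ∷ coeffℤ Q 1 ∷ 1ℤ ∷ [])
      Q≈ = cofactor-≈ {p} {q} {r} {Q} {companion c 1 7} R≈P′Q (coeff-beyond (companion c 1 7)) ≡.refl

      R≈P′Q′ : companion c 1 7 ≈ₚ Reciprocal₆ p q r *ₚ (coeffℤ Q 0 ∷ coeffℤ Q 1 ∷ 1ℤ ∷ [])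
      R≈P′Q′ k = ≡.trans (R≈P′Q k) (*ₚ-congʳ (Reciprocal₆ p q r) Q (coeffℤ Q 0 ∷ coeffℤ Q 1 ∷ 1ℤ ∷ []) Q≈ k)

      with-q₁ : ∀ {q₁} → coeffℤ Q 0 ≡ 1ℤ → coeffℤ Q 1 ≡ q₁ → Q ≈ₚ (1ℤ ∷ q₁ ∷ 1ℤ ∷ [])
      with-q₁ q₀≡ q₁≡ = ≡.subst₂ (λ s t → Q ≈ₚ (s ∷ t ∷ 1ℤ ∷ [])) q₀≡ q₁≡ Q≈

      conclude : coeffℤ Q 0 ≡ 1ℤ × (coeffℤ Q 1 ≡ -1ℤ ⊎ coeffℤ Q 1 ≡ 0ℤ ⊎ coeffℤ Q 1 ≡ + 2) → Cofactors Q
      conclude (q₀≡1 , q₁≡) = Sum.map (with-q₁ q₀≡1) (Sum.map (with-q₁ q₀≡1) (with-q₁ q₀≡1)) q₁≡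

cofactor⊆ : Λ 6 1 7 ⊆ Cofactors
cofactor⊆ {Q} (β , (_ , P₆ , minP₆ , degP₆) , (_ , c , parry) ,
    (_ , 1<β , _ , α , conjugate , unit) , c′ , m′ , p′ , parry′ , P , minP , R≈PQ) =
  go (parry-unique {β} {c} {c′} parry parry′)
  where
  P≈ : P₆ ≈ₚ P
  P≈ = minPoly-unique {β} {P₆} {P} minP₆ degP₆ minP

  degP : HasDegreeℤ P 6
  degP = (λ eq → proj₁ degP₆ (≡.trans (P≈ 6) eq)) , λ k 6<k → ≡.trans (≡.sym (P≈ k)) (proj₂ degP₆ k 6<k)

  go : (∀ n → c (suc n) ≡ c′ (suc n)) × 1 ≡ m′ × 7 ≡ p′ → Cofactors Q
  go (c≡c′ , 1≡m′ , 7≡p′) = classify {β} {P} {Q} {c} {α} 1<β minP degP parry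
    (≡.subst (λ R → R ≈ₚ P *ₚ Q) (≡.trans (cong₂ (companion c′) (≡.sym 1≡m′) (≡.sym 7≡p′)) (≡.sym (companion-cong {c} {c′} c≡c′ 1 7))) R≈PQ)
    conjugate unit

-- Cubics without rational roots, periodic words

Even Odd : ℤ → Set
Even i = ∃[ k ] (i ≡ + 2 ℤ.* k)
Odd  i = ∃[ k ] (i ≡ 1ℤ ℤ.+ + 2 ℤ.* k)

parity : ∀ i → Even i ⊎ Odd i
parity i = go (i %ℕ 2) (n%ℕd<d i 2) (a≡a%ℕn+[a/ℕn]*n i 2)
  where
  k = i /ℕ 2
  go : ∀ m → m ℕ.< 2 → i ≡ + m ℤ.+ k ℤ.* + 2 → Even i ⊎ Odd i
  go 0 _ eq = inj₁ (k , ≡.trans eq (≡.trans (ℤ.+-identityˡ (k ℤ.* + 2)) (ℤ.*-comm k (+ 2))))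
  go 1 _ eq = inj₂ (k , ≡.trans eq (cong (λ z → 1ℤ ℤ.+ z) (ℤ.*-comm k (+ 2))))
  go (suc (suc _)) (s≤s (s≤s ())) _

odd≢0 : ∀ k → ¬ (1ℤ ℤ.+ + 2 ℤ.* k ≡ 0ℤ)
odd≢0 k eq = double≢1 ℤ.∣ k ∣ (≡.trans (≡.sym (ℤ.abs-* (+ 2) k)) (cong ℤ.∣_∣ 2k≡-1))
  where
  open ℤ-Solver
  2k≡-1 : + 2 ℤ.* k ≡ -1ℤ
  2k≡-1 = ≡.trans (solve 1 (λ k → con (+ 2) :* k := (con 1ℤ :+ con (+ 2) :* k) :- con 1ℤ) k) (cong (ℤ._- 1ℤ) eq)

  double≢1 : ∀ n → ¬ (2 ℕ.* n ≡ 1)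
  double≢1 (suc n) eq = ℕ.1+n≢0 (≡.trans (≡.sym (ℕ.+-suc n (n ℕ.+ 0))) (ℕ.suc-injective eq))

even-abs : ∀ {i} → Even i → 2 ∣ ℤ.∣ i ∣
even-abs (k , ≡.refl) = divides ℤ.∣ k ∣ (≡.trans (ℤ.abs-* (+ 2) k) (ℕ.*-comm 2 ℤ.∣ k ∣))

-- Modulo 2 the cubic takes the value 1 at both 0 and 1, so its homogeneous form is odd unless n and
-- d are both even. The argument of `odd≢0` is half of the form minus 1.
cubic-form≢0 : ∀ a q r n d → Odd r → Odd (a ℤ.+ q) → ¬ (Even n × Even d) →
  ¬ (r ℤ.* (d ℤ.* d ℤ.* d) ℤ.+ n ℤ.* (q ℤ.* (d ℤ.* d) ℤ.+ n ℤ.* (a ℤ.* d ℤ.+ n)) ≡ 0ℤ)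
cubic-form≢0 a q _ n d (r , ≡.refl) (s , a+q≡) ¬even root = by-parity (parity n) (parity d)
  where
  open ℤ-Solver
  by-parity : Even n ⊎ Odd n → Even d ⊎ Odd d → ⊥
  by-parity (inj₁ n-even) (inj₁ d-even) = ¬even (n-even , d-even)
  by-parity (inj₁ (k , ≡.refl)) (inj₂ (l , ≡.refl)) = odd≢0
    (r ℤ.* (d ℤ.* d ℤ.* d) ℤ.+ (l ℤ.* (1ℤ ℤ.+ d ℤ.+ d ℤ.* d)) ℤ.+ k ℤ.* (q ℤ.* (d ℤ.* d) ℤ.+ n ℤ.* (a ℤ.* d ℤ.+ n)))
    (≡.trans (solve 5 (λ a q r k l → let n = con (+ 2) :* k ; d = con 1ℤ :+ con (+ 2) :* l in
      con 1ℤ :+ con (+ 2) :* (r :* (d :* d :* d) :+ (l :* (con 1ℤ :+ d :+ d :* d)) :+ k :* (q :* (d :* d) :+ n :* (a :* d :+ n)))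
      := (con 1ℤ :+ con (+ 2) :* r) :* (d :* d :* d) :+ n :* (q :* (d :* d) :+ n :* (a :* d :+ n))) a q r k l) root)
  by-parity (inj₂ (k , ≡.refl)) (inj₁ (l , ≡.refl)) = odd≢0
    ((1ℤ ℤ.+ + 2 ℤ.* r) ℤ.* (l ℤ.* d ℤ.* d) ℤ.+ n ℤ.* (q ℤ.* (l ℤ.* d) ℤ.+ n ℤ.* (a ℤ.* l)) ℤ.+ k ℤ.* (1ℤ ℤ.+ n ℤ.+ n ℤ.* n))
    (≡.trans (solve 5 (λ a q r k l → let n = con 1ℤ :+ con (+ 2) :* k ; d = con (+ 2) :* l in
      con 1ℤ :+ con (+ 2) :* ((con 1ℤ :+ con (+ 2) :* r) :* (l :* d :* d) :+ n :* (q :* (l :* d) :+ n :* (a :* l)) :+ k :* (con 1ℤ :+ n :+ n :* n))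
      := (con 1ℤ :+ con (+ 2) :* r) :* (d :* d :* d) :+ n :* (q :* (d :* d) :+ n :* (a :* d :+ n))) a q r k l) root)
  by-parity (inj₂ (k , ≡.refl)) (inj₂ (l , ≡.refl)) = odd≢0
    (r ℤ.* (d ℤ.* d ℤ.* d) ℤ.+ l ℤ.* (1ℤ ℤ.+ d ℤ.+ d ℤ.* d) ℤ.+ s ℤ.* (n ℤ.* d ℤ.* d) ℤ.+ a ℤ.* n ℤ.* d ℤ.* (k ℤ.- l)
      ℤ.+ k ℤ.* (1ℤ ℤ.+ n ℤ.+ n ℤ.* n) ℤ.+ (k ℤ.* d ℤ.* d ℤ.+ l ℤ.* (1ℤ ℤ.+ d) ℤ.+ 1ℤ))
    (≡.trans (solve 5 (λ a r s k l → let n = con 1ℤ :+ con (+ 2) :* k ; d = con 1ℤ :+ con (+ 2) :* l ; q = (con 1ℤ :+ con (+ 2) :* s) :- a in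
      con 1ℤ :+ con (+ 2) :* (r :* (d :* d :* d) :+ l :* (con 1ℤ :+ d :+ d :* d) :+ s :* (n :* d :* d) :+ a :* n :* d :* (k :- l)
        :+ k :* (con 1ℤ :+ n :+ n :* n) :+ (k :* d :* d :+ l :* (con 1ℤ :+ d) :+ con 1ℤ))
      := (con 1ℤ :+ con (+ 2) :* r) :* (d :* d :* d) :+ n :* (q :* (d :* d) :+ n :* (a :* d :+ n))) a r s k l)
      (≡.trans (cong (λ q → (1ℤ ℤ.+ + 2 ℤ.* r) ℤ.* (d ℤ.* d ℤ.* d) ℤ.+ n ℤ.* (q ℤ.* (d ℤ.* d) ℤ.+ n ℤ.* (a ℤ.* d ℤ.+ n))) q≡) root))
    where
    q≡ : (1ℤ ℤ.+ + 2 ℤ.* s) ℤ.- a ≡ q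
    q≡ = ≡.trans (cong (ℤ._- a) (≡.sym a+q≡)) (solve 2 (λ a q → (a :+ q) :- a := q) a q)

↧*p≡↥ : ∀ p → toℚ (ℚ.↧ p) ℚ.* p ≡ toℚ (ℚ.↥ p)
↧*p≡↥ p@(mkℚ n d-1 _) = ℚ.toℚᵘ-injective (begin
  toℚᵘ (toℚ (+ suc d-1) ℚ.* p)            ≈⟨ ℚ.toℚᵘ-homo-* (toℚ (+ suc d-1)) p ⟩
  toℚᵘ (toℚ (+ suc d-1)) ℚᵘ.* toℚᵘ p      ≈⟨ ℚᵘ.*-congʳ (toℚᵘ-toℚ (+ suc d-1)) ⟩
  mkℚᵘ (+ suc d-1) 0 ℚᵘ.* mkℚᵘ n d-1      ≈⟨ *≡* (≡.trans (ℤ.*-identityʳ _) (≡.trans (ℤ.*-comm (+ suc d-1) n)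
                                               (cong (λ k → n ℤ.* (+ suc k)) (≡.sym (ℕ.+-identityʳ d-1))))) ⟩
  mkℚᵘ n 0                                ≈⟨ toℚᵘ-toℚ n ⟨
  toℚᵘ (toℚ n)                            ∎)
  where open ℚᵘ.≃-Reasoning

¬both-even : ∀ p → ¬ (Even (ℚ.↥ p) × Even (ℚ.↧ p))
¬both-even (mkℚ n d-1 coprime) (n-even , d-even) =
  contradiction (Coprimality.recompute coprime (even-abs n-even , even-abs d-even)) λ ()

no-rational-root : ∀ a q r → Odd r → Odd (a ℤ.+ q) → ∀ t → evalᵠ (toℚ r ∷ toℚ q ∷ toℚ a ∷ 1ℚ ∷ []) t ≢ 0ℚ
no-rational-root a q r r-odd a+q-odd t root =
  cubic-form≢0 a q r n d r-odd a+q-odd (¬both-even t) (toℚ-injective (begin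
    toℚ (r ℤ.* (d ℤ.* d ℤ.* d) ℤ.+ n ℤ.* (q ℤ.* (d ℤ.* d) ℤ.+ n ℤ.* (a ℤ.* d ℤ.+ n)))
      ≡⟨ push-+ (r ℤ.* (d ℤ.* d ℤ.* d)) (n ℤ.* (q ℤ.* (d ℤ.* d) ℤ.+ n ℤ.* (a ℤ.* d ℤ.+ n)))
           (push-* r (d ℤ.* d ℤ.* d) ≡.refl (push-* (d ℤ.* d) d (toℚ-* d d) ≡.refl))
           (push-* n (q ℤ.* (d ℤ.* d) ℤ.+ n ℤ.* (a ℤ.* d ℤ.+ n)) ≡.refl
             (push-+ (q ℤ.* (d ℤ.* d)) (n ℤ.* (a ℤ.* d ℤ.+ n)) (push-* q (d ℤ.* d) ≡.refl (toℚ-* d d))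
               (push-* n (a ℤ.* d ℤ.+ n) ≡.refl (push-+ (a ℤ.* d) n (toℚ-* a d) ≡.refl)))) ⟩
    toℚ r ℚ.* (D ℚ.* D ℚ.* D) ℚ.+ N ℚ.* (toℚ q ℚ.* (D ℚ.* D) ℚ.+ N ℚ.* (toℚ a ℚ.* D ℚ.+ N))
      ≡⟨ cong (λ N → toℚ r ℚ.* (D ℚ.* D ℚ.* D) ℚ.+ N ℚ.* (toℚ q ℚ.* (D ℚ.* D) ℚ.+ N ℚ.* (toℚ a ℚ.* D ℚ.+ N))) (↧*p≡↥ t) ⟨
    toℚ r ℚ.* (D ℚ.* D ℚ.* D) ℚ.+ (D ℚ.* t) ℚ.* (toℚ q ℚ.* (D ℚ.* D) ℚ.+ (D ℚ.* t) ℚ.* (toℚ a ℚ.* D ℚ.+ (D ℚ.* t)))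
      ≡⟨ solve 5 (λ r q a D t → r :* (D :* D :* D) :+ (D :* t) :* (q :* (D :* D) :+ (D :* t) :* (a :* D :+ (D :* t)))
           := (D :* D :* D) :* (r :+ t :* (q :+ t :* (a :+ t :* (con 1ℚ :+ t :* con 0ℚ))))) (toℚ r) (toℚ q) (toℚ a) D t ⟩
    (D ℚ.* D ℚ.* D) ℚ.* evalᵠ (toℚ r ∷ toℚ q ∷ toℚ a ∷ 1ℚ ∷ []) t
      ≡⟨ ≡.trans (cong ((D ℚ.* D ℚ.* D) ℚ.*_) root) (ℚ.*-zeroʳ (D ℚ.* D ℚ.* D)) ⟩
    0ℚ ∎))
  where
  open ≡-Reasoning
  open ℚ-Solver₀
  n = ℚ.↥ t
  d = ℚ.↧ t
  N = toℚ n
  D = toℚ d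

  push-+ : ∀ i j {p s} → toℚ i ≡ p → toℚ j ≡ s → toℚ (i ℤ.+ j) ≡ p ℚ.+ s
  push-+ i j ≡.refl ≡.refl = toℚ-+ i j

  push-* : ∀ i j {p s} → toℚ i ≡ p → toℚ j ≡ s → toℚ (i ℤ.* j) ≡ p ℚ.* s
  push-* i j ≡.refl ≡.refl = toℚ-* i j

-- The sequence c₁ w₀ w₁ … w₆ w₀ w₁ … w₆ …, indexed from 1.
module PeriodicDigits (c₁ : ℤ) (w : ℕ → ℤ) where

  tail : ℕ → ℤ
  tail (suc (suc (suc (suc (suc (suc (suc n))))))) = tail n
  tail n = w n

  digits : ℕ → ℤ
  digits zero          = 0ℤ
  digits (suc zero)    = c₁
  digits (suc (suc n)) = tail n

  private
    tail-+7* : ∀ k n → tail (k ℕ.* 7 ℕ.+ n) ≡ tail n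
    tail-+7* zero    n = ≡.refl
    tail-+7* (suc k) n = tail-+7* k n

  digits-periodic : IsPeriodic digits 1 7
  digits-periodic = s≤s z≤n , λ { (suc n) _ → ≡.trans (cong (λ k → digits (suc k)) (ℕ.+-comm n 1))
    (≡.sym (cong (λ k → digits (suc k)) (≡.trans (ℕ.+-assoc n 1 7) (ℕ.+-comm n 8)))) }

  -- Position 2 + 6m + j moved on by m is 2 + 7m + j, where the tail reads as at j. Any period of
  -- the digits from m on is thus a period of the tail, whatever m is.
  digits-minimal : w 6 ≢ c₁ → (∀ p → 1 ℕ.≤ p → p ℕ.< 7 → ∃[ j ] tail j ≢ tail (j ℕ.+ p)) →
    ∀ m p → IsPeriodic digits m p → 1 ℕ.≤ m × 7 ℕ.≤ p
  digits-minimal w₆≢c₁ aperiodic m p (1≤p , period) = preperiod m p 1≤p period , ℕ.≮⇒≥ λ p<7 →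
    let (j , tail≢) = aperiodic p 1≤p p<7 in tail≢ (begin
      tail j                                   ≡⟨ tail-+7* m j ⟨
      digits (2 ℕ.+ (m ℕ.* 7 ℕ.+ j))           ≡⟨ cong digits (index m j) ⟨
      digits (2 ℕ.+ m ℕ.* 6 ℕ.+ j ℕ.+ m)       ≡⟨ period (2 ℕ.+ m ℕ.* 6 ℕ.+ j) (s≤s z≤n) ⟩
      digits (2 ℕ.+ m ℕ.* 6 ℕ.+ j ℕ.+ m ℕ.+ p) ≡⟨ cong (λ k → digits (k ℕ.+ p)) (index m j) ⟩
      tail (m ℕ.* 7 ℕ.+ j ℕ.+ p)               ≡⟨ cong tail (ℕ.+-assoc (m ℕ.* 7) j p) ⟩
      tail (m ℕ.* 7 ℕ.+ (j ℕ.+ p))             ≡⟨ tail-+7* m (j ℕ.+ p) ⟩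
      tail (j ℕ.+ p)                           ∎)
    where
    open ≡-Reasoning
    module N = ℕSolver.+-*-Solver

    index : ∀ m j → 2 ℕ.+ m ℕ.* 6 ℕ.+ j ℕ.+ m ≡ 2 ℕ.+ (m ℕ.* 7 ℕ.+ j)
    index = N.solve 2 (λ m j → N.con 2 N.:+ m N.:* N.con 6 N.:+ j N.:+ m N.:= N.con 2 N.:+ (m N.:* N.con 7 N.:+ j)) ≡.refl

    -- With m = 0, shifting 7 times by p gives c₁ = w₆.
    preperiod : ∀ m p → 1 ℕ.≤ p → (∀ n → 1 ℕ.≤ n → digits (n ℕ.+ m) ≡ digits (n ℕ.+ m ℕ.+ p)) → 1 ℕ.≤ m
    preperiod (suc m) p _ _ = s≤s z≤n
    preperiod zero (suc p) _ period = contradiction (begin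
      w 6                          ≡⟨ tail-+7* p 6 ⟨
      tail (p ℕ.* 7 ℕ.+ 6)         ≡⟨ cong (λ k → digits (suc k)) (N.solve 1 (λ p → N.con 1 N.:+ (p N.:* N.con 7 N.:+ N.con 6) N.:= N.con 7 N.:* (N.con 1 N.:+ p)) ≡.refl p) ⟩
      digits (suc (7 ℕ.* suc p))   ≡⟨ shifts 7 ⟨
      c₁                           ∎) w₆≢c₁
      where
      shifts : ∀ k → c₁ ≡ digits (suc (k ℕ.* suc p))
      shifts zero    = ≡.refl
      shifts (suc k) = ≡.trans (shifts k) (≡.trans (cong digits (≡.sym (ℕ.+-identityʳ (suc (k ℕ.* suc p)))))
        (≡.trans (period (suc (k ℕ.* suc p)) (s≤s z≤n))
          (cong digits (N.solve 2 (λ x y → N.con 1 N.:+ x N.:+ N.con 0 N.:+ y N.:= N.con 1 N.:+ (y N.:+ x)) ≡.refl (k ℕ.* suc p) (suc p)))))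

-- Existence of the three cofactors

seq-evalℚ : ∀ f x n → seq (evalℚ f x) n ≡ evalᵠ f (seq x n)
seq-evalℚ []      x n = ≡.refl
seq-evalℚ (a ∷ f) x n = cong (λ y → a ℚ.+ seq x n ℚ.* y) (seq-evalℚ f x n)

poly-root : ∀ f lo w → 0ℚ ℚ.≤ w → evalᵠ f lo ℚ.≤ 0ℚ → 0ℚ ℚ.≤ evalᵠ f (lo ℚ.+ w) →
  ∃[ x ] (ℝA.ev f x ≋ 0ᵣ × (∀ n → lo ℚ.≤ seq x n × seq x n ℚ.≤ lo ℚ.+ w))
poly-root f lo w 0≤w f-lo f-hi = root , rootℚ⇒ {f} {root} (isRoot (evalℚ f) evalℚ-cong (seq-evalℚ f)) , left-bounds
  where
  open Bisect (evalᵠ f) lo w 0≤w f-lo f-hi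

  evalℚ-cong : ∀ x y → x ≈ᵣ y → evalℚ f x ≈ᵣ evalℚ f y
  evalℚ-cong x y x≈y = ≡.subst₂ _≈ᵣ_ (eval-ℝ-raw (map fromℚ f) x) (eval-ℝ-raw (map fromℚ f) y)
    (≋⇒≈ᵣ (ℝA.ev-congˣ f (≈ᵣ⇒≋ {x} {y} x≈y)))

-- K(4 - t²) with K(z) = z (z + q)² - (a z + r)², whose roots are the squares
-- of those of the cubic; a root τ gives the conjugate (γ + iτ)/2 of modulus 1.
resolvent : ℚ → ℚ → ℚ → List ℚ
resolvent a q r = (z *ᵠ (zq *ᵠ zq)) -ᵠ (ar *ᵠ ar)
  where
  z zq ar : List ℚ
  z  = 4ℚ ∷ 0ℚ ∷ ℚ.- 1ℚ ∷ []
  zq = z +ᵠ (q ∷ [])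
  ar = map (a ℚ.*_) z +ᵠ (r ∷ [])

module _ (A : ℚ-Algebra) where
  open ℚ-Algebra A
  open ℚ-Solver A
  open import Relation.Binary.Reasoning.Setoid setoid

  ev-resolvent : ∀ a q r t → let z = ι 4ℚ - t * t in
    ev (resolvent a q r) t ≈ z * ((z + ι q) * (z + ι q)) - (ι a * z + ι r) * (ι a * z + ι r)
  ev-resolvent a q r t = trans (ev-- (z *ᵠ (zq *ᵠ zq)) (ar *ᵠ ar) t) (+-cong
    (trans (ev-* z (zq *ᵠ zq) t) (*-cong ev-z (trans (ev-* zq zq t) (*-cong ev-zq ev-zq))))
    (-‿cong (trans (ev-* ar ar t) (*-cong ev-ar ev-ar))))
    where
    z zq ar : List ℚ
    z  = 4ℚ ∷ 0ℚ ∷ ℚ.- 1ℚ ∷ []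
    zq = z +ᵠ (q ∷ [])
    ar = map (a ℚ.*_) z +ᵠ (r ∷ [])

    ev-z : ev z t ≈ ι 4ℚ - t * t
    ev-z = trans (+-congˡ (*-congˡ (+-cong 0#-homo (*-congˡ (+-congʳ (-‿homo 1ℚ))))))
      (solve 1 (λ t → con 4ℚ :+ t :* (con 0ℚ :+ t :* (:- con 1ℚ :+ t :* con 0ℚ)) := con 4ℚ :- t :* t) t)

    ev-constant : ∀ s → ev (s ∷ []) t ≈ ι s
    ev-constant s = solve 2 (λ s t → s :+ t :* con 0ℚ := s) (ι s) t

    ev-zq : ev zq t ≈ (ι 4ℚ - t * t) + ι q
    ev-zq = trans (ev-+ z (q ∷ []) t) (+-cong ev-z (ev-constant q))

    ev-ar : ev ar t ≈ ι a * (ι 4ℚ - t * t) + ι r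
    ev-ar = trans (ev-+ (map (a ℚ.*_) z) (r ∷ []) t)
      (+-cong (trans (ev-scale a z t) (*-congˡ ev-z)) (ev-constant r))

  quadratic-split : ∀ β β′ z → β * β′ ≈ ι 1ℚ →
    (z * z - (β + β′) * z) + ι 1ℚ ≈ (z - β) * (z - β′)
  quadratic-split β β′ z ββ′≈1 = trans (+-congˡ (sym ββ′≈1))
    (solve 3 (λ β β′ z → (z :* z :- (β :+ β′) :* z) :+ β :* β′ := (z :- β) :* (z :- β′)) β β′ z)

  cancel : ∀ x → (x - ι 1ℚ) + (ι 1ℚ - x) ≈ 0#
  cancel = solve 1 (λ x → (x :- con 1ℚ) :+ (con 1ℚ :- x) := con 0ℚ)

  one-horner : ∀ x → ι 1ℚ ≈ ι 1ℚ + x * 0#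
  one-horner = solve 1 (λ x → con 1ℚ := con 1ℚ :+ x :* con 0ℚ)

  one-minus-remainder : ∀ x k → ι 1ℚ - (x - k) ≈ (ι 1ℚ + k) - x
  one-minus-remainder = solve 2 (λ x k → con 1ℚ :- (x :- k) := (con 1ℚ :+ k) :- x)

  sub-zero : ∀ x → x - 0# ≈ x
  sub-zero = solve 1 (λ x → x :- con 0ℚ := x)

-- Absolute values in ℂ

sum-squares≈0 : ∀ {x y} → x ⊗ x ⊕ y ⊗ y ≋ 0ᵣ → x ≋ 0ᵣ
sum-squares≈0 {x} {y} eq = ℝO.≈0-stable λ x≉0 → ℝO.sign {x}
  (λ pos → ℝO.pos+nonNeg≉0 (positive-⊗ pos pos) (ℝO.nonNeg-square y) eq)
  x≉0
  (λ neg → ℝO.pos+nonNeg≉0 (positive-resp (ℝO.neg-*-neg x x) (positive-⊗ neg neg)) (ℝO.nonNeg-square y) eq)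

norm : ℂ → ℝ
norm z = re z ⊗ re z ⊕ im z ⊗ im z

norm-cong : ∀ {z w} → z ≋ᶜ w → norm z ≋ norm w
norm-cong (p , q) = ℝA.+-cong (ℝA.*-cong p p) (ℝA.*-cong q q)

norm≈0 : ∀ {z} → norm z ≋ 0ᵣ → z ≋ᶜ ofℝ 0ᵣ
norm≈0 eq = sum-squares≈0 eq , sum-squares≈0 (ℝA.trans (ℝA.+-comm _ _) eq)

norm-0 : norm (ofℝ 0ᵣ) ≋ 0ᵣ
norm-0 = ℝA.trans (ℝA.+-cong (ℝA.zeroʳ 0ᵣ) (ℝA.zeroʳ 0ᵣ)) (ℝA.+-identityʳ 0ᵣ)

-- The norm is multiplicative and definite, which reduces the claim to ℝ.
ℂ-domain : Domain ℂ-algebra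
ℂ-domain z w zw≈0 z≉0 w≉0 = ℝO.domain (norm z) (norm w)
  (ℝA.trans (ℝA.sym (ComplexIdentities.norm-* ℝ-algebra (re z) (im z) (re w) (im w)))
    (ℝA.trans (norm-cong zw≈0) norm-0))
  (λ eq → z≉0 (norm≈0 eq)) (λ eq → w≉0 (norm≈0 eq))

module Interval (lo hi : ℚ) (d : ℕ → ℤ) where
  lower upper : ℕ → ℚ
  lower zero    = 1ℚ
  lower (suc k) = lo ℚ.* lower k ℚ.- toℚ (d (suc k))
  upper zero    = 1ℚ
  upper (suc k) = hi ℚ.* upper k ℚ.- toℚ (d (suc k))

-- Bounded quantifiers keep this decidable. `p` stands for the candidate period p + 1, between 1 and
-- 6.
Aperiodic : ℤ → (ℕ → ℤ) → Set
Aperiodic c₁ w = ∀ {p} → p ℕ.< 6 → ∃[ j ] (j ℕ.< 7 × tail j ≢ tail (j ℕ.+ suc p))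
  where open PeriodicDigits c₁ w

FractionalRemainders : ℚ → ℚ → (ℕ → ℤ) → Set
FractionalRemainders lo hi d = ∀ {k} → k ℕ.< 7 → 0ℚ ℚ.< lower (suc k) × upper (suc k) ℚ.< 1ℚ
  where open Interval lo hi d

-- Verification that a given root is a Salem number with a given expansion

module SalemWitness
  (a b c q r c₁ : ℤ) (w : ℕ → ℤ) (Q : ℤ[x]) (d lo hi : ℚ)
  (b≡ : toℚ b ≡ toℚ q ℚ.+ 3ℚ) (c≡ : toℚ c ≡ toℚ r ℚ.+ 2ℚ ℚ.* toℚ a)
  (r-odd : Odd r) (a+q-odd : Odd (a ℤ.+ q))
  (d-inverse : (toℚ r ℚ.- toℚ a ℚ.* toℚ q) ℚ.* (toℚ r ℚ.- toℚ a ℚ.* toℚ q) ℚ.* d ≡ 1ℚ)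
  (signs : 0ℚ ℚ.< evalᵠ (toℚ r ∷ toℚ q ∷ toℚ a ∷ 1ℚ ∷ []) 2ℚ ℚ.* evalᵠ (toℚ r ∷ toℚ q ∷ toℚ a ∷ 1ℚ ∷ []) (ℚ.- 2ℚ))
  (w₆≢c₁ : w 6 ≢ c₁) (aperiodic : Aperiodic c₁ w)
  (R≈PQ : companion (PeriodicDigits.digits c₁ w) 1 7 ≈ₚ Reciprocal₆ a b c *ₚ Q)
  (1<lo : 1ℚ ℚ.< lo) (bounds : FractionalRemainders lo hi (PeriodicDigits.digits c₁ w))
  (β τ : ℝ) (β-bounds : ∀ n → lo ℚ.≤ seq β n × seq β n ℚ.≤ hi)
  (β-root : ℝA.ev (map toℚ (Reciprocal₆ a b c)) β ≋ 0ᵣ)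
  (0<τ : 0ᵣ <ᵣ τ) (τ-root : ℝA.ev (resolvent (toℚ a) (toℚ q) (toℚ r)) τ ≋ 0ᵣ)
  where

  open PeriodicDigits c₁ w
  open Interval lo hi digits

  P : ℤ[x]
  P = Reciprocal₆ a b c

  1<β : 1ᵣ <ᵣ β
  1<β = lo ℚ.- 1ℚ , ℚ.<-respˡ-≡ (ℚ.+-inverseʳ 1ℚ) (ℚ.+-monoˡ-< (ℚ.- 1ℚ) 1<lo) , 0 , λ n _ →
    ℚ.≤-trans (ℚ.≤-reflexive (solve 1 (λ l → con 1ℚ :+ (l :- con 1ℚ) := l) lo)) (proj₁ (β-bounds n))
    where open ℚ-Solver₀

  private
    module S = SalemRoots.FromRoots ℝ-ordered (toℚ a) (toℚ b) (toℚ c) (toℚ q) (toℚ r) d b≡ c≡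
      (no-rational-root a q r r-odd a+q-odd) d-inverse signs β τ (<ᵣ⇒positive {1ᵣ} {β} 1<β)
      (positive-resp (sub-zero ℝ-algebra τ) (<ᵣ⇒positive {0ᵣ} {τ} 0<τ)) β-root
      (ℝA.trans (ℝA.sym (ev-resolvent ℝ-algebra (toℚ a) (toℚ q) (toℚ r) τ)) τ-root)

  P-high : ∀ k → 6 ℕ.< k → coeffℤ P k ≡ 0ℤ
  P-high k 6<k = coeff-beyond P k 6<k

  degP : HasDegreeℤ P 6
  degP = (λ ()) , P-high

  evᶻ-P : ℝᶻ.evᶻ P β ≋ 0ᵣ
  evᶻ-P = ℝA.trans (ℝA.reflexive (ℝᶻ.evᶻ≡ev P β)) β-root

  minP : IsMinPoly β P
  minP = independent⇒minPoly {β} {P} {6} S.independent (6 , ≡.refl , P-high) degP evᶻ-P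

  private
    ofℝ-+₃ : ∀ x y z → ofℝ (x ⊕ y ⊕ z) ≋ᶜ ofℝ x ⊕ᶜ ofℝ y ⊕ᶜ ofℝ z
    ofℝ-+₃ x y z = ℂA.trans (ofℝ-⊕ (x ⊕ y) z) (ℂA.+-congʳ (ofℝ-⊕ x y))

    e₁ᶜ : ofℝ (fromℚ (toℚ a)) ≋ᶜ ⊖ᶜ (ofℝ S.γ₀ ⊕ᶜ ofℝ S.γ₁ ⊕ᶜ ofℝ S.γ₂)
    e₁ᶜ = ℂA.trans (ofℝ-cong S.vieta₁) (ℂA.trans (ofℝ-⊖ (S.γ₀ ⊕ S.γ₁ ⊕ S.γ₂)) (ℂA.-‿cong (ofℝ-+₃ S.γ₀ S.γ₁ S.γ₂)))

    e₂ᶜ : ofℝ (fromℚ (toℚ q)) ≋ᶜ ofℝ S.γ₀ ⊗ᶜ ofℝ S.γ₁ ⊕ᶜ ofℝ S.γ₀ ⊗ᶜ ofℝ S.γ₂ ⊕ᶜ ofℝ S.γ₁ ⊗ᶜ ofℝ S.γ₂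
    e₂ᶜ = ℂA.trans (ofℝ-cong S.vieta₂) (ℂA.trans (ofℝ-+₃ (S.γ₀ ⊗ S.γ₁) (S.γ₀ ⊗ S.γ₂) (S.γ₁ ⊗ S.γ₂))
      (ℂA.+-cong (ℂA.+-cong (ofℝ-⊗ S.γ₀ S.γ₁) (ofℝ-⊗ S.γ₀ S.γ₂)) (ofℝ-⊗ S.γ₁ S.γ₂)))

    e₃ᶜ : ofℝ (fromℚ (toℚ r)) ≋ᶜ ⊖ᶜ (ofℝ S.γ₀ ⊗ᶜ ofℝ S.γ₁ ⊗ᶜ ofℝ S.γ₂)
    e₃ᶜ = ℂA.trans (ofℝ-cong S.vieta₃) (ℂA.trans (ofℝ-⊖ (S.γ₀ ⊗ S.γ₁ ⊗ S.γ₂))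
      (ℂA.-‿cong (ℂA.trans (ofℝ-⊗ (S.γ₀ ⊗ S.γ₁) S.γ₂) (ℂA.*-congʳ (ofℝ-⊗ S.γ₀ S.γ₁)))))

    module Rᶜ = Reciprocal ℂ-algebra

    P-factors : ∀ z → ℂᶻ.evᶻ P z ≋ᶜ Rᶜ.quadratic (ofℝ S.γ₀) z ⊗ᶜ (Rᶜ.quadratic (ofℝ S.γ₁) z ⊗ᶜ Rᶜ.quadratic (ofℝ S.γ₂) z)
    P-factors z = ℂA.trans (ℂA.reflexive (ℂᶻ.evᶻ≡ev P z)) (ℂA.trans
      (Rᶜ.sextic-cong z e₁ᶜ
        (ℂA.trans (ℂA.reflexive (cong ℂA.ι b≡)) (ℂA.trans (ℂA.+-homo (toℚ q) 3ℚ) (ℂA.+-congʳ e₂ᶜ)))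
        (ℂA.trans (ℂA.reflexive (cong ℂA.ι c≡)) (ℂA.trans (ℂA.+-homo (toℚ r) (2ℚ ℚ.* toℚ a))
          (ℂA.+-cong e₃ᶜ (ℂA.trans (ℂA.*-homo 2ℚ (toℚ a)) (ℂA.*-congˡ e₁ᶜ))))))
      (Rᶜ.sextic-factor (ofℝ S.γ₀) (ofℝ S.γ₁) (ofℝ S.γ₂) z))

    module _ (γ : ℝ) (z : ℂ) where
      open ComplexIdentities ℝ-algebra

      quadratic-re : re (Rᶜ.quadratic (ofℝ γ) z) ≋ (re z ⊗ re z ⊕ ⊖ (im z ⊗ im z)) ⊕ ⊖ (γ ⊗ re z) ⊕ fromℚ 1ℚ
      quadratic-re = ℝA.+-congʳ (ℝA.+-congˡ (ℝA.-‿cong (real-scale-re γ (re z) (im z))))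

      quadratic-im : im (Rᶜ.quadratic (ofℝ γ) z) ≋ (re z ⊗ im z ⊕ im z ⊗ re z) ⊕ ⊖ (γ ⊗ im z)
      quadratic-im = ℝA.trans (ℝA.+-identityʳ _) (ℝA.+-congˡ (ℝA.-‿cong (real-scale-im γ (re z) (im z))))

    quadratic-unit : ∀ γ → ¬ ¬ Positive (fromℚ 4ℚ ⊕ ⊖ (γ ⊗ γ)) → ∀ z → Rᶜ.quadratic (ofℝ γ) z ≋ᶜ ofℝ 0ᵣ → norm z ≋ 1ᵣ
    quadratic-unit γ ¬¬pos z root = ℝO.unit-modulus (re z) (im z) γ ¬¬pos
      (ℝA.trans (ℝA.sym (quadratic-re γ z)) (re≋ root)) (ℝA.trans (ℝA.sym (quadratic-im γ z)) (im≋ root))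

  -- P is the product of the quadratics z² - γᵢ z + 1. The one for γ₀ has the roots β, which is
  -- excluded, and 1/β; every root of the other two lies on the unit circle.
  conjugate-bound : ∀ α → IsOtherConjugate β α → ∣ α ∣² ≤ᵣ 1ᵣ
  conjugate-bound α (α≉β , P′ , minP′ , root) 1<∣α∣² =
    ℂ-domain (Rᶜ.quadratic (ofℝ S.γ₀) α) (Rᶜ.quadratic (ofℝ S.γ₁) α ⊗ᶜ Rᶜ.quadratic (ofℝ S.γ₂) α)
      (ℂA.trans (ℂA.sym (P-factors α)) P[α]≈0)
      (λ eq → ℂ-domain (α ⊕ᶜ ⊖ᶜ ofℝ β) (α ⊕ᶜ ⊖ᶜ ofℝ S.β′)
        (ℂA.trans (ℂA.sym (ℂA.trans (ℂA.+-congʳ (ℂA.+-congˡ (ℂA.-‿cong (ℂA.*-congʳ (ofℝ-⊕ β S.β′)))))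
          (quadratic-split ℂ-algebra (ofℝ β) (ofℝ S.β′) α (ℂA.trans (ℂA.sym (ofℝ-⊗ β S.β′)) (ofℝ-cong S.ββ′≈1))))) eq)
        (λ α-β≈0 → α≉β (to-≈ᶜ (sub≈0ᶜ α-β≈0)))
        (λ α-β′≈0 → S.0<1-β′² (λ pos → contra-small pos (norm-cong (sub≈0ᶜ α-β′≈0)))))
      (λ eq → ℂ-domain (Rᶜ.quadratic (ofℝ S.γ₁) α) (Rᶜ.quadratic (ofℝ S.γ₂) α) eq
        (λ eq₁ → contra-unit (quadratic-unit S.γ₁ (λ ¬pos → ¬pos S.0<4-γ₁²) α eq₁))
        (λ eq₂ → contra-unit (quadratic-unit S.γ₂ S.0<4-γ₂² α eq₂)))
    where
    P[α]≈0 : ℂᶻ.evᶻ P α ≋ᶜ ofℝ 0ᵣ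
    P[α]≈0 = ℂA.trans (ℂᶻ.evᶻ-cong P P′ α (minPoly-unique {β} {P} {P′} {6} minP degP minP′)) (rootℂ⇒ {P′} {α} root)

    0<norm-1 : Positive (norm α ⊕ ⊖ 1ᵣ)
    0<norm-1 = ≡.subst (λ x → Positive (x ⊕ ⊖ 1ᵣ)) (≡.sym (∣∣²≡ α)) (<ᵣ⇒positive {1ᵣ} {∣ α ∣²} 1<∣α∣²)

    contra-unit : ¬ (norm α ≋ 1ᵣ)
    contra-unit eq = ℝO.pos⇒≉0 0<norm-1 (ℝO.≈⇒-≈0 eq)

    sub≈0ᶜ : ∀ {z w} → z ⊕ᶜ ⊖ᶜ w ≋ᶜ ofℝ 0ᵣ → z ≋ᶜ w
    sub≈0ᶜ (p , q) = ℝO.-≈0⇒≈ p , ℝO.-≈0⇒≈ q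

    to-≈ᶜ : ∀ {z w} → z ≋ᶜ w → z ≈ᶜ w
    to-≈ᶜ (p , q) = ≋⇒≈ᵣ p , ≋⇒≈ᵣ q

    contra-small : Positive (fromℚ 1ℚ ⊕ ⊖ (S.β′ ⊗ S.β′)) → ¬ (norm α ≋ norm (ofℝ S.β′))
    contra-small pos eq = ℝO.pos⇒≉0 (positive-⊕ 0<norm-1 pos)
      (ℝA.trans (ℝA.+-congʳ (ℝA.+-congʳ (ℝA.trans eq
          (ℝA.trans (ℝA.+-congˡ (ℝA.zeroʳ 0ᵣ)) (ℝA.+-identityʳ (S.β′ ⊗ S.β′))))))
        (cancel ℝ-algebra (S.β′ ⊗ S.β′)))

  α : ℂ
  α = S.u +i S.v

  α-conjugate : IsOtherConjugate β α
  α-conjugate = (λ (_ , im≈) → S.v≉0 (≈ᵣ⇒≋ {S.v} {0ᵣ} im≈)) , P , minP , rootℂ⇐ {P} {α} (ℂA.trans (P-factors α)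
    (ℂA.trans (ℂA.*-congˡ (ℂA.trans (ℂA.*-congʳ quadratic≈0) (ℂA.zeroˡ (Rᶜ.quadratic (ofℝ S.γ₂) α)))) (ℂA.zeroʳ (Rᶜ.quadratic (ofℝ S.γ₀) α))))
    where
    quadratic≈0 : Rᶜ.quadratic (ofℝ S.γ₁) α ≋ᶜ ofℝ 0ᵣ
    quadratic≈0 = ℝA.trans (quadratic-re S.γ₁ α) S.quadratic-re , ℝA.trans (quadratic-im S.γ₁ α) S.quadratic-im

  α-unit : ∣ α ∣² ≈ᵣ 1ᵣ
  α-unit = ≡.subst (_≈ᵣ 1ᵣ) (∣∣²≡ α) (≋⇒≈ᵣ S.u²+v²≈1)

  salem : IsSalem β
  salem = (P , proj₁ minP , proj₁ (proj₂ minP)) , 1<β , conjugate-bound , α , α-conjugate , α-unit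

  private
    open Expansion β digits using (ρ; ρ≡remainder; β⊗ρ≡)

    0<lo : 0ℚ ℚ.< lo
    0<lo = ℚ.<-trans (ℚ.positive⁻¹ 1ℚ) 1<lo

    lower-nonneg : ∀ k → k ℕ.≤ 7 → 0ℚ ℚ.≤ lower k
    lower-nonneg zero    _   = ℚ.<⇒≤ (ℚ.positive⁻¹ 1ℚ)
    lower-nonneg (suc k) k<7 = ℚ.<⇒≤ (proj₁ (bounds k<7))

    -- Interval arithmetic may multiply lower ends with lower ends and upper with upper, since β and
    -- the lower bounds of the remainders are nonnegative.
    enclosure : ∀ k → k ℕ.≤ 7 → ∀ n →
      lower k ℚ.≤ seq (remainder β digits k) n × seq (remainder β digits k) n ℚ.≤ upper k
    enclosure zero    _   n = ℚ.≤-refl , ℚ.≤-refl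
    enclosure (suc k) k<7 n = ℚ.+-monoˡ-≤ (ℚ.- toℚ (digits (suc k))) below , ℚ.+-monoˡ-≤ (ℚ.- toℚ (digits (suc k))) above
      where
      x = seq β n
      y = seq (remainder β digits k) n
      IH = enclosure k (ℕ.<⇒≤ k<7) n
      0≤lower = lower-nonneg k (ℕ.<⇒≤ k<7)
      0≤hi = ℚ.≤-trans (ℚ.<⇒≤ 0<lo) (ℚ.≤-trans (proj₁ (β-bounds n)) (proj₂ (β-bounds n)))

      below : lo ℚ.* lower k ℚ.≤ x ℚ.* y
      below = ℚ.≤-trans (ℚ.*-monoʳ-≤-nonNeg (lower k) {{ℚ.nonNegative 0≤lower}} (proj₁ (β-bounds n)))
        (ℚ.*-monoˡ-≤-nonNeg x {{ℚ.nonNegative (ℚ.≤-trans (ℚ.<⇒≤ 0<lo) (proj₁ (β-bounds n)))}} (proj₁ IH))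

      above : x ℚ.* y ℚ.≤ hi ℚ.* upper k
      above = ℚ.≤-trans (ℚ.*-monoʳ-≤-nonNeg y {{ℚ.nonNegative (ℚ.≤-trans 0≤lower (proj₁ IH))}} (proj₂ (β-bounds n)))
        (ℚ.*-monoˡ-≤-nonNeg hi {{ℚ.nonNegative 0≤hi}} (proj₂ IH))

    Fractional : ℝ → Set
    Fractional x = Positive x × Positive (1ᵣ ⊕ ⊖ x)

    fractional-resp : ∀ {x y} → x ≋ y → Fractional x → Fractional y
    fractional-resp x≋y (pos , <1) = positive-resp x≋y pos , positive-resp (ℝA.+-congˡ (ℝA.-‿cong x≋y)) <1

    first-remainders : ∀ k → k ℕ.< 7 → Fractional (ρ (suc k))
    first-remainders k k<7 = ≡.subst Fractional (≡.sym (ρ≡remainder (suc k)))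
      ( positive-resp (sub-zero ℝ-algebra x) (<ᵣ⇒positive {0ᵣ} {x}
          (lower (suc k) , proj₁ (bounds k<7) , 0 , λ n _ →
            ℚ.≤-trans (ℚ.≤-reflexive (ℚ.+-identityˡ (lower (suc k)))) (proj₁ (enclosure (suc k) k<7 n))))
      , <ᵣ⇒positive {x} {1ᵣ} (1ℚ ℚ.- upper (suc k) , gap (proj₂ (bounds k<7)) , 0 , λ n _ →
            ℚ.≤-trans (ℚ.+-monoˡ-≤ (1ℚ ℚ.- upper (suc k)) (proj₂ (enclosure (suc k) k<7 n)))
              (ℚ.≤-reflexive (fill (upper (suc k))))) )
      where
      open ℚ-Solver₀
      x = remainder β digits (suc k)

      fill : ∀ u → u ℚ.+ (1ℚ ℚ.- u) ≡ 1ℚ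
      fill = solve 1 (λ u → u :+ (con 1ℚ :- u) := con 1ℚ)

      gap : ∀ {u} → u ℚ.< 1ℚ → 0ℚ ℚ.< 1ℚ ℚ.- u
      gap {u} u<1 = ℚ.<-respˡ-≡ (ℚ.+-inverseʳ u) (ℚ.+-monoˡ-< (ℚ.- u) u<1)

    -- The k-th remainder is P_k(β). Hence ρ₈ - ρ₁ is the companion polynomial at β, the remainders
    -- repeat, and enclosures of the first seven are sufficient.
    ρ≋expansionPoly : ∀ k → ρ k ≋ ℝᶻ.evᶻ (expansionPoly digits k) β
    ρ≋expansionPoly zero    = one-horner ℝ-algebra β
    ρ≋expansionPoly (suc k) = ℝA.trans (ℝA.+-comm (β ⊗ ρ k) (⊖ fromℤ (digits (suc k))))
      (ℝA.+-cong (ℝA.sym (ℝA.trans (ℝA.reflexive (cong fromℚ (toℚ-neg (digits (suc k))))) (ℝA.-‿homo (toℚ (digits (suc k))))))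
        (ℝA.*-congˡ (ρ≋expansionPoly k)))

    ρ₈≋ρ₁ : ρ 8 ≋ ρ 1
    ρ₈≋ρ₁ = ℝO.-≈0⇒≈ (ℝA.trans (ℝA.+-cong (ρ≋expansionPoly 8) (ℝA.-‿cong (ρ≋expansionPoly 1)))
      (ℝA.trans (ℝA.sym (ℝᶻ.evᶻ-- (expansionPoly digits 8) (expansionPoly digits 1) β))
        (ℝA.trans (ℝᶻ.evᶻ-cong (companion digits 1 7) (P *ₚ Q) β R≈PQ)
          (ℝA.trans (ℝᶻ.evᶻ-* P Q β) (ℝA.trans (ℝA.*-congʳ evᶻ-P) (ℝA.zeroˡ (ℝᶻ.evᶻ Q β)))))))

    ρ-periodic : ∀ k → ρ (suc (7 ℕ.+ k)) ≋ ρ (suc k)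
    ρ-periodic zero    = ρ₈≋ρ₁
    ρ-periodic (suc k) = ℝA.+-congʳ (ℝA.*-congˡ (ρ-periodic k))

    fractional : ∀ k → Fractional (ρ (suc k))
    fractional 0 = first-remainders 0 (ℕ.≤ᵇ⇒≤ 1 7 _)
    fractional 1 = first-remainders 1 (ℕ.≤ᵇ⇒≤ 2 7 _)
    fractional 2 = first-remainders 2 (ℕ.≤ᵇ⇒≤ 3 7 _)
    fractional 3 = first-remainders 3 (ℕ.≤ᵇ⇒≤ 4 7 _)
    fractional 4 = first-remainders 4 (ℕ.≤ᵇ⇒≤ 5 7 _)
    fractional 5 = first-remainders 5 (ℕ.≤ᵇ⇒≤ 6 7 _)
    fractional 6 = first-remainders 6 (ℕ.≤ᵇ⇒≤ 7 7 _)
    fractional (suc (suc (suc (suc (suc (suc (suc k))))))) = fractional-resp (ℝA.sym (ρ-periodic k)) (fractional k)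

    greedy : IsGreedyExpansion β digits
    greedy n = ≡.subst (λ x → IsFloor x (digits (suc n))) (β⊗ρ≡ n)
      ( (λ below → ℝO.pos⇒nonNeg (proj₁ (fractional n)) (positive-resp (ℝA.sym (ℝF.neg-sub (β ⊗ ρ n) (fromℤ (digits (suc n)))))
          (<ᵣ⇒positive {β ⊗ ρ n} {fromℤ (digits (suc n))} below)))
      , positive⇒<ᵣ {β ⊗ ρ n} {fromℤ (ℤ.suc (digits (suc n)))}
          (positive-resp (ℝA.trans (one-minus-remainder ℝ-algebra (β ⊗ ρ n) (fromℤ (digits (suc n))))
            (ℝA.+-congʳ (ℝA.sym (ℝF.ιᶻ-suc (digits (suc n)))))) (proj₂ (fractional n))) )

    remainder≉0 : ∀ n → ¬ (remainder β digits n ≈ᵣ 0ᵣ)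
    remainder≉0 n eq = nonzero n (≡.subst (_≋ 0ᵣ) (≡.sym (ρ≡remainder n)) (≈ᵣ⇒≋ {remainder β digits n} {0ᵣ} eq))
      where
      nonzero : ∀ n → ¬ (ρ n ≋ 0ᵣ)
      nonzero zero    = ℝO.nonTrivial
      nonzero (suc n) = ℝO.pos⇒≉0 (proj₁ (fractional n))

  parry : IsParryExpansion β digits 1 7
  parry = greedy , remainder≉0 , digits-periodic , digits-minimal w₆≢c₁
    λ { (suc p) _ (s≤s p<6) → let (j , _ , tail≢) = aperiodic p<6 in j , tail≢ }

  member : Λ 6 1 7 Q
  member = β , (salem , P , minP , degP) , (salem , digits , parry) ,
    (salem , digits , 1 , 7 , parry , P , minP , R≈PQ)

-- Everything about β that is checked by computation, from enclosures of β
-- in [lo, lo + δ] and of τ in [lo′, lo′ + δ′].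
module Certificate (a q r c₁ : ℤ) (w : ℕ → ℤ) (Q₀ : ℤ[x]) (d lo δ lo′ δ′ : ℚ) where

  b c : ℤ
  b = q ℤ.+ + 3
  c = r ℤ.+ + 2 ℤ.* a

  P : ℤ[x]
  P = Reciprocal₆ a b c

  f G K : List ℚ
  f = map toℚ P
  G = toℚ r ∷ toℚ q ∷ toℚ a ∷ 1ℚ ∷ []
  K = resolvent (toℚ a) (toℚ q) (toℚ r)

  disc : ℚ
  disc = (toℚ r ℚ.- toℚ a ℚ.* toℚ q) ℚ.* (toℚ r ℚ.- toℚ a ℚ.* toℚ q)

  open PeriodicDigits c₁ w
  open Interval lo (lo ℚ.+ δ) digits

  Certified : Set
  Certified =
    disc ℚ.* d ≡ 1ℚ × 0ℚ ℚ.< evalᵠ G 2ℚ ℚ.* evalᵠ G (ℚ.- 2ℚ) ×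
    w 6 ≢ c₁ × Aperiodic c₁ w ×
    1ℚ ℚ.< lo × FractionalRemainders lo (lo ℚ.+ δ) digits ×
    0ℚ ℚ.≤ δ × evalᵠ f lo ℚ.≤ 0ℚ × 0ℚ ℚ.≤ evalᵠ f (lo ℚ.+ δ) ×
    0ℚ ℚ.< lo′ × 0ℚ ℚ.≤ δ′ × evalᵠ K lo′ ℚ.≤ 0ℚ × 0ℚ ℚ.≤ evalᵠ K (lo′ ℚ.+ δ′)

  certified? : Dec Certified
  certified? =
    (disc ℚ.* d ℚ.≟ 1ℚ) ×-dec (0ℚ ℚ.<? evalᵠ G 2ℚ ℚ.* evalᵠ G (ℚ.- 2ℚ)) ×-dec
    ¬? (w 6 ℤ.≟ c₁) ×-dec ℕ.allUpTo? (λ p → ℕ.anyUpTo? (λ j → ¬? (tail j ℤ.≟ tail (j ℕ.+ suc p))) 7) 6 ×-dec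
    (1ℚ ℚ.<? lo) ×-dec ℕ.allUpTo? (λ k → (0ℚ ℚ.<? lower (suc k)) ×-dec (upper (suc k) ℚ.<? 1ℚ)) 7 ×-dec
    (0ℚ ℚ.≤? δ) ×-dec (evalᵠ f lo ℚ.≤? 0ℚ) ×-dec (0ℚ ℚ.≤? evalᵠ f (lo ℚ.+ δ)) ×-dec
    (0ℚ ℚ.<? lo′) ×-dec (0ℚ ℚ.≤? δ′) ×-dec (evalᵠ K lo′ ℚ.≤? 0ℚ) ×-dec (0ℚ ℚ.≤? evalᵠ K (lo′ ℚ.+ δ′))

  cofactor∈Λ : True certified? → Odd r → Odd (a ℤ.+ q) → companion digits 1 7 ≡ P *ₚ Q₀ →
    ∀ {Q} → Q ≈ₚ Q₀ → Λ 6 1 7 Q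
  cofactor∈Λ certified r-odd a+q-odd R≡PQ₀ {Q} Q≈Q₀ = go (toWitness certified)
    where
    go : Certified → Λ 6 1 7 Q
    go (d-inverse , signs , w₆≢c₁ , aperiodic , 1<lo , bounds , 0≤δ , f-lo , f-hi , 0<lo′ , 0≤δ′ , K-lo , K-hi) =
      build (poly-root f lo δ 0≤δ f-lo f-hi) (poly-root K lo′ δ′ 0≤δ′ K-lo K-hi)
      where
      build : ∃[ x ] (ℝA.ev f x ≋ 0ᵣ × (∀ n → lo ℚ.≤ seq x n × seq x n ℚ.≤ lo ℚ.+ δ)) →
        ∃[ x ] (ℝA.ev K x ≋ 0ᵣ × (∀ n → lo′ ℚ.≤ seq x n × seq x n ℚ.≤ lo′ ℚ.+ δ′)) → Λ 6 1 7 Q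
      build (β , β-root , β-bounds) (τ , τ-root , τ-bounds) = SalemWitness.member a b c q r c₁ w Q d lo (lo ℚ.+ δ)
        (toℚ-+ q (+ 3)) (≡.trans (toℚ-+ r (+ 2 ℤ.* a)) (cong (toℚ r ℚ.+_) (toℚ-* (+ 2) a)))
        r-odd a+q-odd d-inverse signs w₆≢c₁ aperiodic
        (λ k → ≡.trans (cong (λ F → coeffℤ F k) R≡PQ₀) (≡.sym (*ₚ-congʳ P Q Q₀ Q≈Q₀ k)))
        1<lo bounds β τ β-bounds β-root
        (lo′ , 0<lo′ , 0 , λ n _ → ℚ.≤-trans (ℚ.≤-reflexive (ℚ.+-identityˡ lo′)) (proj₁ (τ-bounds n)))
        τ-root

word : ℤ → ℤ → ℤ → ℤ → ℤ → ℤ → ℤ → ℕ → ℤ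
word w₀ w₁ w₂ w₃ w₄ w₅ w₆ 0 = w₀
word w₀ w₁ w₂ w₃ w₄ w₅ w₆ 1 = w₁
word w₀ w₁ w₂ w₃ w₄ w₅ w₆ 2 = w₂
word w₀ w₁ w₂ w₃ w₄ w₅ w₆ 3 = w₃
word w₀ w₁ w₂ w₃ w₄ w₅ w₆ 4 = w₄
word w₀ w₁ w₂ w₃ w₄ w₅ w₆ 5 = w₅
word w₀ w₁ w₂ w₃ w₄ w₅ w₆ _ = w₆

-- The Salem numbers 1.9878…, 3.0722… and 5.7213…, with expansions
-- 1 (1111100)^∞, 3 (0020022)^∞ and 5 (4040444)^∞.
cofactor⊇ : Cofactors ⊆ Λ 6 1 7
cofactor⊇ (inj₁ Q≈) = Certificate.cofactor∈Λ 0ℤ (ℤ.- + 5) (ℤ.- + 3) (+ 1)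
  (word (+ 1) (+ 1) (+ 1) (+ 1) (+ 1) (+ 0) (+ 0)) (1ℤ ∷ -1ℤ ∷ 1ℤ ∷ [])
  -- In each of the three calls this row holds d = 1/(r - a q)², then the left end and the width of
  -- the interval for β, then the same for τ. Each step multiplies the error of a remainder by about
  -- β, hence the narrower interval for a larger β.
  (+ 1 ℚ./ 9) (+ 127 ℚ./ 64) (+ 1 ℚ./ 256) ½ ½
  -- The underscore is the evidence for `True certified?`, found by evaluating the decision; the
  -- pairs write r and a + q as 1 + 2k, and the last `≡.refl` multiplies out P Q.
  _ (ℤ.- + 2 , ≡.refl) (ℤ.- + 3 , ≡.refl) ≡.refl Q≈
cofactor⊇ (inj₂ (inj₁ Q≈)) = Certificate.cofactor∈Λ (ℤ.- + 3) (ℤ.- + 4) (+ 9) (+ 3)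
  (word (+ 0) (+ 0) (+ 2) (+ 0) (+ 0) (+ 2) (+ 2)) (1ℤ ∷ 0ℤ ∷ 1ℤ ∷ [])
  (+ 1 ℚ./ 9) (+ 6291 ℚ./ 2048) (+ 1 ℚ./ 2048) ½ ½
  _ (+ 4 , ≡.refl) (ℤ.- + 4 , ≡.refl) ≡.refl Q≈
cofactor⊇ (inj₂ (inj₂ Q≈)) = Certificate.cofactor∈Λ (ℤ.- + 7) (+ 6) (+ 3) (+ 5)
  (word (+ 4) (+ 0) (+ 4) (+ 0) (+ 4) (+ 4) (+ 4)) (1ℤ ∷ + 2 ∷ 1ℤ ∷ [])
  (+ 1 ℚ./ 2025) (+ 749901 ℚ./ 131072) (+ 1 ℚ./ 262144) 1ℚ ½
  _ (+ 1 , ≡.refl) (ℤ.- + 1 , ≡.refl) ≡.refl Q≈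

proposition3p4 : Λ 6 1 7 ≐
    (_≈ₚ (1ℤ ∷ -1ℤ ∷ 1ℤ ∷ [])) ∪
    (_≈ₚ (1ℤ ∷ 0ℤ ∷ 1ℤ ∷ [])) ∪
    (_≈ₚ (1ℤ ∷ + 2 ∷ 1ℤ ∷ []))
proposition3p4 = cofactor⊆ , cofactor⊇
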